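{- Let $p\in(0,1)$ and $q=1-p$. For any positive integers $K$ and $n$, the expected matching loss of the $K$-chain graph $C_{n,K}$ satisfies $$npq^{K}\left(\frac{(1-q^K)^2}{2-q^K}-\exp\left(-\frac{(n-3K-2)\,pq^K}{2}\right)\right)-1\ \le\ L(C_{n,K})\ \le\ npq^K\left(\frac{(1-q^K)^2}{2-q^K}+q^K+1\right)+1 .$$
   Context: The $K$-chain graph $C_{n,K}$ has vertex set $[n]$ placed in order on a circle; distinct $i,j$ are adjacent iff their circular distance $\min\{|i-j|,\,n-|i-j|\}$ is at most $K$. Under $\mathcal D_p$, the demands $D_j$, $j\in[n]$, are independent, each equal to $1/2$ with probability $p$ and $1$ with probability $q=1-p$. Let $\mathrm{supp}(D)=\{j:D_j=1/2\}$ and let $G[\mathrm{supp}(D)]$ be the induced subgraph. $\mu(H)$ is the maximum matching size of $H$. With $K_n$ the complete graph on $[n]$, $L(G)=2\,\mathbb E_{D\sim\mathcal D_p}\bigl[\mu(K_n[\mathrm{supp}(D)])-\mu(G[\mathrm{supp}(D)])\bigr]$. -}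

module Defs where

open import Algebra.Bundles using (RawSemiring)
import Algebra.Definitions.RawSemiring as RawSemiringDefs
open import Data.Fin.Base using (Fin; toℕ)
import Data.Fin.Properties as Fin
open import Data.Fin.Subset using (Subset; ⊤; _∩_; _∈_)
open import Data.Fin.Subset.Properties using (_∈?_; ∈⊤; x∈p∩q⁺)
open import Data.Integer.Base as ℤ using (+_)
import Data.Integer.Properties as ℤ
open import Data.List.Base as List using (List; []; _∷_; _++_)
open import Data.List.Extrema.Nat using (max)
open import Data.List.Relation.Unary.AllPairs using (AllPairs; allPairs?)
open import Data.Nat.Base as ℕ using (ℕ; zero; suc; _!)
import Data.Nat.Properties as ℕ
open import Data.Nat.Properties using (_!≢0)
open import Data.Product.Base using (∃; _×_; _,_; proj₁; proj₂)
import Data.Rational.Base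
open import Data.Rational.Base as ℚ using (ℚ; 0ℚ; 1ℚ; ½)
import Data.Rational.Properties as ℚ
open import Data.Rational.Solver using (module +-*-Solver)
open import Data.Rational.Unnormalised.Base as ℚᵘ using (mkℚᵘ)
import Data.Rational.Unnormalised.Properties as ℚᵘ
open import Data.Sum.Base using (inj₁; inj₂)
open import Data.Vec.Base as Vec using (Vec; []; _∷_)
open import Level using (0ℓ)
open import Relation.Binary.Core using (Rel)
open import Relation.Binary.Definitions using (Decidable; Irreflexive; Symmetric)
open import Relation.Binary.PropositionalEquality
  using (_≡_; _≢_; refl; sym; trans; cong; cong₂; subst; subst₂; ≢-sym; module ≡-Reasoning)
open import Relation.Nullary using (yes; no; does; contradiction; _×-dec_; ¬?)

module Sequences where

  open Data.Rational.Base
  open RawSemiringDefs +-*-rawSemiring using (_^_) public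
  open +-*-Solver using (solve; _:+_; _:*_; _:-_; :-_; con; _:=_)

  IsCauchy : (ℕ → ℚ) → Set
  IsCauchy u = ∀ ε → 0ℚ < ε →
    ∃ λ N → ∀ m n → N ℕ.≤ m → N ℕ.≤ n → ∣ u m - u n ∣ < ε

  ι : ℕ → ℚ
  ι k = + k / 1

  1/! : ℕ → ℚ
  1/! k = _/_ (+ 1) (k !) {{k !≢0}}

  -- Σ_{k<N} xᵏ/k!
  expSum : ℕ → ℚ → ℚ
  expSum zero    x = 0ℚ
  expSum (suc k) x = expSum k x + x ^ k * 1/! k

  -- Total reciprocal with the junk value inv 0 = 0.
  inv : ℚ → ℚ
  inv x with x ℚ.≟ 0ℚ
  ... | yes _  = 0ℚ
  ... | no x≢0 = (1/ x) {{≢-nonZero x≢0}}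

  0≤1 : 0ℚ ≤ 1ℚ
  0≤1 = *≤* (ℤ.+≤+ ℕ.z≤n)

  0<1 : 0ℚ < 1ℚ
  0<1 = *<* (ℤ.+<+ (ℕ.s≤s ℕ.z≤n))

  0<½ : 0ℚ < ½
  0<½ = *<* (ℤ.+<+ (ℕ.s≤s ℕ.z≤n))

  *-mono : ∀ {a b c d} → 0ℚ ≤ b → 0ℚ ≤ c → a ≤ b → c ≤ d → a * c ≤ b * d
  *-mono {a} {b} {c} {d} 0≤b 0≤c a≤b c≤d = ℚ.≤-trans
    (ℚ.*-monoʳ-≤-nonNeg c {{nonNegative 0≤c}} a≤b)
    (ℚ.*-monoˡ-≤-nonNeg b {{nonNegative 0≤b}} c≤d)

  *-nonNeg : ∀ {a b} → 0ℚ ≤ a → 0ℚ ≤ b → 0ℚ ≤ a * b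
  *-nonNeg {a} {b} 0≤a 0≤b =
    subst (_≤ a * b) (ℚ.*-zeroʳ a) (ℚ.*-monoˡ-≤-nonNeg a {{nonNegative 0≤a}} 0≤b)

  *-pos : ∀ {a b} → 0ℚ < a → 0ℚ < b → 0ℚ < a * b
  *-pos {a} {b} 0<a 0<b =
    subst (_< a * b) (ℚ.*-zeroʳ a) (ℚ.*-monoʳ-<-pos a {{positive 0<a}} 0<b)

  +-nonNeg : ∀ {a b} → 0ℚ ≤ a → 0ℚ ≤ b → 0ℚ ≤ a + b
  +-nonNeg = ℚ.+-mono-≤

  ≤-step : ∀ {a b} → 0ℚ ≤ b → a ≤ a + b
  ≤-step {a} 0≤b = subst (_≤ a + _) (ℚ.+-identityʳ a) (ℚ.+-monoʳ-≤ a 0≤b)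

  ≤⇒0≤- : ∀ {a b} → a ≤ b → 0ℚ ≤ b - a
  ≤⇒0≤- {a} {b} a≤b = subst (_≤ b - a) (ℚ.+-inverseʳ a) (ℚ.+-monoˡ-≤ (- a) a≤b)

  0≤-⇒≤ : ∀ {a b} → 0ℚ ≤ b - a → a ≤ b
  0≤-⇒≤ {a} {b} h = subst (a ≤_)
    (solve 2 (λ a b → a :+ (b :- a) := b) refl a b) (≤-step h)

  ∣∣≤ : ∀ {a c} → a ≤ c → - a ≤ c → ∣ a ∣ ≤ c
  ∣∣≤ {a} {c} h h′ with ℚ.∣p∣≡p∨∣p∣≡-p a
  ... | inj₁ eq = subst (_≤ c) (sym eq) h
  ... | inj₂ eq = subst (_≤ c) (sym eq) h′

  p≤∣p∣ : ∀ a → a ≤ ∣ a ∣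
  p≤∣p∣ a with ℚ.≤-total 0ℚ a
  ... | inj₁ 0≤a = ℚ.≤-reflexive (sym (ℚ.0≤p⇒∣p∣≡p 0≤a))
  ... | inj₂ a≤0 = ℚ.≤-trans a≤0 (ℚ.0≤∣p∣ a)

  ∣-∣-sym : ∀ a b → ∣ a - b ∣ ≡ ∣ b - a ∣
  ∣-∣-sym a b = trans (sym (ℚ.∣-p∣≡∣p∣ (a - b)))
    (cong ∣_∣ (solve 2 (λ a b → :- (a :- b) := b :- a) refl a b))

  interval : ∀ {a c u v} → a ≤ u → u ≤ a + c → a ≤ v → v ≤ a + c → ∣ u - v ∣ ≤ c
  interval {a} {c} {u} {v} a≤u u≤ a≤v v≤ = ∣∣≤ (half u≤ a≤v)
    (subst (_≤ c) (solve 2 (λ u v → v :- u := :- (u :- v)) refl u v) (half v≤ a≤u))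
    where
    half : ∀ {x y} → x ≤ a + c → a ≤ y → x - y ≤ c
    half {x} {y} x≤ a≤y = subst (x - y ≤_)
      (solve 2 (λ a c → (a :+ c) :- a := c) refl a c)
      (ℚ.+-mono-≤ x≤ (ℚ.neg-antimono-≤ a≤y))

  1/-pos : ∀ {w} (0<w : 0ℚ < w) → 0ℚ < (1/ w) {{>-nonZero 0<w}}
  1/-pos {w} 0<w = ℚ.positive⁻¹ _ {{ℚ.1/pos⇒pos w {{positive 0<w}}}}

  *-1/ : ∀ {w} (0<w : 0ℚ < w) a → w * (a * (1/ w) {{>-nonZero 0<w}}) ≡ a
  *-1/ {w} 0<w a = begin
    w * (a * i)  ≡⟨ solve 3 (λ w a i → w :* (a :* i) := (w :* i) :* a) refl w a i ⟩
    (w * i) * a  ≡⟨ cong (_* a) (ℚ.*-inverseʳ w {{>-nonZero 0<w}}) ⟩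
    1ℚ * a       ≡⟨ ℚ.*-identityˡ a ⟩
    a            ∎
    where
    open ≡-Reasoning
    i = (1/ w) {{>-nonZero 0<w}}

  ∣*∣ : ∀ a {r} → 0ℚ ≤ r → ∣ a * r ∣ ≡ ∣ a ∣ * r
  ∣*∣ a {r} 0≤r = trans (ℚ.∣p*q∣≡∣p∣*∣q∣ a r) (cong (λ z → ∣ a ∣ * z) (ℚ.0≤p⇒∣p∣≡p 0≤r))

  ½+½ : ∀ a → ½ * a + ½ * a ≡ a
  ½+½ = solve 1 (λ a → con ½ :* a :+ con ½ :* a := a) refl

  toℚᵘ-ι : ∀ k → toℚᵘ (ι k) ℚᵘ.≃ mkℚᵘ (+ k) 0
  toℚᵘ-ι k = ℚ.toℚᵘ-fromℚᵘ (mkℚᵘ (+ k) 0)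

  ι-+ : ∀ j k → ι (j ℕ.+ k) ≡ ι j + ι k
  ι-+ j k = ℚ.toℚᵘ-injective (begin
    toℚᵘ (ι (j ℕ.+ k))              ≈⟨ toℚᵘ-ι (j ℕ.+ k) ⟩
    mkℚᵘ (+ (j ℕ.+ k)) 0            ≈⟨ ℚᵘ.*≡* (cong (ℤ._* + 1) (cong₂ ℤ._+_
                                         (sym (ℤ.*-identityʳ (+ j))) (sym (ℤ.*-identityʳ (+ k))))) ⟩
    mkℚᵘ (+ j) 0 ℚᵘ.+ mkℚᵘ (+ k) 0  ≈⟨ ℚᵘ.+-cong (toℚᵘ-ι j) (toℚᵘ-ι k) ⟨
    toℚᵘ (ι j) ℚᵘ.+ toℚᵘ (ι k)      ≈⟨ ℚ.toℚᵘ-homo-+ (ι j) (ι k) ⟨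
    toℚᵘ (ι j + ι k)                ∎) where open ℚᵘ.≃-Reasoning

  ι-* : ∀ j k → ι (j ℕ.* k) ≡ ι j * ι k
  ι-* j k = ℚ.toℚᵘ-injective (begin
    toℚᵘ (ι (j ℕ.* k))              ≈⟨ toℚᵘ-ι (j ℕ.* k) ⟩
    mkℚᵘ (+ (j ℕ.* k)) 0            ≈⟨ ℚᵘ.*≡* (cong (ℤ._* + 1) (ℤ.pos-* j k)) ⟩
    mkℚᵘ (+ j) 0 ℚᵘ.* mkℚᵘ (+ k) 0  ≈⟨ ℚᵘ.*-cong (toℚᵘ-ι j) (toℚᵘ-ι k) ⟨
    toℚᵘ (ι j) ℚᵘ.* toℚᵘ (ι k)      ≈⟨ ℚ.toℚᵘ-homo-* (ι j) (ι k) ⟨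
    toℚᵘ (ι j * ι k)                ∎) where open ℚᵘ.≃-Reasoning

  1/-ι : ∀ m .{{_ : ℕ.NonZero m}} → (+ 1 / m) * ι m ≡ 1ℚ
  1/-ι m@(suc k) = ℚ.toℚᵘ-injective (begin
    toℚᵘ ((+ 1 / m) * ι m)            ≈⟨ ℚ.toℚᵘ-homo-* (+ 1 / m) (ι m) ⟩
    toℚᵘ (+ 1 / m) ℚᵘ.* toℚᵘ (ι m)    ≈⟨ ℚᵘ.*-cong (ℚ.toℚᵘ-fromℚᵘ (mkℚᵘ (+ 1) k)) (toℚᵘ-ι m) ⟩
    mkℚᵘ (+ 1) k ℚᵘ.* mkℚᵘ (+ m) 0    ≈⟨ ℚᵘ.*≡* (cong +_ (trans (ℕ.*-identityʳ _) (trans (ℕ.*-identityˡ m)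
                                           (sym (trans (ℕ.*-identityˡ _) (ℕ.*-identityʳ m)))))) ⟩
    toℚᵘ 1ℚ                           ∎) where open ℚᵘ.≃-Reasoning

  0≤ι : ∀ k → 0ℚ ≤ ι k
  0≤ι k = ℚ.nonNegative⁻¹ (ι k) {{ℚ.normalize-nonNeg k 1}}

  ι-mono : ∀ {j k} → j ℕ.≤ k → ι j ≤ ι k
  ι-mono {j} {k} j≤k = subst (ι j ≤_)
    (trans (sym (ι-+ j (k ℕ.∸ j))) (cong ι (ℕ.m+[n∸m]≡n j≤k))) (≤-step (0≤ι (k ℕ.∸ j)))

  0<ι : ∀ k → 0ℚ < ι (suc k)
  0<ι k = ℚ.<-≤-trans 0<1 (ι-mono (ℕ.s≤s (ℕ.z≤n {k})))

  archimedean : ∀ q → ∃ λ k → q ≤ ι k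
  archimedean q@(mkℚ n d-1 _) = ℤ.∣ n ∣ ,
    ℚ.toℚᵘ-cancel-≤ (ℚᵘ.≤-respʳ-≃ (ℚᵘ.≃-sym (toℚᵘ-ι ℤ.∣ n ∣)) (ℚᵘ.*≤* (begin
      n ℤ.* + 1               ≡⟨ ℤ.*-identityʳ n ⟩
      n                       ≤⟨ n≤∣n∣ n ⟩
      + ℤ.∣ n ∣               ≤⟨ ℤ.+≤+ (ℕ.m≤m*n ℤ.∣ n ∣ (suc d-1)) ⟩
      + (ℤ.∣ n ∣ ℕ.* suc d-1) ≡⟨ ℤ.pos-* ℤ.∣ n ∣ (suc d-1) ⟩
      + ℤ.∣ n ∣ ℤ.* + suc d-1 ∎)))
    where
    open ℤ.≤-Reasoning
    n≤∣n∣ : ∀ i → i ℤ.≤ + ℤ.∣ i ∣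
    n≤∣n∣ (+ _)        = ℤ.≤-refl
    n≤∣n∣ (ℤ.-[1+ _ ]) = ℤ.-≤+

  1/!-suc : ∀ k → 1/! (suc k) * ι (suc k) ≡ 1/! k
  1/!-suc k = begin
    r′ * s             ≡⟨ solve 2 (λ r′ s → r′ :* s := (r′ :* s) :* con 1ℚ) refl r′ s ⟩
    (r′ * s) * 1ℚ      ≡⟨ cong ((r′ * s) *_) (1/-ι (k !) {{k !≢0}}) ⟨
    (r′ * s) * (r * f) ≡⟨ solve 4 (λ r′ s r f → (r′ :* s) :* (r :* f) := (r′ :* (s :* f)) :* r) refl r′ s r f ⟩
    (r′ * (s * f)) * r ≡⟨ cong (λ z → (r′ * z) * r) (ι-* (suc k) (k !)) ⟨
    (r′ * ι (suc k !)) * r ≡⟨ cong (_* r) (1/-ι (suc k !) {{suc k !≢0}}) ⟩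
    1ℚ * r             ≡⟨ ℚ.*-identityˡ r ⟩
    r                  ∎
    where
    open ≡-Reasoning
    r = 1/! k
    r′ = 1/! (suc k)
    s = ι (suc k)
    f = ι (k !)

  0≤1/! : ∀ k → 0ℚ ≤ 1/! k
  0≤1/! k = ℚ.nonNegative⁻¹ (1/! k) {{ℚ.normalize-nonNeg 1 (k !) {{k !≢0}}}}

  ^-nonNeg : ∀ {a} → 0ℚ ≤ a → ∀ k → 0ℚ ≤ a ^ k
  ^-nonNeg 0≤a zero    = 0≤1
  ^-nonNeg 0≤a (suc k) = *-nonNeg 0≤a (^-nonNeg 0≤a k)

  ∣^∣≤ : ∀ {x b} → ∣ x ∣ ≤ b → ∀ k → ∣ x ^ k ∣ ≤ b ^ k
  ∣^∣≤ x≤b zero    = ℚ.≤-refl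
  ∣^∣≤ {x} {b} x≤b (suc k) = subst (_≤ b ^ suc k) (sym (ℚ.∣p*q∣≡∣p∣*∣q∣ x (x ^ k)))
    (*-mono (ℚ.≤-trans (ℚ.0≤∣p∣ x) x≤b) (ℚ.0≤∣p∣ (x ^ k)) x≤b (∣^∣≤ x≤b k))

  ^-lip : ∀ {x y b} → ∣ x ∣ ≤ b → ∣ y ∣ ≤ b → ∀ k →
          ∣ x ^ suc k - y ^ suc k ∣ ≤ (ι (suc k) * b ^ k) * ∣ x - y ∣
  ^-lip {x} {y} {b} x≤b y≤b zero = ℚ.≤-reflexive (begin
    ∣ x * 1ℚ - y * 1ℚ ∣       ≡⟨ cong ∣_∣ (solve 2 (λ x y → x :* con 1ℚ :- y :* con 1ℚ := x :- y) refl x y) ⟩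
    ∣ x - y ∣                 ≡⟨ ℚ.*-identityˡ ∣ x - y ∣ ⟨
    1ℚ * ∣ x - y ∣            ∎) where open ≡-Reasoning
  ^-lip {x} {y} {b} x≤b y≤b (suc k) = begin
    ∣ x * X - y * Y ∣
      ≡⟨ cong ∣_∣ (solve 4 (λ x y X Y → x :* X :- y :* Y := x :* (X :- Y) :+ (x :- y) :* Y) refl x y X Y) ⟩
    ∣ x * (X - Y) + (x - y) * Y ∣
      ≤⟨ ℚ.∣p+q∣≤∣p∣+∣q∣ (x * (X - Y)) ((x - y) * Y) ⟩
    ∣ x * (X - Y) ∣ + ∣ (x - y) * Y ∣
      ≡⟨ cong₂ _+_ (ℚ.∣p*q∣≡∣p∣*∣q∣ x (X - Y)) (ℚ.∣p*q∣≡∣p∣*∣q∣ (x - y) Y) ⟩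
    ∣ x ∣ * ∣ X - Y ∣ + d * ∣ Y ∣
      ≤⟨ ℚ.+-mono-≤ (*-mono 0≤b (ℚ.0≤∣p∣ (X - Y)) x≤b (^-lip x≤b y≤b k))
                    (*-mono (ℚ.0≤∣p∣ (x - y)) (ℚ.0≤∣p∣ Y) ℚ.≤-refl (∣^∣≤ y≤b (suc k))) ⟩
    b * ((ι (suc k) * b ^ k) * d) + d * (b * b ^ k)
      ≡⟨ solve 4 (λ b i p d → b :* ((i :* p) :* d) :+ d :* (b :* p)
                            := ((con 1ℚ :+ i) :* (b :* p)) :* d) refl b (ι (suc k)) (b ^ k) d ⟩
    ((1ℚ + ι (suc k)) * (b * b ^ k)) * d
      ≡⟨ cong (λ z → (z * (b * b ^ k)) * d) (ι-+ 1 (suc k)) ⟨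
    (ι (suc (suc k)) * b ^ suc k) * d ∎
    where
    open ℚ.≤-Reasoning
    X = x ^ suc k
    Y = y ^ suc k
    d = ∣ x - y ∣
    0≤b = ℚ.≤-trans (ℚ.0≤∣p∣ x) x≤b

  term-nonNeg : ∀ {b} → 0ℚ ≤ b → ∀ k → 0ℚ ≤ b ^ k * 1/! k
  term-nonNeg 0≤b k = *-nonNeg (^-nonNeg 0≤b k) (0≤1/! k)

  expSum-mono : ∀ {b} → 0ℚ ≤ b → ∀ j n → expSum n b ≤ expSum (j ℕ.+ n) b
  expSum-mono 0≤b zero    n = ℚ.≤-refl
  expSum-mono 0≤b (suc j) n =
    ℚ.≤-trans (expSum-mono 0≤b j n) (≤-step (term-nonNeg 0≤b (j ℕ.+ n)))

  expSum-tail : ∀ {x b} → ∣ x ∣ ≤ b → ∀ j n →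
    ∣ expSum (j ℕ.+ n) x - expSum n x ∣ ≤ expSum (j ℕ.+ n) b - expSum n b
  expSum-tail {x} {b} x≤b zero n = ℚ.≤-reflexive (begin
    ∣ expSum n x - expSum n x ∣ ≡⟨ cong ∣_∣ (ℚ.+-inverseʳ (expSum n x)) ⟩
    0ℚ                          ≡⟨ ℚ.+-inverseʳ (expSum n b) ⟨
    expSum n b - expSum n b     ∎) where open ≡-Reasoning
  expSum-tail {x} {b} x≤b (suc j) n = begin
    ∣ (F + x ^ m * r) - F₀ ∣        ≡⟨ cong ∣_∣ (rearrange F F₀ (x ^ m * r)) ⟩
    ∣ (F - F₀) + x ^ m * r ∣        ≤⟨ ℚ.∣p+q∣≤∣p∣+∣q∣ (F - F₀) (x ^ m * r) ⟩
    ∣ F - F₀ ∣ + ∣ x ^ m * r ∣      ≡⟨ cong (λ z → ∣ F - F₀ ∣ + z) (∣*∣ (x ^ m) (0≤1/! m)) ⟩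
    ∣ F - F₀ ∣ + ∣ x ^ m ∣ * r      ≤⟨ ℚ.+-mono-≤ (expSum-tail x≤b j n)
                                         (*-mono (^-nonNeg 0≤b m) (0≤1/! m) (∣^∣≤ x≤b m) ℚ.≤-refl) ⟩
    (G - G₀) + b ^ m * r            ≡⟨ rearrange G G₀ (b ^ m * r) ⟨
    (G + b ^ m * r) - G₀            ∎
    where
    open ℚ.≤-Reasoning
    m = j ℕ.+ n
    r = 1/! m
    F = expSum m x
    F₀ = expSum n x
    G = expSum m b
    G₀ = expSum n b
    0≤b = ℚ.≤-trans (ℚ.0≤∣p∣ x) x≤b
    rearrange : ∀ f f₀ t → (f + t) - f₀ ≡ (f - f₀) + t
    rearrange = solve 3 (λ f f₀ t → (f :+ t) :- f₀ := (f :- f₀) :+ t) refl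

  expSum-diff : ∀ {x b} → ∣ x ∣ ≤ b → ∀ m n →
    ∣ expSum m x - expSum n x ∣ ≤ ∣ expSum m b - expSum n b ∣
  expSum-diff {x} {b} x≤b m n with ℕ.≤-total n m
  ... | inj₁ n≤m = ordered n≤m
    where
    ordered : ∀ {m n} → n ℕ.≤ m → ∣ expSum m x - expSum n x ∣ ≤ ∣ expSum m b - expSum n b ∣
    ordered {m} {n} n≤m = ℚ.≤-trans
      (subst (λ k → ∣ expSum k x - expSum n x ∣ ≤ expSum k b - expSum n b)
             (ℕ.m∸n+n≡m n≤m) (expSum-tail x≤b (m ℕ.∸ n) n))
      (p≤∣p∣ _)
  ... | inj₂ m≤n = subst₂ _≤_ (∣-∣-sym (expSum n x) (expSum m x)) (∣-∣-sym (expSum n b) (expSum m b))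
      (ℚ.≤-trans
        (subst (λ k → ∣ expSum k x - expSum m x ∣ ≤ expSum k b - expSum m b)
               (ℕ.m∸n+n≡m m≤n) (expSum-tail x≤b (n ℕ.∸ m) m))
        (p≤∣p∣ _))

  expSum-lip : ∀ {x y b} → ∣ x ∣ ≤ b → ∣ y ∣ ≤ b → ∀ n →
    ∣ expSum (suc n) x - expSum (suc n) y ∣ ≤ expSum n b * ∣ x - y ∣
  expSum-lip {x} {y} x≤b y≤b zero = ℚ.≤-reflexive (sym (ℚ.*-zeroˡ ∣ x - y ∣))
  expSum-lip {x} {y} {b} x≤b y≤b (suc n) = begin
    ∣ (F + X * r) - (G + Y * r) ∣
      ≡⟨ cong ∣_∣ (solve 5 (λ F G X Y r → (F :+ X :* r) :- (G :+ Y :* r)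
                                        := (F :- G) :+ (X :- Y) :* r) refl F G X Y r) ⟩
    ∣ (F - G) + (X - Y) * r ∣
      ≤⟨ ℚ.∣p+q∣≤∣p∣+∣q∣ (F - G) ((X - Y) * r) ⟩
    ∣ F - G ∣ + ∣ (X - Y) * r ∣
      ≡⟨ cong (λ z → ∣ F - G ∣ + z) (∣*∣ (X - Y) (0≤1/! (suc n))) ⟩
    ∣ F - G ∣ + ∣ X - Y ∣ * r
      ≤⟨ ℚ.+-mono-≤ (expSum-lip x≤b y≤b n)
                    (*-mono 0≤bound (0≤1/! (suc n)) (^-lip x≤b y≤b n) ℚ.≤-refl) ⟩
    expSum n b * d + ((ι (suc n) * b ^ n) * d) * r
      ≡⟨ solve 5 (λ e i p d r → e :* d :+ ((i :* p) :* d) :* r := (e :+ p :* (r :* i)) :* d)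
           refl (expSum n b) (ι (suc n)) (b ^ n) d r ⟩
    (expSum n b + b ^ n * (r * ι (suc n))) * d
      ≡⟨ cong (λ z → (expSum n b + b ^ n * z) * d) (1/!-suc n) ⟩
    expSum (suc n) b * d ∎
    where
    open ℚ.≤-Reasoning
    F = expSum (suc n) x
    G = expSum (suc n) y
    X = x ^ suc n
    Y = y ^ suc n
    r = 1/! (suc n)
    d = ∣ x - y ∣
    0≤bound = *-nonNeg (*-nonNeg (0≤ι (suc n))
      (^-nonNeg (ℚ.≤-trans (ℚ.0≤∣p∣ x) x≤b) n)) (ℚ.0≤∣p∣ (x - y))

  lipschitz : ∀ u v w → IsCauchy u → IsCauchy v → ∀ C → 0ℚ < C → ∀ N →
    (∀ m n → N ℕ.≤ m → N ℕ.≤ n → ∣ w m - w n ∣ ≤ C * (∣ u m - u n ∣ + ∣ v m - v n ∣)) →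
    IsCauchy w
  lipschitz u v w cu cv C 0<C N bound ε 0<ε = N ℕ.⊔ (N₁ ℕ.⊔ N₂) , λ m n ≤m ≤n → begin-strict
      ∣ w m - w n ∣
        ≤⟨ bound m n (ℕ.m⊔n≤o⇒m≤o N _ ≤m) (ℕ.m⊔n≤o⇒m≤o N _ ≤n) ⟩
      C * (∣ u m - u n ∣ + ∣ v m - v n ∣)
        <⟨ ℚ.*-monoʳ-<-pos C {{positive 0<C}} (ℚ.+-mono-<
             (close₁ m n (ℕ.m⊔n≤o⇒m≤o N₁ N₂ (ℕ.m⊔n≤o⇒n≤o N _ ≤m)) (ℕ.m⊔n≤o⇒m≤o N₁ N₂ (ℕ.m⊔n≤o⇒n≤o N _ ≤n)))
             (close₂ m n (ℕ.m⊔n≤o⇒n≤o N₁ N₂ (ℕ.m⊔n≤o⇒n≤o N _ ≤m)) (ℕ.m⊔n≤o⇒n≤o N₁ N₂ (ℕ.m⊔n≤o⇒n≤o N _ ≤n)))) ⟩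
      C * (½ * δ + ½ * δ)
        ≡⟨ cong (C *_) (½+½ δ) ⟩
      C * δ
        ≡⟨ *-1/ 0<C ε ⟩
      ε ∎
    where
    open ℚ.≤-Reasoning
    δ = ε * (1/ C) {{>-nonZero 0<C}}
    0<½δ : 0ℚ < ½ * δ
    0<½δ = *-pos 0<½ (*-pos 0<ε (1/-pos 0<C))
    N₁ = proj₁ (cu (½ * δ) 0<½δ)
    N₂ = proj₁ (cv (½ * δ) 0<½δ)
    close₁ = proj₂ (cu (½ * δ) 0<½δ)
    close₂ = proj₂ (cv (½ * δ) 0<½δ)

  Bounded : (ℕ → ℚ) → Set
  Bounded u = ∃ λ B → 0ℚ < B × ∃ λ N → ∀ n → N ℕ.≤ n → ∣ u n ∣ ≤ B

  bounded : ∀ u → IsCauchy u → Bounded u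
  bounded u cu = ∣ u N ∣ + 1ℚ , ℚ.+-mono-≤-< (ℚ.0≤∣p∣ (u N)) 0<1 , N , λ n N≤n → begin
      ∣ u n ∣                   ≡⟨ cong ∣_∣ (solve 2 (λ a b → a := b :+ (a :- b)) refl (u n) (u N)) ⟩
      ∣ u N + (u n - u N) ∣     ≤⟨ ℚ.∣p+q∣≤∣p∣+∣q∣ (u N) (u n - u N) ⟩
      ∣ u N ∣ + ∣ u n - u N ∣   ≤⟨ ℚ.+-monoʳ-≤ ∣ u N ∣ (ℚ.<⇒≤ (close n N N≤n ℕ.≤-refl)) ⟩
      ∣ u N ∣ + 1ℚ              ∎
    where
    open ℚ.≤-Reasoning
    N = proj₁ (cu 1ℚ 0<1)
    close = proj₂ (cu 1ℚ 0<1)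

  const-cauchy : ∀ q → IsCauchy (λ _ → q)
  const-cauchy q ε 0<ε = 0 , λ _ _ _ _ → subst (_< ε) (sym (cong ∣_∣ (ℚ.+-inverseʳ q))) 0<ε

  +-cauchy : ∀ u v → IsCauchy u → IsCauchy v → IsCauchy (λ n → u n + v n)
  +-cauchy u v cu cv = lipschitz u v (λ n → u n + v n) cu cv 1ℚ 0<1 0 λ m n _ _ → begin
      ∣ (u m + v m) - (u n + v n) ∣           ≡⟨ cong ∣_∣ (solve 4 (λ a b c d → (a :+ b) :- (c :+ d)
                                                   := (a :- c) :+ (b :- d)) refl (u m) (v m) (u n) (v n)) ⟩
      ∣ (u m - u n) + (v m - v n) ∣           ≤⟨ ℚ.∣p+q∣≤∣p∣+∣q∣ (u m - u n) (v m - v n) ⟩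
      ∣ u m - u n ∣ + ∣ v m - v n ∣           ≡⟨ ℚ.*-identityˡ _ ⟨
      1ℚ * (∣ u m - u n ∣ + ∣ v m - v n ∣)    ∎
    where open ℚ.≤-Reasoning

  neg-cauchy : ∀ u → IsCauchy u → IsCauchy (λ n → - u n)
  neg-cauchy u cu ε 0<ε = proj₁ (cu ε 0<ε) , λ m n ≤m ≤n → subst (_< ε)
    (trans (∣-∣-sym (u m) (u n)) (cong ∣_∣ (solve 2 (λ a b → b :- a := (:- a) :- (:- b)) refl (u m) (u n))))
    (proj₂ (cu ε 0<ε) m n ≤m ≤n)

  *-cauchy : ∀ u v → IsCauchy u → IsCauchy v → IsCauchy (λ n → u n * v n)
  *-cauchy u v cu cv = go (bounded u cu) (bounded v cv)
    where
    open ℚ.≤-Reasoning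

    bound : ∀ {A B} → 0ℚ < A → 0ℚ < B → ∀ a b c d → ∣ a ∣ ≤ A → ∣ d ∣ ≤ B →
            ∣ a * b - c * d ∣ ≤ (A + B) * (∣ a - c ∣ + ∣ b - d ∣)
    bound {A} {B} 0<A 0<B a b c d a≤A d≤B = begin
      ∣ a * b - c * d ∣
        ≡⟨ cong ∣_∣ (solve 4 (λ a b c d → a :* b :- c :* d := a :* (b :- d) :+ (a :- c) :* d)
             refl a b c d) ⟩
      ∣ a * (b - d) + (a - c) * d ∣
        ≤⟨ ℚ.∣p+q∣≤∣p∣+∣q∣ (a * (b - d)) ((a - c) * d) ⟩
      ∣ a * (b - d) ∣ + ∣ (a - c) * d ∣
        ≡⟨ cong₂ _+_ (ℚ.∣p*q∣≡∣p∣*∣q∣ a (b - d)) (ℚ.∣p*q∣≡∣p∣*∣q∣ (a - c) d) ⟩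
      ∣ a ∣ * s + r * ∣ d ∣
        ≤⟨ ℚ.+-mono-≤ (*-mono (ℚ.<⇒≤ 0<A) 0≤s a≤A ℚ.≤-refl)
                      (*-mono 0≤r (ℚ.0≤∣p∣ d) ℚ.≤-refl d≤B) ⟩
      A * s + r * B
        ≤⟨ ≤-step (+-nonNeg (*-nonNeg (ℚ.<⇒≤ 0<A) 0≤r) (*-nonNeg (ℚ.<⇒≤ 0<B) 0≤s)) ⟩
      (A * s + r * B) + (A * r + B * s)
        ≡⟨ solve 4 (λ A B r s → (A :* s :+ r :* B) :+ (A :* r :+ B :* s)
                              := (A :+ B) :* (r :+ s)) refl A B r s ⟩
      (A + B) * (r + s) ∎
      where
      r = ∣ a - c ∣
      s = ∣ b - d ∣
      0≤r = ℚ.0≤∣p∣ (a - c)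
      0≤s = ℚ.0≤∣p∣ (b - d)

    go : Bounded u → Bounded v → IsCauchy (λ n → u n * v n)
    go (A , 0<A , N₁ , u≤A) (B , 0<B , N₂ , v≤B) =
      lipschitz u v (λ n → u n * v n) cu cv (A + B) (ℚ.+-mono-< 0<A 0<B) (N₁ ℕ.⊔ N₂) λ m n ≤m ≤n →
        bound 0<A 0<B (u m) (v m) (u n) (v n)
          (u≤A m (ℕ.m⊔n≤o⇒m≤o N₁ N₂ ≤m)) (v≤B n (ℕ.m⊔n≤o⇒n≤o N₁ N₂ ≤n))

  inv-cauchy : ∀ u → IsCauchy u → ∀ δ → 0ℚ < δ → ∀ N →
    (∀ n → N ℕ.≤ n → δ ≤ u n) → IsCauchy (λ n → inv (u n))
  inv-cauchy u cu δ 0<δ N δ≤u = lipschitz u u (λ n → inv (u n)) cu cu (i * i) (*-pos 0<i 0<i) N λ m n ≤m ≤n →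
      let a = u m ; b = u n ; d = ∣ b - a ∣ in begin
      ∣ inv a - inv b ∣
        ≡⟨ cong ∣_∣ (begin-equality
             inv a - inv b
               ≡⟨ solve 2 (λ x y → x :- y := x :* con 1ℚ :- con 1ℚ :* y) refl (inv a) (inv b) ⟩
             inv a * 1ℚ - 1ℚ * inv b
               ≡⟨ cong₂ (λ s t → inv a * s - t * inv b) (*-inv b (0<u ≤n)) (*-inv a (0<u ≤m)) ⟨
             inv a * (b * inv b) - (a * inv a) * inv b
               ≡⟨ solve 4 (λ a b x y → x :* (b :* y) :- (a :* x) :* y := (x :* y) :* (b :- a))
                    refl a b (inv a) (inv b) ⟩
             (inv a * inv b) * (b - a) ∎) ⟩
      ∣ (inv a * inv b) * (b - a) ∣
        ≡⟨ ℚ.∣p*q∣≡∣p∣*∣q∣ (inv a * inv b) (b - a) ⟩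
      ∣ inv a * inv b ∣ * d
        ≡⟨ cong (_* d) (ℚ.0≤p⇒∣p∣≡p (*-nonNeg (0≤inv a (0<u ≤m)) (0≤inv b (0<u ≤n)))) ⟩
      (inv a * inv b) * d
        ≤⟨ *-mono (*-nonNeg (ℚ.<⇒≤ 0<i) (ℚ.<⇒≤ 0<i)) (ℚ.0≤∣p∣ (b - a))
             (*-mono (ℚ.<⇒≤ 0<i) (0≤inv b (0<u ≤n)) (inv≤ a (δ≤u m ≤m)) (inv≤ b (δ≤u n ≤n)))
             (≤-step (ℚ.0≤∣p∣ (b - a))) ⟩
      (i * i) * (d + d)
        ≡⟨ cong (λ z → (i * i) * (z + z)) (∣-∣-sym b a) ⟩
      (i * i) * (∣ a - b ∣ + ∣ a - b ∣) ∎
    where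
    open ℚ.≤-Reasoning
    i = (1/ δ) {{>-nonZero 0<δ}}
    0<i : 0ℚ < i
    0<i = 1/-pos 0<δ
    0<u : ∀ {n} → N ℕ.≤ n → 0ℚ < u n
    0<u ≤n = ℚ.<-≤-trans 0<δ (δ≤u _ ≤n)
    *-inv : ∀ a → 0ℚ < a → a * inv a ≡ 1ℚ
    *-inv a 0<a with a ℚ.≟ 0ℚ
    ... | yes a≡0 = contradiction (sym a≡0) (ℚ.<⇒≢ 0<a)
    ... | no  a≢0 = ℚ.*-inverseʳ a {{≢-nonZero a≢0}}
    0≤inv : ∀ a → 0ℚ < a → 0ℚ ≤ inv a
    0≤inv a 0<a with a ℚ.≟ 0ℚ
    ... | yes _ = ℚ.≤-refl
    ... | no  _ = ℚ.<⇒≤ (1/-pos 0<a)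
    inv≤ : ∀ a → δ ≤ a → inv a ≤ i
    inv≤ a δ≤a = begin
      inv a             ≡⟨ *-1/ 0<δ (inv a) ⟨
      δ * (inv a * i)   ≤⟨ *-mono (ℚ.<⇒≤ 0<a) (*-nonNeg (0≤inv a 0<a) (ℚ.<⇒≤ 0<i)) δ≤a ℚ.≤-refl ⟩
      a * (inv a * i)   ≡⟨ ℚ.*-assoc a (inv a) i ⟨
      (a * inv a) * i   ≡⟨ cong (_* i) (*-inv a 0<a) ⟩
      1ℚ * i            ≡⟨ ℚ.*-identityˡ i ⟩
      i                 ∎
      where 0<a = ℚ.<-≤-trans 0<δ δ≤a

  -- Beyond index 2b the terms of Σ bᵏ/k! at least halve at each step, so a
  -- tail is at most twice its first term, and the terms tend to 0.
  expSum-cauchy-const : ∀ b → 0ℚ ≤ b → IsCauchy (λ n → expSum n b)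
  expSum-cauchy-const b 0≤b ε 0<ε = J ℕ.+ M , λ m n ≤m ≤n → ℚ.≤-<-trans
      (interval (lower ≤m) (upper ≤m) (lower ≤n) (upper ≤n)) small
    where
    open ℚ.≤-Reasoning
    M = proj₁ (archimedean (b + b))
    2b≤M = proj₂ (archimedean (b + b))

    t : ℕ → ℚ
    t k = b ^ k * 1/! k

    0≤t : ∀ k → 0ℚ ≤ t k
    0≤t = term-nonNeg 0≤b

    halve : ∀ k → M ℕ.≤ k → t (suc k) + t (suc k) ≤ t k
    halve k M≤k = begin
      t (suc k) + t (suc k)                 ≡⟨ solve 3 (λ b p r → (b :* p) :* r :+ (b :* p) :* r
                                                 := (b :+ b) :* (p :* r)) refl b (b ^ k) r ⟩
      (b + b) * (b ^ k * r)                 ≤⟨ *-mono (0≤ι (suc k)) (*-nonNeg (^-nonNeg 0≤b k) (0≤1/! (suc k)))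
                                                 (ℚ.≤-trans 2b≤M (ι-mono (ℕ.m≤n⇒m≤1+n M≤k))) ℚ.≤-refl ⟩
      ι (suc k) * (b ^ k * r)               ≡⟨ solve 3 (λ i p r → i :* (p :* r) := p :* (r :* i))
                                                 refl (ι (suc k)) (b ^ k) r ⟩
      b ^ k * (r * ι (suc k))               ≡⟨ cong (b ^ k *_) (1/!-suc k) ⟩
      t k                                   ∎
      where r = 1/! (suc k)

    decay : ∀ j → ι (suc j) * t (j ℕ.+ M) ≤ t M
    decay zero    = ℚ.≤-reflexive (ℚ.*-identityˡ (t M))
    decay (suc j) = begin
      ι (suc (suc j)) * t′                ≡⟨ cong (_* t′) (ι-+ 1 (suc j)) ⟩
      (1ℚ + i) * t′                       ≤⟨ *-mono (+-nonNeg (0≤ι (suc j)) (0≤ι (suc j))) (0≤t (suc j ℕ.+ M))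
                                               (ℚ.+-monoˡ-≤ i (ι-mono (ℕ.s≤s (ℕ.z≤n {j})))) ℚ.≤-refl ⟩
      (i + i) * t′                        ≡⟨ solve 2 (λ i t → (i :+ i) :* t := i :* (t :+ t)) refl i t′ ⟩
      i * (t′ + t′)                       ≤⟨ *-mono (0≤ι (suc j)) (+-nonNeg (0≤t (suc j ℕ.+ M)) (0≤t (suc j ℕ.+ M)))
                                               ℚ.≤-refl (halve (j ℕ.+ M) (ℕ.m≤n+m M j)) ⟩
      i * t (j ℕ.+ M)                     ≤⟨ decay j ⟩
      t M                                 ∎
      where
      i = ι (suc j)
      t′ = t (suc j ℕ.+ M)

    q = (t M + t M) * (1/ ε) {{>-nonZero 0<ε}}
    J = proj₁ (archimedean q)
    T = t (J ℕ.+ M)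
    S = expSum (J ℕ.+ M) b

    small : T + T < ε
    small = ℚ.*-cancelˡ-<-nonNeg (ι (suc J)) {{nonNegative (0≤ι (suc J))}} (begin-strict
      ι (suc J) * (T + T)            ≡⟨ ℚ.*-distribˡ-+ (ι (suc J)) T T ⟩
      ι (suc J) * T + ι (suc J) * T  ≤⟨ ℚ.+-mono-≤ (decay J) (decay J) ⟩
      t M + t M                      ≡⟨ *-1/ 0<ε (t M + t M) ⟨
      ε * q                          ≤⟨ ℚ.*-monoˡ-≤-nonNeg ε {{nonNegative (ℚ.<⇒≤ 0<ε)}}
                                          (proj₂ (archimedean q)) ⟩
      ε * ι J                        <⟨ ℚ.*-monoʳ-<-pos ε {{positive 0<ε}} (subst₂ _<_
                                          (ℚ.+-identityˡ (ι J)) (sym (ι-+ 1 J)) (ℚ.+-monoˡ-< (ι J) 0<1)) ⟩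
      ε * ι (suc J)                  ≡⟨ ℚ.*-comm ε (ι (suc J)) ⟩
      ι (suc J) * ε                  ∎)

    lower : ∀ {m} → J ℕ.+ M ℕ.≤ m → S ≤ expSum m b
    lower {m} ≤m = subst (λ k → S ≤ expSum k b) (ℕ.m∸n+n≡m ≤m) (expSum-mono 0≤b (m ℕ.∸ (J ℕ.+ M)) (J ℕ.+ M))

    descend : ∀ j → let k = j ℕ.+ (J ℕ.+ M) in expSum k b + (t k + t k) ≤ S + (T + T)
    descend zero    = ℚ.≤-refl
    descend (suc j) = begin
      (expSum k b + t k) + (t (suc k) + t (suc k))
        ≤⟨ ℚ.+-monoʳ-≤ (expSum k b + t k) (halve k (ℕ.≤-trans (ℕ.m≤n+m M J) (ℕ.m≤n+m (J ℕ.+ M) j))) ⟩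
      (expSum k b + t k) + t k
        ≡⟨ ℚ.+-assoc (expSum k b) (t k) (t k) ⟩
      expSum k b + (t k + t k)
        ≤⟨ descend j ⟩
      S + (T + T) ∎
      where k = j ℕ.+ (J ℕ.+ M)

    upper : ∀ {m} → J ℕ.+ M ℕ.≤ m → expSum m b ≤ S + (T + T)
    upper {m} ≤m = subst (λ k → expSum k b ≤ S + (T + T)) (ℕ.m∸n+n≡m ≤m)
      (ℚ.≤-trans (≤-step (+-nonNeg (0≤t k′) (0≤t k′))) (descend (m ℕ.∸ (J ℕ.+ M))))
      where k′ = m ℕ.∸ (J ℕ.+ M) ℕ.+ (J ℕ.+ M)

  exp-cauchy : ∀ u → IsCauchy u → IsCauchy (λ n → expSum n (u n))
  exp-cauchy u cu = go (bounded u cu)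
    where
    open ℚ.≤-Reasoning

    bound : ∀ {b C x y} m′ n → 0ℚ < C → ∣ x ∣ ≤ b → ∣ y ∣ ≤ b → ∣ expSum m′ b ∣ ≤ C →
      ∣ expSum (suc m′) x - expSum n y ∣ ≤
      (1ℚ + C) * (∣ x - y ∣ + ∣ expSum (suc m′) b - expSum n b ∣)
    bound {b} {C} {x} {y} m′ n 0<C x≤b y≤b e≤C = begin
      ∣ expSum m x - expSum n y ∣
        ≡⟨ cong ∣_∣ (solve 3 (λ x y z → x :- z := (x :- y) :+ (y :- z)) refl
             (expSum m x) (expSum m y) (expSum n y)) ⟩
      ∣ (expSum m x - expSum m y) + (expSum m y - expSum n y) ∣
        ≤⟨ ℚ.∣p+q∣≤∣p∣+∣q∣ (expSum m x - expSum m y) (expSum m y - expSum n y) ⟩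
      ∣ expSum m x - expSum m y ∣ + ∣ expSum m y - expSum n y ∣
        ≤⟨ ℚ.+-mono-≤ (expSum-lip x≤b y≤b m′) (expSum-diff y≤b m n) ⟩
      expSum m′ b * d + e
        ≤⟨ ℚ.+-monoˡ-≤ e (*-mono (ℚ.<⇒≤ 0<C) 0≤d (ℚ.≤-trans (p≤∣p∣ (expSum m′ b)) e≤C) ℚ.≤-refl) ⟩
      C * d + e
        ≤⟨ ≤-step (+-nonNeg 0≤d (*-nonNeg (ℚ.<⇒≤ 0<C) 0≤e)) ⟩
      (C * d + e) + (d + C * e)
        ≡⟨ solve 3 (λ C d e → (C :* d :+ e) :+ (d :+ C :* e) := (con 1ℚ :+ C) :* (d :+ e)) refl C d e ⟩
      (1ℚ + C) * (d + e) ∎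
      where
      m = suc m′
      d = ∣ x - y ∣
      e = ∣ expSum m b - expSum n b ∣
      0≤d = ℚ.0≤∣p∣ (x - y)
      0≤e = ℚ.0≤∣p∣ (expSum m b - expSum n b)

    go : Bounded u → IsCauchy (λ n → expSum n (u n))
    go (b , 0<b , N₁ , u≤b) = go′ (bounded E cE)
      where
      E = λ n → expSum n b
      cE = expSum-cauchy-const b (ℚ.<⇒≤ 0<b)

      go′ : Bounded E → IsCauchy (λ n → expSum n (u n))
      go′ (C , 0<C , N₂ , e≤C) = lipschitz u E (λ n → expSum n (u n)) cu cE
        (1ℚ + C) (ℚ.+-mono-< 0<1 0<C) (N₁ ℕ.⊔ suc N₂) close
        where
        close : ∀ m n → N₁ ℕ.⊔ suc N₂ ℕ.≤ m → N₁ ℕ.⊔ suc N₂ ℕ.≤ n →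
          ∣ expSum m (u m) - expSum n (u n) ∣ ≤ (1ℚ + C) * (∣ u m - u n ∣ + ∣ E m - E n ∣)
        close zero n ≤m ≤n = contradiction (ℕ.m⊔n≤o⇒n≤o N₁ (suc N₂) ≤m) λ ()
        close m@(suc m′) n ≤m ≤n = bound m′ n 0<C
          (u≤b m (ℕ.m⊔n≤o⇒m≤o N₁ (suc N₂) ≤m)) (u≤b n (ℕ.m⊔n≤o⇒m≤o N₁ (suc N₂) ≤n))
          (e≤C m′ (ℕ.s≤s⁻¹ (ℕ.m⊔n≤o⇒n≤o N₁ (suc N₂) ≤m)))

  2-^≥1 : ∀ {a} → 0ℚ ≤ a → a ≤ 1ℚ → ∀ k → 0ℚ + 1ℚ ≤ (1ℚ + 1ℚ) + - (a ^ k)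
  2-^≥1 {a} 0≤a a≤1 k = 0≤-⇒≤ (subst (0ℚ ≤_)
    (solve 1 (λ x → con 1ℚ :- x := ((con 1ℚ :+ con 1ℚ) :- x) :- (con 0ℚ :+ con 1ℚ)) refl (a ^ k))
    (≤⇒0≤- (^≤1 k)))
    where
    ^≤1 : ∀ k → a ^ k ≤ 1ℚ
    ^≤1 zero    = ℚ.≤-refl
    ^≤1 (suc k) = *-mono 0≤1 (^-nonNeg 0≤a k) a≤1 (^≤1 k)

  1-bounds : ∀ {x ε ε′} → 0ℚ < ε → 0ℚ < ε′ → 0ℚ + ε ≤ x → x + ε′ ≤ 1ℚ →
             0ℚ ≤ 1ℚ + - x × 1ℚ + - x ≤ 1ℚ
  1-bounds {x} {ε} {ε′} 0<ε 0<ε′ lo hi =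
    ≤⇒0≤- (ℚ.≤-trans (≤-step {x} (ℚ.<⇒≤ 0<ε′)) hi) ,
    0≤-⇒≤ (subst (0ℚ ≤_) (solve 1 (λ x → x := con 1ℚ :- (con 1ℚ :- x)) refl x)
      (ℚ.≤-trans (ℚ.≤-trans (ℚ.<⇒≤ 0<ε) (ℚ.≤-reflexive (sym (ℚ.+-identityˡ ε)))) lo))

open Sequences using (IsCauchy; expSum; inv; const-cauchy; +-cauchy; neg-cauchy;
  *-cauchy; inv-cauchy; exp-cauchy; 2-^≥1; 1-bounds)

infix  4 _<_ _≤_ _≈_
infixl 6 _+_ _-_
infixl 7 _*_ _÷_[_]
infix  8 -_

-- Cauchy sequences of rationals; equality of reals is _≈_ below.
record ℝ : Set where
  constructor mkℝ
  field
    seq    : ℕ → ℚ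
    cauchy : IsCauchy seq

open ℝ public

_<_ : Rel ℝ 0ℓ
x < y = ∃ λ ε → 0ℚ ℚ.< ε × ∃ λ N → ∀ n → N ℕ.≤ n → seq x n ℚ.+ ε ℚ.≤ seq y n

_≤_ : Rel ℝ 0ℓ
x ≤ y = ∀ ε → 0ℚ ℚ.< ε → ∃ λ N → ∀ n → N ℕ.≤ n → seq x n ℚ.≤ seq y n ℚ.+ ε

_≈_ : Rel ℝ 0ℓ
x ≈ y = x ≤ y × y ≤ x

-- Abstract, so that comparing real numbers never unfolds these proofs.
abstract
  const-isCauchy : ∀ q → IsCauchy (λ _ → q)
  const-isCauchy = const-cauchy

  +-isCauchy : ∀ x y → IsCauchy (λ n → seq x n ℚ.+ seq y n)
  +-isCauchy x y = +-cauchy (seq x) (seq y) (cauchy x) (cauchy y)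

  *-isCauchy : ∀ x y → IsCauchy (λ n → seq x n ℚ.* seq y n)
  *-isCauchy x y = *-cauchy (seq x) (seq y) (cauchy x) (cauchy y)

  neg-isCauchy : ∀ x → IsCauchy (λ n → ℚ.- seq x n)
  neg-isCauchy x = neg-cauchy (seq x) (cauchy x)

  exp-isCauchy : ∀ x → IsCauchy (λ n → expSum n (seq x n))
  exp-isCauchy x = exp-cauchy (seq x) (cauchy x)

fromℚ : ℚ → ℝ
fromℚ q = mkℝ (λ _ → q) (const-isCauchy q)

fromℕ : ℕ → ℝ
fromℕ k = fromℚ (+ k ℚ./ 1)

0ℝ 1ℝ 2ℝ 3ℝ : ℝ
0ℝ = fromℚ 0ℚ
1ℝ = fromℚ 1ℚ
2ℝ = fromℕ 2
3ℝ = fromℕ 3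

_+_ _*_ : ℝ → ℝ → ℝ
x + y = mkℝ (λ n → seq x n ℚ.+ seq y n) (+-isCauchy x y)
x * y = mkℝ (λ n → seq x n ℚ.* seq y n) (*-isCauchy x y)

-_ : ℝ → ℝ
- x = mkℝ (λ n → ℚ.- seq x n) (neg-isCauchy x)

_-_ : ℝ → ℝ → ℝ
x - y = x + - y

abstract
  inv-isCauchy : ∀ y → 0ℝ < y → IsCauchy (λ n → inv (seq y n))
  inv-isCauchy y (δ , 0<δ , N , δ≤y) = inv-cauchy (seq y) (cauchy y) δ 0<δ N λ n N≤n →
    subst (ℚ._≤ seq y n) (ℚ.+-identityˡ δ) (δ≤y n N≤n)

-- The sequence of x ÷ y [ 0<y ] does not depend on the positivity proof.
_÷_[_] : (x y : ℝ) → 0ℝ < y → ℝ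
x ÷ y [ 0<y ] = x * mkℝ (λ n → inv (seq y n)) (inv-isCauchy y 0<y)

0<2 : 0ℝ < 2ℝ
0<2 = 1ℚ , ℚ.*<* (ℤ.+<+ (ℕ.s≤s ℕ.z≤n)) , 0 , λ _ _ → ℚ.*≤* (ℤ.+≤+ (ℕ.s≤s ℕ.z≤n))

-- The n-th approximation sums the first n terms of the exponential series at
-- the n-th approximation of x.
exp : ℝ → ℝ
exp x = mkℝ (λ n → expSum n (seq x n)) (exp-isCauchy x)

ℝ-rawSemiring : RawSemiring 0ℓ 0ℓ
ℝ-rawSemiring = record
  { Carrier = ℝ ; _≈_ = _≈_ ; _+_ = _+_ ; _*_ = _*_ ; 0# = 0ℝ ; 1# = 1ℝ }

open RawSemiringDefs ℝ-rawSemiring public using (_^_)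

seq-^ : ∀ x k n → seq (x ^ k) n ≡ seq x n Sequences.^ k
seq-^ x zero    n = refl
seq-^ x (suc k) n = cong (seq x n ℚ.*_) (seq-^ x k n)

0<2-q^ : ∀ p → 0ℝ < p → p < 1ℝ → ∀ k → 0ℝ < 2ℝ - (1ℝ - p) ^ k
0<2-q^ p (ε , 0<ε , N , lo) (ε′ , 0<ε′ , N′ , hi) k =
  1ℚ , ℚ.*<* (ℤ.+<+ (ℕ.s≤s ℕ.z≤n)) , N ℕ.⊔ N′ , λ n ≤n →
    let 0≤q , q≤1 = 1-bounds 0<ε 0<ε′ (lo n (ℕ.m⊔n≤o⇒m≤o N N′ ≤n)) (hi n (ℕ.m⊔n≤o⇒n≤o N N′ ≤n))
    in subst (λ z → 0ℚ ℚ.+ 1ℚ ℚ.≤ (1ℚ ℚ.+ 1ℚ) ℚ.+ ℚ.- z) (sym (seq-^ (1ℝ - p) k n)) (2-^≥1 0≤q q≤1 k)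

-- Finite simple graphs whose vertex set is a subset of Fin n.
record Graph (n : ℕ) : Set₁ where
  infix 4 _~_ _~?_
  field
    vertices : Subset n
    _~_      : Rel (Fin n) 0ℓ
    _~?_     : Decidable _~_
    ~-sym    : Symmetric _~_
    ~-irrefl : Irreflexive _≡_ _~_
    ~⇒∈      : ∀ {i j} → i ~ j → i ∈ vertices

complete : ∀ n → Graph n
complete n = record
  { vertices = ⊤
  ; _~_      = _≢_
  ; _~?_     = λ i j → ¬? (i Fin.≟ j)
  ; ~-sym    = ≢-sym
  ; ~-irrefl = λ i≡j i≢j → i≢j i≡j
  ; ~⇒∈      = λ _ → ∈⊤
  }

circularDistance : ∀ {n} → Fin n → Fin n → ℕ
circularDistance {n} i j = ℕ.∣ toℕ i - toℕ j ∣ ℕ.⊓ (n ℕ.∸ ℕ.∣ toℕ i - toℕ j ∣)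

chain : (n K : ℕ) → Graph n
chain n K = record
  { vertices = ⊤
  ; _~_      = λ i j → i ≢ j × circularDistance i j ℕ.≤ K
  ; _~?_     = λ i j → ¬? (i Fin.≟ j) ×-dec (circularDistance i j ℕ.≤? K)
  ; ~-sym    = λ {i} {j} (i≢j , d≤K) → ≢-sym i≢j ,
      subst (λ d → d ℕ.⊓ (n ℕ.∸ d) ℕ.≤ K) (ℕ.∣-∣-comm (toℕ i) (toℕ j)) d≤K
  ; ~-irrefl = λ i≡j (i≢j , _) → i≢j i≡j
  ; ~⇒∈      = λ _ → ∈⊤
  }

infix 9 _[_]

_[_] : ∀ {n} → Graph n → Subset n → Graph n
G [ S ] = record
  { vertices = vertices ∩ S
  ; _~_      = λ i j → i ~ j × i ∈ S × j ∈ S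
  ; _~?_     = λ i j → (i ~? j) ×-dec ((i ∈? S) ×-dec (j ∈? S))
  ; ~-sym    = λ (i~j , i∈S , j∈S) → ~-sym i~j , j∈S , i∈S
  ; ~-irrefl = λ i≡j (i~j , _) → ~-irrefl i≡j i~j
  ; ~⇒∈      = λ (i~j , i∈S , _) → x∈p∩q⁺ (~⇒∈ i~j , i∈S)
  }
  where open Graph G

Edge : ℕ → Set
Edge n = Fin n × Fin n

-- Each undirected edge is listed once, with its smaller endpoint first.
edges : ∀ {n} → Graph n → List (Edge n)
edges {n} G = List.filter (λ (i , j) → (i Fin.<? j) ×-dec (i ~? j))
  (List.cartesianProduct (List.allFin n) (List.allFin n))
  where open Graph G

Disjoint : ∀ {n} → Rel (Edge n) 0ℓ
Disjoint (i , j) (k , l) = (i ≢ k × i ≢ l) × (j ≢ k × j ≢ l)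

disjoint? : ∀ {n} → Decidable (Disjoint {n})
disjoint? (i , j) (k , l) =
  (¬? (i Fin.≟ k) ×-dec ¬? (i Fin.≟ l)) ×-dec (¬? (j Fin.≟ k) ×-dec ¬? (j Fin.≟ l))

IsMatching : ∀ {n} → List (Edge n) → Set
IsMatching = AllPairs Disjoint

sublists : ∀ {A : Set} → List A → List (List A)
sublists []       = [] ∷ []
sublists (x ∷ xs) = List.map (x ∷_) (sublists xs) ++ sublists xs

μ : ∀ {n} → Graph n → ℕ
μ G = max 0 (List.map List.length (List.filter (allPairs? disjoint?) (sublists (edges G))))

data Demand : Set where
  half full : Demand

⟦_⟧ : Demand → ℚ
⟦ half ⟧ = ½
⟦ full ⟧ = 1ℚ

supp : ∀ {n} → Vec Demand n → Subset n
supp = Vec.map (λ d → does (⟦ d ⟧ ℚ.≟ ½))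

demands : ∀ n → List (Vec Demand n)
demands zero    = [] ∷ []
demands (suc n) = List.cartesianProductWith _∷_ (half ∷ full ∷ []) (demands n)

module _ (p : ℝ) where

  weight : Demand → ℝ
  weight half = p
  weight full = 1ℝ - p

  -- Independence: the probability of a demand vector is the product of the
  -- probabilities of its entries.
  Pr : ∀ {n} → Vec Demand n → ℝ
  Pr = Vec.foldr′ (λ d r → weight d * r) 1ℝ

  𝔼 : ∀ {n} → (Vec Demand n → ℝ) → ℝ
  𝔼 {n} f = List.foldr (λ D s → Pr D * f D + s) 0ℝ (demands n)

  L : ∀ {n} → Graph n → ℝ
  L {n} G = 2ℝ * 𝔼 λ D → fromℕ (μ (complete n [ supp D ])) - fromℕ (μ (G [ supp D ]))

{-# OPTIONS --safe #-}

-- Call a maximal run of half-demand vertices with consecutive circular distances at most K a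
-- cluster.  Up to the parity of the number of half-demand vertices, twice the matching loss is the
-- number of odd clusters.  From above, it is at most the number of clusters when the circle is cut
-- open between n − 1 and 0, whose expectation is at most npqᴷ + 1.  From below, a given vertex is
-- the last one of an odd cluster with probability pqᴷ times the probability that, reading n − K − 1
-- further vertices backwards, the cluster picks up an even number of them.  Reading on forever this
-- probability would be 1/(2 − qᴷ), and the cluster is still unfinished after K + j vertices with
-- probability at most (1 − pqᴷ)ʲ ≤ exp(−j pqᴷ).

module Submission where

open import Defs hiding (_+_; _*_; _-_; -_; _≤_; _<_; _≈_; _^_)
open import Data.Bool.Base using (Bool; true; false; if_then_else_; not)
open import Data.Bool.Properties using (not-involutive; T-≡)
open import Data.Fin.Base as Fin using (Fin; toℕ)
import Data.Fin.Properties as Fin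
import Data.Fin.Subset as Subset
open import Data.List.Base as List using (List; []; _∷_; _++_; length)
open import Data.List.Extrema.Nat using (xs≤max; argmax-sel)
open import Data.List.Membership.Propositional using (_∈_)
open import Data.List.Membership.Propositional.Properties
  using (∈-∃++; ∈-map⁺; ∈-map⁻; ∈-++⁺ˡ; ∈-++⁺ʳ; ∈-++⁻; ∈-filter⁺; ∈-filter⁻; ∈-cartesianProduct⁺; ∈-allFin)
open import Data.List.Properties using (length-map; length-++; map-++; map-∘; map-cong; ++-identityʳ)
open import Data.List.Relation.Binary.Permutation.Propositional as Perm
  using (_↭_; ↭-refl; ↭-sym; ↭-trans; prep)
import Data.List.Relation.Binary.Permutation.Propositional.Properties as Perm
import Data.List.Relation.Binary.Permutation.Setoid.Properties as PermSetoid
open import Data.List.Relation.Binary.Subset.Propositional using (_⊆_)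
open import Data.List.Relation.Unary.All as All using (All; []; _∷_)
import Data.List.Relation.Unary.All.Properties as All
open import Data.List.Relation.Unary.AllPairs as AllPairs using (AllPairs; []; _∷_; allPairs?)
import Data.List.Relation.Unary.AllPairs.Properties as AllPairs
open import Data.List.Relation.Unary.Any using (here; there; any?) renaming (tail to ∈-tail)
open import Data.List.Relation.Unary.Unique.Propositional using (Unique)
import Data.List.Relation.Unary.Unique.Propositional.Properties as Unique
open import Data.Maybe.Base as Maybe using (Maybe; just; nothing)
open import Data.Nat.Base as ℕ using (ℕ; zero; suc; z≤n; s≤s; _≡ᵇ_)
open import Data.Nat.DivMod using (_%_; _/_; _mod_; m<n⇒m%n≡m; [m+n]%n≡m%n; m≡m%n+[m/n]*n)
open import Data.Nat.ListAction using (sum)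
open import Data.Nat.ListAction.Properties using (sum-↭; sum-++)
import Data.Nat.Properties as ℕ
open import Data.Nat.Tactic.RingSolver using (solve-∀)
open import Data.Product.Base using (∃; _×_; _,_; proj₁; proj₂)
import Data.Rational.Base
open import Data.Rational.Base as ℚ using (ℚ; 0ℚ; 1ℚ)
import Data.Rational.Properties as ℚ
open import Data.Rational.Solver using (module +-*-Solver)
open import Data.Sum.Base using (_⊎_; inj₁; inj₂)
open import Data.Vec.Base as Vec using (Vec; []; _∷_; _∷ʳ_; here; there)
open import Function.Base using (_∘_; id)
open import Function.Bundles using (Equivalence)
open import Relation.Binary.Definitions using (DecidableEquality; Symmetric)
open import Relation.Binary.PropositionalEquality hiding ([_])
open import Relation.Nullary using (Dec; yes; no; contradiction; _×-dec_)

open Sequences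
  using (ι; ι-+; ι-*; ι-mono; 0≤ι; 0<ι; 0<1; 0≤1; 0≤-⇒≤; ≤⇒0≤-; ≤-step; *-mono; *-nonNeg; +-nonNeg;
         ^-nonNeg; inv; expSum; expSum-mono)
  renaming (_^_ to _^ℚ_)
open +-*-Solver using (solve; _:+_; _:*_; _:-_; :-_; con; _:=_)

-- Maximum matchings

-- Operations on `ℝ` act termwise on sequences of rationals, so the `k`-th term of `L p G` is
-- exactly the expected loss at the rational parameter `seq p k`, and all probability is done over
-- `ℚ`. Only `exp` resists: its `k`-th term is a partial sum, which at a negative argument can lie
-- below the exponential. Comparing (1 - pqᴷ)ʲ with it therefore costs a truncation error, which has
-- to be bounded uniformly in `seq p k` and to tend to 0. The stated constants leave slack. In the
-- upper bound, (1 - qᴷ)²/(2 - qᴷ) + qᴷ is simply added to a coefficient 1 that suffices. In the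
-- lower bound, (1 - qᴷ)² is a factor at most 1 that could be left out. A vertex and its gap use K +
-- 1 of the n vertices and the decay sets in after K more, so j = n - 2K - 1, which is more than (n
-- - 3K - 2)/2 once n ≥ 3K + 2. For n ≤ 3K + 2 the exponential is at least 1, and L ≥ -1 is enough.

module _ {A : Set} where

  Unique-resp-↭ : ∀ {xs ys : List A} → xs ↭ ys → Unique xs → Unique ys
  Unique-resp-↭ = PermSetoid.Unique-resp-↭ (setoid A) ∘ Perm.↭⇒↭ₛ

  AllPairs-resp-↭ : ∀ {R : A → A → Set} → Symmetric R → ∀ {xs ys} → xs ↭ ys → AllPairs R xs → AllPairs R ys
  AllPairs-resp-↭ {R} R-sym = PermSetoid.AllPairs-resp-↭ (setoid A) R-sym (resp₂ R) ∘ Perm.↭⇒↭ₛ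

  ∈⇒↭ : ∀ {x : A} {xs} → x ∈ xs → ∃ λ ys → xs ↭ x ∷ ys
  ∈⇒↭ x∈xs with ys , zs , refl ← ∈-∃++ x∈xs = ys ++ zs , Perm.shift _ ys zs

  ∷⊆⇒⊆ : ∀ {x : A} {xs ys} → Unique (x ∷ xs) → x ∷ xs ⊆ x ∷ ys → xs ⊆ ys
  ∷⊆⇒⊆ (x∉ ∷ _) ⊆ z∈ with ⊆ (there z∈)
  ... | here refl = contradiction refl (All.lookup x∉ z∈)
  ... | there z∈′ = z∈′

  Unique-⊆⇒↭ : ∀ {xs ys : List A} → Unique xs → xs ⊆ ys → ∃ λ zs → ys ↭ xs ++ zs
  Unique-⊆⇒↭ {[]} {ys} _ _ = ys , ↭-refl
  Unique-⊆⇒↭ {x ∷ xs} u@(_ ∷ u′) xs⊆ys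
    with ys′ , ys↭ ← ∈⇒↭ (xs⊆ys (here refl))
    with zs , ys′↭ ← Unique-⊆⇒↭ {xs} u′ (∷⊆⇒⊆ u (Perm.∈-resp-↭ ys↭ ∘ xs⊆ys))
    = zs , ↭-trans ys↭ (prep x ys′↭)

  ∈-sublists⇒⊆ : ∀ {xs : List A} ys → xs ∈ sublists ys → xs ⊆ ys
  ∈-sublists⇒⊆ [] (here refl) ()
  ∈-sublists⇒⊆ (y ∷ ys) xs∈ z∈ with ∈-++⁻ (List.map (y ∷_) (sublists ys)) xs∈
  ... | inj₂ xs∈′ = there (∈-sublists⇒⊆ ys xs∈′ z∈)
  ... | inj₁ xs∈′ with ∈-map⁻ (y ∷_) xs∈′
  ... | _ , xs∈″ , refl with z∈
  ... | here refl = here refl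
  ... | there z∈′ = there (∈-sublists⇒⊆ ys xs∈″ z∈′)

  -- `μ` maximises over sublists only, which keep the order of `edges`. An arbitrary matching must
  -- first be permuted into that order; being a matching survives this because `Disjoint` is
  -- symmetric.
  ⊆⇒∈-sublists : DecidableEquality A → ∀ {xs} ys → Unique xs → xs ⊆ ys →
                 ∃ λ zs → zs ∈ sublists ys × xs ↭ zs
  ⊆⇒∈-sublists _≟_ {[]} [] _ _ = [] , here refl , ↭-refl
  ⊆⇒∈-sublists _≟_ {x ∷ xs} [] _ xs⊆ with () ← xs⊆ (here refl)
  ⊆⇒∈-sublists _≟_ {xs} (y ∷ ys) u xs⊆ with any? (y ≟_) xs
  ... | yes y∈xs
    with xs′ , xs↭ ← ∈⇒↭ y∈xs
    with u′@(_ ∷ u″) ← Unique-resp-↭ xs↭ u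
    with zs , zs∈ , xs′↭ ← ⊆⇒∈-sublists _≟_ ys u″ (∷⊆⇒⊆ u′ (xs⊆ ∘ Perm.∈-resp-↭ (↭-sym xs↭)))
    = y ∷ zs , ∈-++⁺ˡ (∈-map⁺ (y ∷_) zs∈) , ↭-trans xs↭ (prep y xs′↭)
  ... | no y∉xs
    with zs , zs∈ , xs↭ ← ⊆⇒∈-sublists _≟_ ys u (λ z∈ → ∈-tail (λ { refl → y∉xs z∈ }) (xs⊆ z∈))
    = zs , ∈-++⁺ʳ _ zs∈ , xs↭

module _ {n : ℕ} where

  _≟ᴱ_ : DecidableEquality (Edge n)
  (i , j) ≟ᴱ (k , l) with i Fin.≟ k | j Fin.≟ l
  ... | yes refl | yes refl = yes refl
  ... | no i≢k   | _        = no λ { refl → i≢k refl }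
  ... | _        | no j≢l   = no λ { refl → j≢l refl }

  Disjoint-sym : Symmetric (Disjoint {n})
  Disjoint-sym ((i≢k , i≢l) , (j≢k , j≢l)) = (≢-sym i≢k , ≢-sym j≢k) , (≢-sym i≢l , ≢-sym j≢l)

  matching-unique : ∀ {M : List (Edge n)} → IsMatching M → Unique M
  matching-unique = AllPairs.map λ { ((i≢i , _) , _) refl → i≢i refl }

module _ {n : ℕ} (G : Graph n) where

  open Graph G

  ∈-edges⁺ : ∀ {i j} → i Fin.< j → i ~ j → (i , j) ∈ edges G
  ∈-edges⁺ {i} {j} i<j i~j = ∈-filter⁺ (λ (i , j) → (i Fin.<? j) ×-dec (i ~? j))
    (∈-cartesianProduct⁺ (∈-allFin i) (∈-allFin j)) (i<j , i~j)

  ∈-edges⁻ : ∀ {i j} → (i , j) ∈ edges G → i Fin.< j × i ~ j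
  ∈-edges⁻ ij∈ = proj₂ (∈-filter⁻ (λ (i , j) → (i Fin.<? j) ×-dec (i ~? j)) {xs = List.cartesianProduct (List.allFin n) (List.allFin n)} ij∈)

  length≤μ : ∀ {M} → IsMatching M → M ⊆ edges G → length M ℕ.≤ μ G
  length≤μ {M} matching M⊆
    with zs , zs∈ , M↭zs ← ⊆⇒∈-sublists _≟ᴱ_ (edges G) (matching-unique matching) M⊆
    = subst (ℕ._≤ μ G) (sym (Perm.↭-length M↭zs)) (All.lookup
        (xs≤max 0 (List.map length (List.filter (allPairs? disjoint?) (sublists (edges G)))))
        (∈-map⁺ length (∈-filter⁺ (allPairs? disjoint?) zs∈ (AllPairs-resp-↭ Disjoint-sym M↭zs matching))))

  μ-attained : ∃ λ M → IsMatching M × M ⊆ edges G × length M ≡ μ G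
  μ-attained with argmax-sel id 0 (List.map length (List.filter (allPairs? disjoint?) (sublists (edges G))))
  -- The default value of `max` was returned; the empty matching has that size.
  ... | inj₁ μ≡0 = [] , [] , (λ ()) , sym μ≡0
  ... | inj₂ μ∈ with M , M∈ , μ≡ ← ∈-map⁻ length μ∈
                with M∈′ , matching ← ∈-filter⁻ (allPairs? disjoint?) {xs = sublists (edges G)} M∈
                = M , matching , ∈-sublists⇒⊆ (edges G) M∈′ , sym μ≡

-- Pairing off consecutive vertices

halves : ∀ {n} → Vec Demand n → ℕ
halves []         = 0
halves (half ∷ D) = suc (halves D)
halves (full ∷ D) = halves D

-- No half among the first K entries; past the end everything counts as full.
clear : ∀ {n} → ℕ → Vec Demand n → Bool
clear zero    _          = true
clear (suc K) []         = true
clear (suc K) (half ∷ _) = false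
clear (suc K) (full ∷ D) = clear K D

-- A cluster is counted at its last half.
clusters : ∀ {n} → ℕ → Vec Demand n → ℕ
clusters K []         = 0
clusters K (half ∷ D) = (if clear K D then 1 else 0) ℕ.+ clusters K D
clusters K (full ∷ D) = clusters K D

firstHalf : ∀ {n} → Vec Demand n → Maybe (Fin n)
firstHalf []         = nothing
firstHalf (half ∷ D) = just Fin.zero
firstHalf (full ∷ D) = Maybe.map Fin.suc (firstHalf D)

clear-false : ∀ {n} K (D : Vec Demand n) → clear K D ≡ false →
              ∃ λ f → firstHalf D ≡ just f × toℕ f ℕ.< K
clear-false (suc K) (half ∷ D) _  = Fin.zero , refl , s≤s z≤n
clear-false (suc K) (full ∷ D) eq with f , first≡ , f<K ← clear-false K D eq =
  Fin.suc f , cong (Maybe.map Fin.suc) first≡ , s≤s f<K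

clear-true : ∀ {n} K K′ (D : Vec Demand n) → n ℕ.≤ K → clear K D ≡ true → clusters K′ D ≡ 0
clear-true K       K′ []         _         _  = refl
clear-true (suc K) K′ (full ∷ D) (s≤s n≤K) eq = clear-true K K′ D n≤K eq

clusters≤1 : ∀ {n} K (D : Vec Demand n) → n ℕ.≤ K → clusters K D ℕ.≤ 1
clusters≤1 K []         _   = z≤n
clusters≤1 K (full ∷ D) n≤K = clusters≤1 K D (ℕ.<⇒≤ n≤K)
clusters≤1 K (half ∷ D) n≤K with clear K D in eq
... | true  = s≤s (ℕ.≤-reflexive (clear-true K K D (ℕ.<⇒≤ n≤K) eq))
... | false = clusters≤1 K D (ℕ.<⇒≤ n≤K)

firstHalf-∈ : ∀ {n} (D : Vec Demand n) {f} → firstHalf D ≡ just f → f Subset.∈ supp D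
firstHalf-∈ (half ∷ D) refl = here
firstHalf-∈ (full ∷ D) eq with firstHalf D in eq′ | eq
... | just f | refl = there (firstHalf-∈ D eq′)

ShortEdge : ∀ {n} → ℕ → Vec Demand n → Edge n → Set
ShortEdge K D (i , j) = i Fin.< j × toℕ j ℕ.≤ K ℕ.+ toℕ i × i Subset.∈ supp D × j Subset.∈ supp D

Avoids : ∀ {n} → Fin n → Edge n → Set
Avoids f (i , j) = f ≢ i × f ≢ j

-- What the greedy matching of consecutive vertices, built from the right, has done
-- to its leftmost cluster.
data Leftmost {n} (K : ℕ) (D : Vec Demand n) (M : List (Edge n)) : Set where
  absent    : firstHalf D ≡ nothing → halves D ≡ 0 → Leftmost K D M
  saturated : suc (halves D) ℕ.≤ 2 ℕ.* length M ℕ.+ clusters K D → Leftmost K D M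
  exposed   : ∀ f → firstHalf D ≡ just f → All (Avoids f) M →
              halves D ℕ.≤ 2 ℕ.* length M ℕ.+ clusters K D → Leftmost K D M

unmatched≤clusters : ∀ {n K} {D : Vec Demand n} {M} → Leftmost K D M →
  halves D ℕ.≤ 2 ℕ.* length M ℕ.+ clusters K D
unmatched≤clusters (absent _ h≡0) rewrite h≡0 = z≤n
unmatched≤clusters (saturated h<)     = ℕ.<⇒≤ h<
unmatched≤clusters (exposed _ _ _ h≤) = h≤

raise : ∀ {n} → Edge n → Edge (suc n)
raise (i , j) = Fin.suc i , Fin.suc j

raise-short : ∀ {n} K d (D : Vec Demand n) {M} → All (ShortEdge K D) M → All (ShortEdge K (d ∷ D)) (List.map raise M)
raise-short K d D = All.map⁺ ∘ All.map λ {(i , j)} (i<j , j≤ , i∈ , j∈) →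
  s≤s i<j , subst (suc (toℕ j) ℕ.≤_) (sym (ℕ.+-suc K (toℕ i))) (s≤s j≤) , there i∈ , there j∈

raise-matching : ∀ {n} {M : List (Edge n)} → IsMatching M → IsMatching (List.map raise M)
raise-matching = AllPairs.map⁺ ∘ AllPairs.map λ ((a , b) , (c , d)) →
  (a ∘ Fin.suc-injective , b ∘ Fin.suc-injective) , (c ∘ Fin.suc-injective , d ∘ Fin.suc-injective)

raise-avoids : ∀ {n} {f : Fin n} {M} → All (Avoids f) M → All (Avoids (Fin.suc f)) (List.map raise M)
raise-avoids = All.map⁺ ∘ All.map λ (a , b) → a ∘ Fin.suc-injective , b ∘ Fin.suc-injective

zero-avoids : ∀ {n} {M : List (Edge n)} → All (Avoids Fin.zero) (List.map raise M)
zero-avoids {M = M} = All.map⁺ (All.universal (λ _ → (λ ()) , λ ()) M)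

-- Each unmatched half is charged to its own cluster. While the leftmost cluster is `saturated`, its
-- charge is still available, which is the extra unit in that constructor; while it is `exposed`,
-- the charge is spent on its first half, the only one that the next half to the left may have to be
-- matched with.
greedy : ∀ {n} K (D : Vec Demand n) → ∃ λ M → IsMatching M × All (ShortEdge K D) M × Leftmost K D M
greedy K [] = [] , [] , [] , absent refl refl
greedy K (full ∷ D) with M , matching , short , leftmost ← greedy K D =
  List.map raise M , raise-matching matching , raise-short K full D short , extend leftmost
  where
  extend : Leftmost K D M → Leftmost K (full ∷ D) (List.map raise M)
  extend (absent eq h≡0) = absent (cong (Maybe.map Fin.suc) eq) h≡0
  extend (saturated h<) = saturated (subst (λ l → _ ℕ.≤ 2 ℕ.* l ℕ.+ _) (sym (length-map raise M)) h<)
  extend (exposed f eq avoids h≤) = exposed (Fin.suc f) (cong (Maybe.map Fin.suc) eq) (raise-avoids avoids)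
    (subst (λ l → _ ℕ.≤ 2 ℕ.* l ℕ.+ _) (sym (length-map raise M)) h≤)
greedy K (half ∷ D) with M , matching , short , leftmost ← greedy K D | clear K D in eq
-- The half is the last one of a new cluster, whose charge pays for leaving it exposed.
... | true =
  List.map raise M , raise-matching matching , raise-short K half D short ,
  exposed Fin.zero refl (zero-avoids {M = M}) (begin
    suc (halves D) ≤⟨ s≤s (unmatched≤clusters leftmost) ⟩
    suc (2 ℕ.* length M ℕ.+ clusters K D) ≡⟨ ℕ.+-suc (2 ℕ.* length M) (clusters K D) ⟨
    2 ℕ.* length M ℕ.+ suc (clusters K D)
      ≡⟨ cong₂ (λ l c → 2 ℕ.* l ℕ.+ ((if c then 1 else 0) ℕ.+ clusters K D)) (length-map raise M) eq ⟨
    2 ℕ.* length (List.map raise M) ℕ.+ clusters K (half ∷ D) ∎)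
  where
  open ℕ.≤-Reasoning
... | false with f , first≡ , f<K ← clear-false K D eq | leftmost
... | absent first≡′ _ with () ← trans (sym first≡) first≡′
-- The spare unit pays for leaving the new half exposed.
... | saturated h< =
  List.map raise M , raise-matching matching , raise-short K half D short ,
  exposed Fin.zero refl (zero-avoids {M = M})
    (subst₂ (λ l c → suc (halves D) ℕ.≤ 2 ℕ.* l ℕ.+ ((if c then 1 else 0) ℕ.+ clusters K D)) (sym (length-map raise M)) (sym eq) h<)
-- The new half is matched with the exposed one, at distance `toℕ f + 1 ≤ K`. The edge adds two on
-- the right and only one half is new, so a unit becomes spare again.
... | exposed f′ first≡′ avoids h≤ with refl ← trans (sym first≡) first≡′ =
  (Fin.zero , Fin.suc f) ∷ List.map raise M ,
  All.zipWith (λ ((a , b) , (c , d)) → (a , b) , (c , d)) (zero-avoids {M = M} , raise-avoids avoids) ∷ raise-matching matching ,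
  (s≤s z≤n , subst (suc (toℕ f) ℕ.≤_) (sym (ℕ.+-identityʳ K)) f<K , here , there (firstHalf-∈ D first≡)) ∷ raise-short K half D short ,
  saturated (begin
    suc (suc (halves D)) ≤⟨ s≤s (s≤s h≤) ⟩
    2 ℕ.+ (2 ℕ.* length M ℕ.+ clusters K D) ≡⟨ ℕ.+-assoc 2 (2 ℕ.* length M) (clusters K D) ⟨
    2 ℕ.+ 2 ℕ.* length M ℕ.+ clusters K D ≡⟨ cong (ℕ._+ clusters K D) (ℕ.*-suc 2 (length M)) ⟨
    2 ℕ.* suc (length M) ℕ.+ clusters K D
      ≡⟨ cong₂ (λ l c → 2 ℕ.* suc l ℕ.+ ((if c then 1 else 0) ℕ.+ clusters K D)) (length-map raise M) eq ⟨
    2 ℕ.* suc (length (List.map raise M)) ℕ.+ clusters K (half ∷ D) ∎)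
  where open ℕ.≤-Reasoning

halves≤2μ+clusters : ∀ {n} (G : Graph n) K (D : Vec Demand n) →
  (∀ {i j} → i Fin.< j → toℕ j ℕ.≤ K ℕ.+ toℕ i → Graph._~_ G i j) →
  halves D ℕ.≤ 2 ℕ.* μ (G [ supp D ]) ℕ.+ clusters K D
halves≤2μ+clusters G K D short⇒~ with M , matching , short , leftmost ← greedy K D = begin
    halves D                                        ≤⟨ unmatched≤clusters leftmost ⟩
    2 ℕ.* length M ℕ.+ clusters K D
      ≤⟨ ℕ.+-monoˡ-≤ _ (ℕ.*-monoʳ-≤ 2 (length≤μ (G [ supp D ]) matching M⊆)) ⟩
    2 ℕ.* μ (G [ supp D ]) ℕ.+ clusters K D         ∎
  where
  open ℕ.≤-Reasoning
  M⊆ : M ⊆ edges (G [ supp D ])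
  M⊆ e∈ with i<j , j≤ , i∈ , j∈ ← All.lookup short e∈ = ∈-edges⁺ (G [ supp D ]) i<j (short⇒~ i<j j≤ , i∈ , j∈)

-- In the complete graph all distances are allowed, so it may be treated as a chain with `K = n`,
-- where all halves form a single cluster. Only parity is lost.
halves≤2μ-complete+1 : ∀ {n} (D : Vec Demand n) → halves D ℕ.≤ 2 ℕ.* μ (complete n [ supp D ]) ℕ.+ 1
halves≤2μ-complete+1 {n} D = ℕ.≤-trans
  (halves≤2μ+clusters (complete n) n D λ i<j _ → Fin.<⇒≢ i<j)
  (ℕ.+-monoʳ-≤ _ (clusters≤1 n D ℕ.≤-refl))

halves≤2μ-chain+clusters : ∀ {n} K (D : Vec Demand n) → halves D ℕ.≤ 2 ℕ.* μ (chain n K [ supp D ]) ℕ.+ clusters K D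
halves≤2μ-chain+clusters {n} K D = halves≤2μ+clusters (chain n K) K D λ {i} {j} i<j j≤ →
  Fin.<⇒≢ i<j , ℕ.≤-trans (ℕ.m⊓n≤m _ _) (begin
    ℕ.∣ toℕ i - toℕ j ∣        ≡⟨ ℕ.m≤n⇒∣m-n∣≡n∸m (ℕ.<⇒≤ i<j) ⟩
    toℕ j ℕ.∸ toℕ i            ≤⟨ ℕ.∸-monoˡ-≤ (toℕ i) j≤ ⟩
    K ℕ.+ toℕ i ℕ.∸ toℕ i      ≡⟨ ℕ.m+n∸n≡m K (toℕ i) ⟩
    K                          ∎)
  where open ℕ.≤-Reasoning

-- Odd clusters on the circle

odd : ℕ → Bool
odd zero    = false
odd (suc k) = not (odd k)

odd-suc-suc : ∀ k → odd (suc (suc k)) ≡ odd k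
odd-suc-suc = not-involutive ∘ odd

odd⇒≥1 : ∀ k → odd k ≡ true → 1 ℕ.≤ k
odd⇒≥1 (suc k) _ = s≤s z≤n

δ : ℕ → ℕ → ℕ
δ a b = if a ≡ᵇ b then 1 else 0

δ-≡ : ∀ {a b} → a ≡ b → δ a b ≡ 1
δ-≡ {a} refl rewrite Equivalence.to T-≡ (ℕ.≡⇒≡ᵇ a a refl) = refl

δ-≢ : ∀ {a b} → a ≢ b → δ a b ≡ 0
δ-≢ {a} {b} a≢b with a ≡ᵇ b in eq
... | true  = contradiction (ℕ.≡ᵇ⇒≡ a b (Equivalence.from T-≡ eq)) a≢b
... | false = refl

sumFrom : (ℕ → ℕ) → ℕ → ℕ → ℕ
sumFrom f k zero    = 0
sumFrom f k (suc d) = f k ℕ.+ sumFrom f (suc k) d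

sumFrom-+ : ∀ f k a b → sumFrom f k (a ℕ.+ b) ≡ sumFrom f k a ℕ.+ sumFrom f (a ℕ.+ k) b
sumFrom-+ f k zero    b = refl
sumFrom-+ f k (suc a) b = begin
  f k ℕ.+ sumFrom f (suc k) (a ℕ.+ b)
    ≡⟨ cong (f k ℕ.+_) (sumFrom-+ f (suc k) a b) ⟩
  f k ℕ.+ (sumFrom f (suc k) a ℕ.+ sumFrom f (a ℕ.+ suc k) b)
    ≡⟨ cong (λ i → f k ℕ.+ (sumFrom f (suc k) a ℕ.+ sumFrom f i b)) (ℕ.+-suc a k) ⟩
  f k ℕ.+ (sumFrom f (suc k) a ℕ.+ sumFrom f (suc a ℕ.+ k) b)         ≡⟨ ℕ.+-assoc (f k) _ _ ⟨
  sumFrom f k (suc a) ℕ.+ sumFrom f (suc a ℕ.+ k) b                   ∎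
  where open ≡-Reasoning

sumFrom-distrib : ∀ f g k d → sumFrom (λ i → f i ℕ.+ g i) k d ≡ sumFrom f k d ℕ.+ sumFrom g k d
sumFrom-distrib f g k zero    = refl
sumFrom-distrib f g k (suc d) = begin
  (f k ℕ.+ g k) ℕ.+ sumFrom (λ i → f i ℕ.+ g i) (suc k) d
    ≡⟨ cong ((f k ℕ.+ g k) ℕ.+_) (sumFrom-distrib f g (suc k) d) ⟩
  (f k ℕ.+ g k) ℕ.+ (sumFrom f (suc k) d ℕ.+ sumFrom g (suc k) d) ≡⟨ +-interchange (f k) (g k) _ _ ⟩
  sumFrom f k (suc d) ℕ.+ sumFrom g k (suc d)                ∎
  where
  open ≡-Reasoning
  open import Algebra.Properties.CommutativeSemigroup ℕ.+-commutativeSemigroup using () renaming (interchange to +-interchange)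

sumFrom-mono : ∀ f g k d → (∀ t → t ℕ.< d → f (t ℕ.+ k) ℕ.≤ g (t ℕ.+ k)) → sumFrom f k d ℕ.≤ sumFrom g k d
sumFrom-mono f g k zero    _   = z≤n
sumFrom-mono f g k (suc d) f≤g = ℕ.+-mono-≤ (f≤g 0 (s≤s z≤n)) (sumFrom-mono f g (suc k) d λ t t<d →
  subst (λ i → f i ℕ.≤ g i) (sym (ℕ.+-suc t k)) (f≤g (suc t) (s≤s t<d)))

sumFrom-zero : ∀ f k d → (∀ t → t ℕ.< d → f (t ℕ.+ k) ≡ 0) → sumFrom f k d ≡ 0
sumFrom-zero f k zero    _  = refl
sumFrom-zero f k (suc d) f0 = cong₂ ℕ._+_ (f0 0 (s≤s z≤n))
  (sumFrom-zero f (suc k) d λ t t<d → trans (cong f (ℕ.+-suc t k)) (f0 (suc t) (s≤s t<d)))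

sumFrom-δ : ∀ a k d → sumFrom (δ a) k d ℕ.≤ 1
sumFrom-δ a k zero    = z≤n
sumFrom-δ a k (suc d) with a ℕ.≟ k
... | no a≢k rewrite δ-≢ a≢k = sumFrom-δ a (suc k) d
... | yes refl rewrite δ-≡ {a} refl = s≤s (ℕ.≤-reflexive (sumFrom-zero (δ a) (suc a) d
    λ t _ → δ-≢ (ℕ.<⇒≢ (subst (a ℕ.<_) (sym (ℕ.+-suc t a)) (s≤s (ℕ.m≤n+m a t))))))

sumFrom-rotate : ∀ f n → (∀ k → f (n ℕ.+ k) ≡ f k) → ∀ k → sumFrom f k n ≡ sumFrom f 0 n
sumFrom-rotate f n f-per zero    = refl
sumFrom-rotate f n f-per (suc k) = trans (ℕ.+-cancelˡ-≡ (f k) _ _ (begin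
  f k ℕ.+ sumFrom f (suc k) n              ≡⟨⟩
  sumFrom f k (1 ℕ.+ n)                    ≡⟨ cong (sumFrom f k) (ℕ.+-comm 1 n) ⟩
  sumFrom f k (n ℕ.+ 1)                    ≡⟨ sumFrom-+ f k n 1 ⟩
  sumFrom f k n ℕ.+ (f (n ℕ.+ k) ℕ.+ 0)
    ≡⟨ cong (sumFrom f k n ℕ.+_) (trans (ℕ.+-identityʳ _) (f-per k)) ⟩
  sumFrom f k n ℕ.+ f k                    ≡⟨ ℕ.+-comm (sumFrom f k n) (f k) ⟩
  f k ℕ.+ sumFrom f k n                    ∎)) (sumFrom-rotate f n f-per k)
  where open ≡-Reasoning

whenHalf : Demand → ℕ → ℕ
whenHalf half x = x
whenHalf full x = 0

window : (ℕ → Demand) → ℕ → ∀ d → Vec Demand d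
window s k zero    = []
window s k (suc d) = s k ∷ window s (suc k) d

-- Read from right to left, starting just after a half.  The first component is
-- the number of further consecutive fulls that keeps the cluster of that half
-- going, 0 once the cluster has ended; the second is the parity of the number
-- of further halves in the cluster.
step : ℕ → Demand → ℕ × Bool → ℕ × Bool
step K _    (zero  , b) = zero , b
step K half (suc g , b) = K , not b
step K full (suc g , b) = g , b

scan : ∀ {d} → ℕ → Vec Demand d → ℕ × Bool
scan K = Vec.foldr′ (step K) (K , false)

-- `r` counts the fulls that are still required. A vector too short for them gives `false`, so for
-- `n ≤ K` no vertex passes `oddEnd`; such `n` need only the trivial lower bound -1.
evenAfterGap : ∀ {d} → ℕ → ℕ → Vec Demand d → Bool
evenAfterGap K zero    D          = not (proj₂ (scan K D))
evenAfterGap K (suc r) []         = false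
evenAfterGap K (suc r) (half ∷ D) = false
evenAfterGap K (suc r) (full ∷ D) = evenAfterGap K r D

-- The first entry, regarded cyclically, is the last vertex of an odd cluster.
oddEnd : ∀ {d} → ℕ → Vec Demand d → Bool
oddEnd K []         = false
oddEnd K (half ∷ D) = evenAfterGap K K D
oddEnd K (full ∷ D) = false

evenAfterGap-window : ∀ K s r k d → evenAfterGap K r (window s k d) ≡ true →
  ∃ λ N → d ≡ r ℕ.+ N × (∀ t → t ℕ.< r → s (t ℕ.+ k) ≡ full) × proj₂ (scan K (window s (r ℕ.+ k) N)) ≡ false
evenAfterGap-window K s zero    k d eq = d , refl , (λ _ ()) , trans (sym (not-involutive _)) (cong not eq)
evenAfterGap-window K s (suc r) k (suc d) eq with s k in sk
... | full with N , d≡ , gap , even ← evenAfterGap-window K s r (suc k) d eq =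
  N , cong suc d≡ ,
  (λ { zero _ → sk ; (suc t) (s≤s t<r) → trans (cong s (sym (ℕ.+-suc t k))) (gap t t<r) }) ,
  trans (cong (λ i → proj₂ (scan K (window s i N))) (sym (ℕ.+-suc r k))) even

full? : Demand → Bool
full? half = false
full? full = true

-- Labelling the vertices of a cluster by its last vertex

module Cyclic (κ m : ℕ) (s : ℕ → Demand) (s-periodic : ∀ k → s (suc m ℕ.+ k) ≡ s k) where

  K n : ℕ
  K = suc κ
  n = suc m

  gap : ℕ → ℕ → Bool
  gap zero    k = true
  gap (suc r) k = if full? (s k) then gap r (suc k) else false

  gap⁺ : ∀ r k → (∀ t → t ℕ.< r → s (t ℕ.+ k) ≡ full) → gap r k ≡ true
  gap⁺ zero    k _ = refl
  gap⁺ (suc r) k fulls rewrite fulls 0 (s≤s z≤n) =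
    gap⁺ r (suc k) λ t t<r → trans (cong s (ℕ.+-suc t k)) (fulls (suc t) (s≤s t<r))

  gap⁻ : ∀ r k t → t ℕ.< r → s (t ℕ.+ k) ≡ half → gap r k ≡ false
  gap⁻ (suc r) k zero    _         eq rewrite eq = refl
  gap⁻ (suc r) k (suc t) (s≤s t<r) eq with s k
  ... | half = refl
  ... | full = gap⁻ r (suc k) t t<r (trans (cong s (ℕ.+-suc t k)) eq)

  gap-periodic : ∀ r k → gap r (n ℕ.+ k) ≡ gap r k
  gap-periodic zero    k = refl
  gap-periodic (suc r) k rewrite s-periodic k = cong (if full? (s k) then_else false)
    (trans (cong (gap r) (sym (ℕ.+-suc n k))) (gap-periodic r (suc k)))

  run : ℕ → Bool
  run u = gap K (suc u)

  run-periodic : ∀ k → run (n ℕ.+ k) ≡ run k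
  run-periodic k = trans (cong (gap K) (sym (ℕ.+-suc n k))) (gap-periodic K (suc k))

  -- Junk value 0 when there is no run among k, …, k + f − 1.
  find : ℕ → ℕ → ℕ
  find zero    k = 0
  find (suc f) k = if run k then k else find f (suc k)

  find-extend : ∀ f k → run (f ℕ.+ k) ≡ false → find (suc f) k ≡ find f k
  find-extend zero    k eq rewrite eq = refl
  find-extend (suc f) k eq = cong (if run k then k else_)
    (find-extend f (suc k) (trans (cong run (ℕ.+-suc f k)) eq))

  find-∃ : ∀ f k u → k ℕ.≤ u → u ℕ.< f ℕ.+ k → run u ≡ true → k ℕ.≤ find f k × find f k ℕ.≤ u
  find-∃ zero    k u k≤u u< _ = contradiction u< (ℕ.≤⇒≯ k≤u)
  find-∃ (suc f) k u k≤u u< eq with run k in rk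
  ... | true  = ℕ.≤-refl , k≤u
  ... | false with lo , hi ← find-∃ f (suc k) u (ℕ.≤∧≢⇒< k≤u λ { refl → contradiction (trans (sym eq) rk) λ () })
                                    (subst (u ℕ.<_) (sym (ℕ.+-suc f k)) u<) eq
    = ℕ.<⇒≤ lo , hi

  find-periodic : ∀ f k → find f (n ℕ.+ k) % n ≡ find f k % n
  find-periodic zero    k = refl
  find-periodic (suc f) k rewrite run-periodic k with run k
  ... | true  = trans (cong (_% n) (ℕ.+-comm n k)) ([m+n]%n≡m%n k n)
  ... | false = trans (cong (λ i → find f i % n) (sym (ℕ.+-suc n k))) (find-periodic f (suc k))

  -- For a vertex k of a cluster this is the last vertex of that cluster: the
  -- first run at or after k sits there.
  label : ℕ → ℕ
  label k = find n k % n

  label-periodic : ∀ k → label (n ℕ.+ k) ≡ label k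
  label-periodic = find-periodic n

  label-run : ∀ k → run k ≡ true → label k ≡ k % n
  label-run k eq rewrite eq = refl

  -- The searches from `k` and from `k + 1` differ only in the candidates `k` and `n + k`, and by
  -- periodicity neither of them is a run.
  label-suc : ∀ k → run k ≡ false → label k ≡ label (suc k)
  label-suc k eq = cong (_% n) (trans lhs (sym (find-extend m (suc k) (trans (cong run (ℕ.+-suc m k)) (trans (run-periodic k) eq)))))
    where
    lhs : find n k ≡ find m (suc k)
    lhs rewrite eq = refl

  label-const : ∀ d k → (∀ u → k ℕ.≤ u → u ℕ.< d ℕ.+ k → run u ≡ false) → label k ≡ label (d ℕ.+ k)
  label-const zero    k _  = refl
  label-const (suc d) k no-run = begin
    label k              ≡⟨ label-suc k (no-run k ℕ.≤-refl (s≤s (ℕ.m≤n+m k d))) ⟩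
    label (suc k)
      ≡⟨ label-const d (suc k) (λ u k<u u< → no-run u (ℕ.<⇒≤ k<u) (subst (u ℕ.<_) (ℕ.+-suc d k) u<)) ⟩
    label (d ℕ.+ suc k)  ≡⟨ cong label (ℕ.+-suc d k) ⟩
    label (suc d ℕ.+ k)  ∎
    where open ≡-Reasoning

  label-const′ : ∀ {k l} → k ℕ.≤ l → (∀ u → k ℕ.≤ u → u ℕ.< l → run u ≡ false) → label k ≡ label l
  label-const′ {k} {l} k≤l no-run = subst (λ i → label k ≡ label i) (ℕ.m∸n+n≡m k≤l)
    (label-const (l ℕ.∸ k) k λ u k≤u u< → no-run u k≤u (subst (u ℕ.<_) (ℕ.m∸n+n≡m k≤l) u<))

  -- A run at some `u` with `k ≤ u < l` would need the `K` vertices after `u` to be full, but the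
  -- half at `l ≤ K + k ≤ K + u` is among them.
  label-short : ∀ {k l} → k ℕ.≤ l → l ℕ.≤ K ℕ.+ k → s l ≡ half → label k ≡ label l
  label-short {k} {l} k≤l l≤ sl = label-const′ k≤l λ u k≤u u<l →
    gap⁻ K (suc u) (l ℕ.∸ suc u)
      (ℕ.+-cancelʳ-< (suc u) _ _ (subst (ℕ._< K ℕ.+ suc u) (sym (ℕ.m∸n+n≡m u<l))
        (ℕ.≤-<-trans l≤ (ℕ.≤-<-trans (ℕ.+-monoʳ-≤ K k≤u) (ℕ.+-monoʳ-< K (ℕ.n<1+n u))))))
      (trans (cong s (ℕ.m∸n+n≡m u<l)) sl)

  -- Equal remainders would force `v / n < a / n < v / n + 1`.
  %-≢ : ∀ {v a} → v ℕ.< a → a ℕ.< n ℕ.+ v → v % n ≢ a % n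
  %-≢ {v} {a} v<a a<n+v eq = contradiction (ℕ.*-cancelʳ-< n (v / n) (a / n) v/n<) (ℕ.<⇒≱ ≮)
    where
    open ℕ.≤-Reasoning
    r = v % n
    v/n< : (v / n) ℕ.* n ℕ.< (a / n) ℕ.* n
    v/n< = ℕ.+-cancelˡ-< r _ _ (begin-strict
      r ℕ.+ v / n ℕ.* n       ≡⟨ m≡m%n+[m/n]*n v n ⟨
      v                       <⟨ v<a ⟩
      a                       ≡⟨ m≡m%n+[m/n]*n a n ⟩
      a % n ℕ.+ a / n ℕ.* n   ≡⟨ cong (ℕ._+ a / n ℕ.* n) eq ⟨
      r ℕ.+ a / n ℕ.* n       ∎)
    ≮ : a / n ℕ.< suc (v / n)
    ≮ = ℕ.*-cancelʳ-< n (a / n) (suc (v / n)) (ℕ.+-cancelˡ-< r _ _ (begin-strict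
      r ℕ.+ a / n ℕ.* n              ≡⟨ cong (ℕ._+ a / n ℕ.* n) eq ⟩
      a % n ℕ.+ a / n ℕ.* n          ≡⟨ m≡m%n+[m/n]*n a n ⟨
      a                              <⟨ a<n+v ⟩
      n ℕ.+ v                        ≡⟨ cong (n ℕ.+_) (m≡m%n+[m/n]*n v n) ⟩
      n ℕ.+ (r ℕ.+ v / n ℕ.* n)      ≡⟨ ℕ.+-comm n _ ⟩
      r ℕ.+ v / n ℕ.* n ℕ.+ n        ≡⟨ ℕ.+-assoc r _ n ⟩
      r ℕ.+ (v / n ℕ.* n ℕ.+ n)      ≡⟨ cong (r ℕ.+_) (ℕ.+-comm _ n) ⟩
      r ℕ.+ suc (v / n) ℕ.* n        ∎))

  labelled : ℕ → ℕ → ℕ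
  labelled j k = whenHalf (s k) (δ (label k) j)

  labelled-periodic : ∀ j k → labelled j (n ℕ.+ k) ≡ labelled j k
  labelled-periodic j k = cong₂ (λ d l → whenHalf d (δ l j)) (s-periodic k) (label-periodic k)

  module _ (a : ℕ) (sa : s a ≡ half) (run-a : run a ≡ true) where

    -- How the first component of a scan back from a down to k + 1 reflects the runs.
    data Status (k : ℕ) : ℕ → Set where
      ended : ∀ u → k ℕ.≤ u → u ℕ.< a → run u ≡ true → Status k zero
      alive : ∀ {g} f → f ℕ.+ suc g ≡ K → (∀ t → t ℕ.< f → s (t ℕ.+ suc k) ≡ full) → s (f ℕ.+ suc k) ≡ half →
              (∀ u → k ℕ.≤ u → u ℕ.< a → run u ≡ false) → Status k (suc g)

    Scanned : ℕ → ℕ → ℕ × Bool → Set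
    Scanned k d (g , b) = Status k g × odd (sumFrom (labelled (a % n)) (suc k) d) ≡ b

    no-run-at : ∀ {k} f → f ℕ.< K → s (f ℕ.+ suc k) ≡ half → (∀ u → suc k ℕ.≤ u → u ℕ.< a → run u ≡ false) →
                ∀ u → k ℕ.≤ u → u ℕ.< a → run u ≡ false
    no-run-at {k} f f<K eq no-run u k≤u u<a with k ℕ.≟ u
    ... | yes refl = gap⁻ K (suc k) f f<K eq
    ... | no k≢u   = no-run u (ℕ.≤∧≢⇒< k≤u k≢u) u<a

    -- The scan mirrors the labels. While the budget is positive, no run separates the current
    -- vertex from `a`, so every half met has the label of `a`. Once it is 0, a run does separate
    -- them, and later halves have other labels because less than a full turn is scanned.
    scan-step : ∀ k d → suc d ℕ.+ suc k ≡ a → suc d ℕ.< n → ∀ st → Scanned (suc k) d st → Scanned k (suc d) (step K (s (suc k)) st)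
    scan-step k d ≡a d<n (zero , b) (ended u k<u u<a run-u , parity) =
      ended u (ℕ.<⇒≤ k<u) u<a run-u ,
      trans (cong (λ c → odd (c ℕ.+ sumFrom (labelled (a % n)) (suc (suc k)) d)) (labelled≡0 (s (suc k)))) parity
      where
      label≢ : label (suc k) ≢ a % n
      -- The run found lies at or after `k + 1` and before `a`, hence less than a full turn away
      -- from `a`.
      label≢ with lo , hi ← find-∃ n (suc k) u k<u
                    (ℕ.<-trans u<a (subst (ℕ._< n ℕ.+ suc k) ≡a (ℕ.+-monoˡ-< (suc k) d<n))) run-u
        = %-≢ (ℕ.≤-<-trans hi u<a)
              (ℕ.<-≤-trans (subst (ℕ._< n ℕ.+ suc k) ≡a (ℕ.+-monoˡ-< (suc k) d<n)) (ℕ.+-monoʳ-≤ n lo))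
      labelled≡0 : ∀ e → whenHalf e (δ (label (suc k)) (a % n)) ≡ 0
      labelled≡0 half = δ-≢ label≢
      labelled≡0 full = refl
    scan-step k d ≡a d<n (suc g , b) (alive f f+g≡K fulls sf no-run , parity) with s (suc k) in sk
    ... | half = alive 0 refl (λ _ ()) sk (no-run-at 0 (s≤s z≤n) sk no-run) , (begin
        odd (δ (label (suc k)) (a % n) ℕ.+ S)     ≡⟨ cong (λ c → odd (c ℕ.+ S)) (δ-≡ label≡) ⟩
        not (odd S)                               ≡⟨ cong not parity ⟩
        not b                                     ∎)
      where
      open ≡-Reasoning
      S = sumFrom (labelled (a % n)) (suc (suc k)) d
      label≡ : label (suc k) ≡ a % n
      label≡ = trans (label-const′ (subst (suc k ℕ.≤_) ≡a (ℕ.m≤n+m (suc k) (suc d))) no-run) (label-run a run-a)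
    ... | full with g | f+g≡K
    -- This full and the `f = K − 1` fulls after it are the `K` vertices following `k`, so the
    -- budget runs out exactly at a run.
    ... | zero   | f+1≡K = ended k ℕ.≤-refl (subst (k ℕ.<_) ≡a (ℕ.m≤n+m (suc k) (suc d)))
        (gap⁺ K (suc k) fulls′) , parity
      where
      fulls′ : ∀ t → t ℕ.< K → s (t ℕ.+ suc k) ≡ full
      fulls′ zero    _         = sk
      fulls′ (suc t) t<K = trans (cong s (sym (ℕ.+-suc t (suc k)))) (fulls t (ℕ.s≤s⁻¹ (subst (suc t ℕ.<_) (trans (sym f+1≡K) (ℕ.+-comm f 1)) t<K)))
    ... | suc g′ | f+g≡K′ = alive (suc f) sucf+g≡K fulls′ sf′
        (no-run-at (suc f) (subst (suc f ℕ.<_) sucf+g≡K (ℕ.m<m+n (suc f) (s≤s z≤n))) sf′ no-run) , parity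
      where
      sucf+g≡K : suc f ℕ.+ suc g′ ≡ K
      sucf+g≡K = trans (sym (ℕ.+-suc f (suc g′))) f+g≡K′
      sf′ : s (suc f ℕ.+ suc k) ≡ half
      sf′ = trans (cong s (sym (ℕ.+-suc f (suc k)))) sf
      fulls′ : ∀ t → t ℕ.< suc f → s (t ℕ.+ suc k) ≡ full
      fulls′ zero    _         = sk
      fulls′ (suc t) (s≤s t<f) = trans (cong s (sym (ℕ.+-suc t (suc k)))) (fulls t t<f)

    scanned : ∀ k d → d ℕ.+ suc k ≡ a → d ℕ.< n → Scanned k d (scan K (window s (suc k) d))
    scanned k zero    refl _   = alive 0 refl (λ _ ()) sa (no-run-at 0 (s≤s z≤n) sa λ u k<u u<a → contradiction u<a (ℕ.≤⇒≯ k<u)) , refl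
    scanned k (suc d) ≡a   d<n = scan-step k d ≡a d<n _
      (scanned (suc k) d (trans (ℕ.+-suc d (suc k)) ≡a) (ℕ.<⇒≤ d<n))

  -- The labels are counted over the turn from `j + 1` to `n + j`: the `K` fulls of the gap
  -- contribute nothing, the scanned part contributes an even number, and the copy `n + j` of `j`
  -- contributes the last one.
  oddEnd⇒odd : ∀ j → oddEnd K (window s j n) ≡ true → odd (sumFrom (labelled (j % n)) 0 n) ≡ true
  oddEnd⇒odd j eq with s j in sj
  ... | half with N , m≡ , fulls , even ← evenAfterGap-window K s K (suc j) m eq = begin
      odd (sumFrom ℓ 0 n)
        ≡⟨ cong odd (sumFrom-rotate ℓ n (labelled-periodic _) (suc j)) ⟨
      odd (sumFrom ℓ (suc j) n)                             ≡⟨ cong (odd ∘ sumFrom ℓ (suc j)) n≡ ⟩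
      odd (sumFrom ℓ (suc j) (K ℕ.+ (N ℕ.+ 1)))
        ≡⟨ cong odd (sumFrom-+ ℓ (suc j) K (N ℕ.+ 1)) ⟩
      odd (sumFrom ℓ (suc j) K ℕ.+ sumFrom ℓ k (N ℕ.+ 1))
        ≡⟨ cong (λ c → odd (c ℕ.+ sumFrom ℓ k (N ℕ.+ 1)))
                                                                 (sumFrom-zero ℓ (suc j) K λ t t<K → cong (λ e → whenHalf e (δ (label (t ℕ.+ suc j)) (j % n))) (fulls t t<K)) ⟩
      odd (sumFrom ℓ k (N ℕ.+ 1))                           ≡⟨ cong odd (sumFrom-+ ℓ k N 1) ⟩
      odd (sumFrom ℓ k N ℕ.+ (ℓ (N ℕ.+ k) ℕ.+ 0))
        ≡⟨ cong (λ c → odd (sumFrom ℓ k N ℕ.+ c)) (trans (ℕ.+-identityʳ _) last) ⟩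
      odd (sumFrom ℓ k N ℕ.+ 1)
        ≡⟨ cong odd (ℕ.+-comm (sumFrom ℓ k N) 1) ⟩
      not (odd (sumFrom ℓ k N))                             ≡⟨ cong not parity ⟩
      true                                                  ∎
    where
    open ≡-Reasoning
    ℓ = labelled (j % n)
    k = K ℕ.+ suc j
    a = n ℕ.+ j
    n≡ : n ≡ K ℕ.+ (N ℕ.+ 1)
    n≡ = trans (cong suc m≡) (trans (ℕ.+-comm 1 (K ℕ.+ N)) (ℕ.+-assoc K N 1))
    N+k≡a : N ℕ.+ k ≡ a
    N+k≡a = begin
      N ℕ.+ (K ℕ.+ suc j)   ≡⟨ ℕ.+-assoc N K (suc j) ⟨
      N ℕ.+ K ℕ.+ suc j     ≡⟨ cong (ℕ._+ suc j) (trans (ℕ.+-comm N K) (sym m≡)) ⟩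
      m ℕ.+ suc j           ≡⟨ ℕ.+-suc m j ⟩
      n ℕ.+ j               ∎
    k≡ : k ≡ suc (K ℕ.+ j)
    k≡ = ℕ.+-suc K j
    sa : s a ≡ half
    sa = trans (s-periodic j) sj
    run-a : run a ≡ true
    run-a = trans (run-periodic j) (gap⁺ K (suc j) fulls)
    a%n≡ : a % n ≡ j % n
    a%n≡ = trans (cong (_% n) (ℕ.+-comm n j)) ([m+n]%n≡m%n j n)
    last : ℓ (N ℕ.+ k) ≡ 1
    last = trans (cong ℓ N+k≡a) (trans (cong (λ e → whenHalf e (δ (label a) (j % n))) sa) (δ-≡ (trans (label-run a run-a) a%n≡)))
    parity : odd (sumFrom ℓ k N) ≡ false
    parity = subst (λ i → odd (sumFrom ℓ i N) ≡ false) (sym k≡) (subst (λ i → odd (sumFrom (labelled i) (suc (K ℕ.+ j)) N) ≡ false) a%n≡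
      (trans (proj₂ (scanned a sa run-a (K ℕ.+ j) N (trans (cong (N ℕ.+_) (sym k≡)) N+k≡a)
        (subst (N ℕ.<_) (sym (cong suc m≡)) (s≤s (ℕ.m≤n+m N K)))))
        (trans (cong (λ i → proj₂ (scan K (window s i N))) (sym k≡)) even)))

⊓≤⇒ : ∀ a b {c} → a ℕ.⊓ b ℕ.≤ c → a ℕ.≤ c ⊎ b ℕ.≤ c
⊓≤⇒ a b ≤c with ℕ.⊓-sel a b
... | inj₁ eq = inj₁ (subst (ℕ._≤ _) eq ≤c)
... | inj₂ eq = inj₂ (subst (ℕ._≤ _) eq ≤c)

∸≤⇒≤+ : ∀ a b {c} → a ℕ.∸ b ℕ.≤ c → a ℕ.≤ c ℕ.+ b
∸≤⇒≤+ a       zero    {c} h = ℕ.≤-trans h (ℕ.m≤m+n c 0)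
∸≤⇒≤+ zero    (suc b)     h = z≤n
∸≤⇒≤+ (suc a) (suc b) {c} h = subst (suc a ℕ.≤_) (sym (ℕ.+-suc c b)) (s≤s (∸≤⇒≤+ a b h))

-- Vertices left over by a matching, counted by label

positions : ∀ {n} → Vec Demand n → List (Fin n)
positions []         = []
positions (half ∷ D) = Fin.zero ∷ List.map Fin.suc (positions D)
positions (full ∷ D) = List.map Fin.suc (positions D)

length-positions : ∀ {n} (D : Vec Demand n) → length (positions D) ≡ halves D
length-positions []         = refl
length-positions (half ∷ D) = cong suc (trans (length-map Fin.suc (positions D)) (length-positions D))
length-positions (full ∷ D) = trans (length-map Fin.suc (positions D)) (length-positions D)

∈-positions : ∀ {n} (D : Vec Demand n) {i} → i Subset.∈ supp D → i ∈ positions D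
∈-positions (half ∷ D) here        = here refl
∈-positions (half ∷ D) (there i∈) = there (∈-map⁺ Fin.suc (∈-positions D i∈))
∈-positions (full ∷ D) (there i∈) = ∈-map⁺ Fin.suc (∈-positions D i∈)

supp⇒half : ∀ {n} (D : Vec Demand n) {i} → i Subset.∈ supp D → Vec.lookup D i ≡ half
supp⇒half (half ∷ D) here       = refl
supp⇒half (_ ∷ D)    (there i∈) = supp⇒half D i∈

sum-positions : ∀ {n} (D : Vec Demand n) (s : ℕ → Demand) (g : ℕ → ℕ) k → (∀ i → s (toℕ i ℕ.+ k) ≡ Vec.lookup D i) →
  sum (List.map (λ i → g (toℕ i ℕ.+ k)) (positions D)) ≡ sumFrom (λ i → whenHalf (s i) (g i)) k n
sum-positions []      s g k _   = refl
sum-positions {suc n} (d ∷ D) s g k s≡D rewrite s≡D Fin.zero = branch d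
  where
  open ≡-Reasoning
  rest : sum (List.map (λ i → g (toℕ i ℕ.+ k)) (List.map Fin.suc (positions D))) ≡ sumFrom (λ i → whenHalf (s i) (g i)) (suc k) n
  rest = begin
    sum (List.map (λ i → g (toℕ i ℕ.+ k)) (List.map Fin.suc (positions D)))
      ≡⟨ cong sum (map-∘ (positions D)) ⟨
    sum (List.map (λ i → g (suc (toℕ i ℕ.+ k))) (positions D))
      ≡⟨ cong sum (map-cong (λ i → cong g (ℕ.+-suc (toℕ i) k)) (positions D)) ⟨
    sum (List.map (λ i → g (toℕ i ℕ.+ suc k)) (positions D))
      ≡⟨ sum-positions D s g (suc k) (λ i → trans (cong s (ℕ.+-suc (toℕ i) k)) (s≡D (Fin.suc i))) ⟩
    sumFrom (λ i → whenHalf (s i) (g i)) (suc k) n                           ∎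
  branch : ∀ d → sum (List.map (λ i → g (toℕ i ℕ.+ k)) (positions (d ∷ D))) ≡ whenHalf d (g k) ℕ.+ sumFrom (λ i → whenHalf (s i) (g i)) (suc k) n
  branch half = cong (g k ℕ.+_) rest
  branch full = rest

positions-unique : ∀ {n} (D : Vec Demand n) → Unique (positions D)
positions-unique []         = []
positions-unique (half ∷ D) = All.map⁺ (All.universal (λ _ ()) (positions D)) ∷ Unique.map⁺ Fin.suc-injective (positions-unique D)
positions-unique (full ∷ D) = Unique.map⁺ Fin.suc-injective (positions-unique D)

module _ {n : ℕ} where

  endpoints : List (Edge n) → List (Fin n)
  endpoints []            = []
  endpoints ((i , j) ∷ M) = i ∷ j ∷ endpoints M

  length-endpoints : ∀ M → length (endpoints M) ≡ 2 ℕ.* length M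
  length-endpoints []      = refl
  length-endpoints (e ∷ M) = trans (cong (suc ∘ suc) (length-endpoints M)) (sym (ℕ.*-suc 2 (length M)))

  All-endpoints : ∀ {P : Fin n → Set} {M} → All (λ (i , j) → P i × P j) M → All P (endpoints M)
  All-endpoints []               = []
  All-endpoints ((pi , pj) ∷ ps) = pi ∷ pj ∷ All-endpoints ps

  endpoints-unique : ∀ {M} → IsMatching M → All (λ (i , j) → i Fin.< j) M → Unique (endpoints M)
  endpoints-unique []              []           = []
  endpoints-unique (disj ∷ matching) (i<j ∷ M<) =
    (Fin.<⇒≢ i<j ∷ All-endpoints (All.map proj₁ disj)) ∷
    All-endpoints (All.map proj₂ disj) ∷ endpoints-unique matching M<

  -- Each edge contributes the same value twice.
  even-endpoints : ∀ (f : Fin n → ℕ) {M} → All (λ (i , j) → f i ≡ f j) M → ∀ k →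
                   odd (sum (List.map f (endpoints M)) ℕ.+ k) ≡ odd k
  even-endpoints f {[]}          []         k = refl
  even-endpoints f {(i , j) ∷ M} (eq ∷ eqs) k rewrite sym eq = begin
    odd (f i ℕ.+ (f i ℕ.+ S) ℕ.+ k)      ≡⟨ cong (λ x → odd (x ℕ.+ k)) (ℕ.+-assoc (f i) (f i) S) ⟨
    odd (f i ℕ.+ f i ℕ.+ S ℕ.+ k)        ≡⟨ cong odd (ℕ.+-assoc (f i ℕ.+ f i) S k) ⟩
    odd (f i ℕ.+ f i ℕ.+ (S ℕ.+ k))      ≡⟨ odd-double (f i) (S ℕ.+ k) ⟩
    odd (S ℕ.+ k)                        ≡⟨ even-endpoints f eqs k ⟩
    odd k                                ∎
    where
    open ≡-Reasoning
    S = sum (List.map f (endpoints M))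
    odd-double : ∀ a k → odd (a ℕ.+ a ℕ.+ k) ≡ odd k
    odd-double zero    k = refl
    odd-double (suc a) k rewrite ℕ.+-suc a a = trans (odd-suc-suc (a ℕ.+ a ℕ.+ k)) (odd-double a k)

-- The vertices of positions D left over by a maximum matching.
μ-complement : ∀ {n} (G : Graph n) (D : Vec Demand n) → ∃ λ M → ∃ λ rest →
  M ⊆ edges (G [ supp D ]) × positions D ↭ endpoints M ++ rest × halves D ≡ 2 ℕ.* μ (G [ supp D ]) ℕ.+ length rest
μ-complement G D
  with M , matching , M⊆ , ∣M∣≡μ ← μ-attained (G [ supp D ])
  with rest , X↭ ← Unique-⊆⇒↭ {ys = positions D}
         (endpoints-unique matching (All.tabulate (proj₁ ∘ ∈-edges⁻ (G [ supp D ]) ∘ M⊆)))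
         (All.lookup (All-endpoints (All.tabulate λ e∈ → let _ , _ , i∈ , j∈ = ∈-edges⁻ (G [ supp D ]) (M⊆ e∈)
                                                         in ∈-positions D i∈ , ∈-positions D j∈)))
  = M , rest , M⊆ , X↭ , (begin
    halves D                                      ≡⟨ length-positions D ⟨
    length (positions D)                          ≡⟨ Perm.↭-length X↭ ⟩
    length (endpoints M ++ rest)                  ≡⟨ length-++ (endpoints M) ⟩
    length (endpoints M) ℕ.+ length rest
      ≡⟨ cong (ℕ._+ length rest) (trans (length-endpoints M) (cong (2 ℕ.*_) ∣M∣≡μ)) ⟩
    2 ℕ.* μ (G [ supp D ]) ℕ.+ length rest        ∎)
  where open ≡-Reasoning

2μ≤halves : ∀ {n} (G : Graph n) (D : Vec Demand n) → 2 ℕ.* μ (G [ supp D ]) ℕ.≤ halves D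
2μ≤halves G D = let _ , rest , _ , _ , halves≡ = μ-complement G D in
  subst (2 ℕ.* μ (G [ supp D ]) ℕ.≤_) (sym halves≡) (ℕ.m≤m+n _ (length rest))

module _ {m : ℕ} (D : Vec Demand (suc m)) where

  private n = suc m

  -- Unrolling the circle turns a cluster that passes from `n − 1` to 0 into part of an interval of
  -- natural numbers.
  cyclic : ℕ → Demand
  cyclic k = Vec.lookup D (k mod n)

  cyclic-toℕ : ∀ i → cyclic (toℕ i) ≡ Vec.lookup D i
  cyclic-toℕ i = cong (Vec.lookup D) (Fin.toℕ-injective (trans (Fin.toℕ-fromℕ< _) (m<n⇒m%n≡m (Fin.toℕ<n i))))

  cyclic-periodic : ∀ k → cyclic (n ℕ.+ k) ≡ cyclic k
  cyclic-periodic k = cong (Vec.lookup D) (Fin.toℕ-injective (begin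
    toℕ ((n ℕ.+ k) mod n)   ≡⟨ Fin.toℕ-fromℕ< _ ⟩
    (n ℕ.+ k) % n           ≡⟨ cong (_% n) (ℕ.+-comm n k) ⟩
    (k ℕ.+ n) % n           ≡⟨ [m+n]%n≡m%n k n ⟩
    k % n                   ≡⟨ Fin.toℕ-fromℕ< _ ⟨
    toℕ (k mod n)           ∎))
    where open ≡-Reasoning

  module _ (κ : ℕ) where

    open Cyclic κ m cyclic cyclic-periodic hiding (n)

    labelledRest : List (Fin n) → ℕ → ℕ
    labelledRest xs j = sum (List.map (λ i → δ (label (toℕ i)) j) xs)

    -- A vertex has a single label, so it is counted for at most one `j`.
    sum-labelledRest : ∀ xs → sumFrom (labelledRest xs) 0 n ℕ.≤ length xs
    sum-labelledRest []       = ℕ.≤-reflexive (sumFrom-zero (labelledRest []) 0 n λ _ _ → refl)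
    sum-labelledRest (x ∷ xs) = begin
      sumFrom (λ j → δ (label (toℕ x)) j ℕ.+ labelledRest xs j) 0 n
        ≡⟨ sumFrom-distrib (δ (label (toℕ x))) (labelledRest xs) 0 n ⟩
      sumFrom (δ (label (toℕ x))) 0 n ℕ.+ sumFrom (labelledRest xs) 0 n
        ≤⟨ ℕ.+-mono-≤ (sumFrom-δ (label (toℕ x)) 0 n) (sum-labelledRest xs) ⟩
      suc (length xs)                                                        ∎
      where open ℕ.≤-Reasoning

    label-edge : ∀ {i j} → (i , j) ∈ edges (chain n K [ supp D ]) → label (toℕ i) ≡ label (toℕ j)
    label-edge {i} {j} e∈
      with i<j , (_ , dist≤) , i∈ , j∈ ← ∈-edges⁻ (chain n K [ supp D ]) e∈
      rewrite ℕ.m≤n⇒∣m-n∣≡n∸m (ℕ.<⇒≤ i<j)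
      with ⊓≤⇒ (toℕ j ℕ.∸ toℕ i) _ dist≤
    ... | inj₁ near = label-short (ℕ.<⇒≤ i<j) (∸≤⇒≤+ (toℕ j) (toℕ i) near) (trans (cyclic-toℕ j) (supp⇒half D j∈))
    -- The edge crosses the cut: going forwards from `j` it reaches the copy `n + i` of `i`, which
    -- has the same label.
    ... | inj₂ around = sym (trans
        (label-short (ℕ.≤-trans (ℕ.<⇒≤ (Fin.toℕ<n j)) (ℕ.m≤m+n n (toℕ i))) wrapped
          (trans (cyclic-periodic (toℕ i)) (trans (cyclic-toℕ i) (supp⇒half D i∈))))
        (label-periodic (toℕ i)))
      where
      open ℕ.≤-Reasoning
      wrapped : n ℕ.+ toℕ i ℕ.≤ K ℕ.+ toℕ j
      wrapped = begin
        n ℕ.+ toℕ i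
          ≤⟨ ℕ.+-monoˡ-≤ (toℕ i) (∸≤⇒≤+ n (toℕ j ℕ.∸ toℕ i) around) ⟩
        K ℕ.+ (toℕ j ℕ.∸ toℕ i) ℕ.+ toℕ i            ≡⟨ ℕ.+-assoc K _ (toℕ i) ⟩
        K ℕ.+ (toℕ j ℕ.∸ toℕ i ℕ.+ toℕ i)            ≡⟨ cong (K ℕ.+_) (ℕ.m∸n+n≡m (ℕ.<⇒≤ i<j)) ⟩
        K ℕ.+ toℕ j                                  ∎

    oddEnds : ℕ
    oddEnds = sumFrom (λ j → if oddEnd K (window cyclic j n) then 1 else 0) 0 n

    -- Edges stay within clusters, so a matching leaves an odd number of vertices of each odd cluster.
    oddEnds≤rest : ∀ {M rest} → M ⊆ edges (chain n K [ supp D ]) → positions D ↭ endpoints M ++ rest →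
                   oddEnds ℕ.≤ length rest
    oddEnds≤rest {M} {rest} M⊆ X↭ = ℕ.≤-trans (sumFrom-mono _ (labelledRest rest) 0 n term≤) (sum-labelledRest rest)
      where
      odd-rest : ∀ j → oddEnd K (window cyclic j n) ≡ true → odd (labelledRest rest (j % n)) ≡ true
      odd-rest j eq = begin
        odd (labelledRest rest j′)
          ≡⟨ even-endpoints f (All.tabulate λ e∈ → cong (λ l → δ l j′) (label-edge (M⊆ e∈))) _ ⟨
        odd (labelledRest (endpoints M) j′ ℕ.+ labelledRest rest j′)
          ≡⟨ cong odd (sum-++ (List.map f (endpoints M)) (List.map f rest)) ⟨
        odd (sum (List.map f (endpoints M) ++ List.map f rest))
          ≡⟨ cong (odd ∘ sum) (map-++ f (endpoints M) rest) ⟨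
        odd (labelledRest (endpoints M ++ rest) j′)
          ≡⟨ cong odd (sum-↭ (Perm.map⁺ f X↭)) ⟨
        odd (labelledRest (positions D) j′)
          ≡⟨ cong (odd ∘ sum) (map-cong (λ i → cong (λ k → δ (label k) j′) (ℕ.+-identityʳ (toℕ i))) (positions D)) ⟨
        odd (sum (List.map (λ i → δ (label (toℕ i ℕ.+ 0)) j′) (positions D)))
          ≡⟨ cong odd (sum-positions D cyclic (λ k → δ (label k) j′) 0 (λ i → trans (cong cyclic (ℕ.+-identityʳ (toℕ i))) (cyclic-toℕ i))) ⟩
        odd (sumFrom (labelled j′) 0 n)                                    ≡⟨ oddEnd⇒odd j eq ⟩
        true                                                               ∎
        where
        open ≡-Reasoning
        j′ = j % n
        f : Fin n → ℕ
        f i = δ (label (toℕ i)) j′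
      term≤ : ∀ t → t ℕ.< n → (if oddEnd K (window cyclic (t ℕ.+ 0) n) then 1 else 0) ℕ.≤ labelledRest rest (t ℕ.+ 0)
      term≤ t t<n rewrite ℕ.+-identityʳ t with oddEnd K (window cyclic t n) in eq
      ... | false = z≤n
      ... | true  = odd⇒≥1 _ (trans (cong (odd ∘ labelledRest rest) (sym (m<n⇒m%n≡m t<n))) (odd-rest t eq))

    oddEnds+2μ≤halves : oddEnds ℕ.+ 2 ℕ.* μ (chain n K [ supp D ]) ℕ.≤ halves D
    oddEnds+2μ≤halves = let _ , rest , M⊆ , X↭ , halves≡ = μ-complement (chain n K) D in begin
      oddEnds ℕ.+ 2 ℕ.* μ (chain n K [ supp D ])        ≤⟨ ℕ.+-monoˡ-≤ _ (oddEnds≤rest M⊆ X↭) ⟩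
      length rest ℕ.+ 2 ℕ.* μ (chain n K [ supp D ])    ≡⟨ ℕ.+-comm (length rest) _ ⟩
      2 ℕ.* μ (chain n K [ supp D ]) ℕ.+ length rest    ≡⟨ halves≡ ⟨
      halves D                                          ∎
      where open ℕ.≤-Reasoning

-- Expectations at a rational parameter

rotate : ∀ {m} → Vec Demand (suc m) → Vec Demand (suc m)
rotate (d ∷ D) = D ∷ʳ d

window-∷ʳ : ∀ s k d → window s k (suc d) ≡ window s k d ∷ʳ s (d ℕ.+ k)
window-∷ʳ s k zero    = refl
window-∷ʳ s k (suc d) = cong (s k ∷_) (trans (window-∷ʳ s (suc k) d) (cong (λ i → window s (suc k) d ∷ʳ s i) (ℕ.+-suc d k)))

window-lookup : ∀ {d} (D : Vec Demand d) s k → (∀ i → s (Fin.toℕ i ℕ.+ k) ≡ Vec.lookup D i) → window s k d ≡ D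
window-lookup []      s k _   = refl
window-lookup (d ∷ D) s k s≡D = cong₂ _∷_ (s≡D Fin.zero)
  (window-lookup D s (suc k) λ i → trans (cong s (ℕ.+-suc (Fin.toℕ i) k)) (s≡D (Fin.suc i)))

window-rotate : ∀ {m} (D : Vec Demand (suc m)) j →
  window (cyclic D) (suc j) (suc m) ≡ rotate (window (cyclic D) j (suc m))
window-rotate {m} D j = trans (window-∷ʳ (cyclic D) (suc j) m)
  (cong (window (cyclic D) (suc j) m ∷ʳ_) (trans (cong (cyclic D) (ℕ.+-suc m j)) (cyclic-periodic D j)))

𝟙 : Bool → ℚ
𝟙 b = ι (if b then 1 else 0)

module Expectation (p : ℚ) (0≤p : 0ℚ ℚ.≤ p) (p≤1 : p ℚ.≤ 1ℚ) where

  open Data.Rational.Base hiding (truncate)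

  q : ℚ
  q = 1ℚ - p

  0≤q : 0ℚ ≤ q
  0≤q = ≤⇒0≤- p≤1

  E : ∀ n → (Vec Demand n → ℚ) → ℚ
  E zero    f = f []
  E (suc n) f = p * E n (f ∘ (half ∷_)) + q * E n (f ∘ (full ∷_))

  E-cong : ∀ n {f g} → (∀ D → f D ≡ g D) → E n f ≡ E n g
  E-cong zero    f≡g = f≡g []
  E-cong (suc n) f≡g = cong₂ (λ a b → p * a + q * b) (E-cong n (f≡g ∘ (half ∷_))) (E-cong n (f≡g ∘ (full ∷_)))

  E-mono : ∀ n {f g} → (∀ D → f D ≤ g D) → E n f ≤ E n g
  E-mono zero    f≤g = f≤g []
  E-mono (suc n) f≤g = ℚ.+-mono-≤
    (ℚ.*-monoˡ-≤-nonNeg p {{nonNegative 0≤p}} (E-mono n (f≤g ∘ (half ∷_))))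
    (ℚ.*-monoˡ-≤-nonNeg q {{nonNegative 0≤q}} (E-mono n (f≤g ∘ (full ∷_))))

  convex : ∀ c → p * c + q * c ≡ c
  convex = solve 2 (λ p c → p :* c :+ (con 1ℚ :- p) :* c := c) refl p

  E-const : ∀ n c → E n (λ _ → c) ≡ c
  E-const zero    c = refl
  E-const (suc n) c rewrite E-const n c = convex c

  E-+ : ∀ n f g → E n (λ D → f D + g D) ≡ E n f + E n g
  E-+ zero    f g = refl
  E-+ (suc n) f g rewrite E-+ n (f ∘ (half ∷_)) (g ∘ (half ∷_)) | E-+ n (f ∘ (full ∷_)) (g ∘ (full ∷_)) =
    solve 6 (λ p q a b c d → p :* (a :+ b) :+ q :* (c :+ d) := (p :* a :+ q :* c) :+ (p :* b :+ q :* d)) refl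
      p q (E n (f ∘ (half ∷_))) (E n (g ∘ (half ∷_))) (E n (f ∘ (full ∷_))) (E n (g ∘ (full ∷_)))

  E-* : ∀ n c f → E n (λ D → c * f D) ≡ c * E n f
  E-* zero    c f = refl
  E-* (suc n) c f rewrite E-* n c (f ∘ (half ∷_)) | E-* n c (f ∘ (full ∷_)) =
    solve 5 (λ p q c a b → p :* (c :* a) :+ q :* (c :* b) := c :* (p :* a :+ q :* b)) refl
      p q c (E n (f ∘ (half ∷_))) (E n (f ∘ (full ∷_)))

  -- By independence one may condition on the last entry instead of the first. This makes the
  -- distribution invariant under rotation, so that all windows round the circle have the same law.
  E-∷ʳ : ∀ n f → E (suc n) f ≡ p * E n (f ∘ (_∷ʳ half)) + q * E n (f ∘ (_∷ʳ full))
  E-∷ʳ zero    f = refl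
  E-∷ʳ (suc n) f = trans
    (cong₂ (λ a b → p * a + q * b) (E-∷ʳ n (f ∘ (half ∷_))) (E-∷ʳ n (f ∘ (full ∷_))))
    (solve 6 (λ p q a b c d → p :* (p :* a :+ q :* b) :+ q :* (p :* c :+ q :* d)
                            := p :* (p :* a :+ q :* c) :+ q :* (p :* b :+ q :* d)) refl
      p q (E n (λ D → f (half ∷ (D ∷ʳ half)))) (E n (λ D → f (half ∷ (D ∷ʳ full))))
          (E n (λ D → f (full ∷ (D ∷ʳ half)))) (E n (λ D → f (full ∷ (D ∷ʳ full)))))

  E-rotate : ∀ m f → E (suc m) (f ∘ rotate) ≡ E (suc m) f
  E-rotate m f = sym (E-∷ʳ m f)

  E-window : ∀ m f j → E (suc m) (λ D → f (window (cyclic D) j (suc m))) ≡ E (suc m) f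
  E-window m f zero    = E-cong (suc m) λ D → cong f (window-lookup D (cyclic D) 0
    λ i → trans (cong (cyclic D) (ℕ.+-identityʳ (Fin.toℕ i))) (cyclic-toℕ D i))
  E-window m f (suc j) = trans (E-cong (suc m) λ D → cong f (window-rotate D j))
    (trans (E-window m (f ∘ rotate) j) (E-rotate m f))

  E-sumFrom : ∀ n (f : Vec Demand n → ℕ → ℕ) c → (∀ j → E n (λ D → ι (f D j)) ≡ c) →
              ∀ k d → E n (λ D → ι (sumFrom (f D) k d)) ≡ ι d * c
  E-sumFrom n f c f≡c k zero    = trans (E-const n 0ℚ) (sym (ℚ.*-zeroˡ c))
  E-sumFrom n f c f≡c k (suc d) = begin
    E n (λ D → ι (f D k ℕ.+ sumFrom (f D) (suc k) d))
      ≡⟨ E-cong n (λ D → ι-+ (f D k) _) ⟩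
    E n (λ D → ι (f D k) + ι (sumFrom (f D) (suc k) d))           ≡⟨ E-+ n (λ D → ι (f D k)) _ ⟩
    E n (λ D → ι (f D k)) + E n (λ D → ι (sumFrom (f D) (suc k) d))
      ≡⟨ cong₂ _+_ (f≡c k) (E-sumFrom n f c f≡c (suc k) d) ⟩
    c + ι d * c
      ≡⟨ solve 2 (λ c d → c :+ d :* c := (con 1ℚ :+ d) :* c) refl c (ι d) ⟩
    (1ℚ + ι d) * c                                                ≡⟨ cong (_* c) (ι-+ 1 d) ⟨
    ι (suc d) * c                                                 ∎
    where open ≡-Reasoning

  ^-≤1 : ∀ {a} → 0ℚ ≤ a → a ≤ 1ℚ → ∀ k → a ^ℚ k ≤ 1ℚ
  ^-≤1 0≤a a≤1 zero    = ℚ.≤-refl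
  ^-≤1 0≤a a≤1 (suc k) = *-mono 0≤1 (^-nonNeg 0≤a k) a≤1 (^-≤1 0≤a a≤1 k)

  q≤1 : q ≤ 1ℚ
  q≤1 = 0≤-⇒≤ (subst (0ℚ ≤_) (solve 1 (λ p → p := con 1ℚ :- (con 1ℚ :- p)) refl p) 0≤p)

  E-clear : ∀ n K → E n (𝟙 ∘ clear K) ≡ q ^ℚ (K ℕ.⊓ n)
  E-clear n       zero    = E-const n 1ℚ
  E-clear zero    (suc K) = refl
  E-clear (suc n) (suc K) rewrite E-const n 0ℚ | E-clear n K =
    solve 2 (λ p c → p :* con 0ℚ :+ c := c) refl p (q * q ^ℚ (K ℕ.⊓ n))

  -- A half that is at least `K` entries away from the end closes a cluster with probability
  -- `p * q ^ K`. The last `K ⊓ n` entries hold at most one cluster end, present unless they are all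
  -- full, and this gives the correction `1 − q ^ (K ⊓ n)`.
  E-clusters : ∀ n K → E n (ι ∘ clusters K) ≤ ι n * (p * q ^ℚ K) + (1ℚ - q ^ℚ (K ℕ.⊓ n))
  E-clusters zero    K rewrite ℕ.⊓-zeroʳ K = ℚ.≤-reflexive (solve 1 (λ y → con 0ℚ := con 0ℚ :* y :+ (con 1ℚ :- con 1ℚ)) refl (p * q ^ℚ K))
  E-clusters (suc n) K = begin
    p * E n (λ D → ι ((if clear K D then 1 else 0) ℕ.+ clusters K D)) + q * e
      ≡⟨ cong (λ z → p * z + q * e) (trans (E-cong n λ D → ι-+ (if clear K D then 1 else 0) _) (E-+ n (𝟙 ∘ clear K) _)) ⟩
    p * (E n (𝟙 ∘ clear K) + e) + q * e
      ≡⟨ solve 3 (λ p c e → p :* (c :+ e) :+ (con 1ℚ :- p) :* e := p :* c :+ e) refl p (E n (𝟙 ∘ clear K)) e ⟩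
    p * E n (𝟙 ∘ clear K) + e
      ≤⟨ ℚ.+-mono-≤ (ℚ.≤-reflexive (cong (p *_) (E-clear n K))) (E-clusters n K) ⟩
    p * q ^ℚ (K ℕ.⊓ n) + (ι n * y + (1ℚ - q ^ℚ (K ℕ.⊓ n)))
      ≤⟨ advance ⟩
    (1ℚ + ι n) * y + (1ℚ - q ^ℚ (K ℕ.⊓ suc n))
      ≡⟨ cong (λ z → z * y + (1ℚ - q ^ℚ (K ℕ.⊓ suc n))) (ι-+ 1 n) ⟨
    ι (suc n) * y + (1ℚ - q ^ℚ (K ℕ.⊓ suc n)) ∎
    where
    open ℚ.≤-Reasoning
    e = E n (ι ∘ clusters K)
    y = p * q ^ℚ K
    advance : p * q ^ℚ (K ℕ.⊓ n) + (ι n * y + (1ℚ - q ^ℚ (K ℕ.⊓ n))) ≤ (1ℚ + ι n) * y + (1ℚ - q ^ℚ (K ℕ.⊓ suc n))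
    advance with K ℕ.≤? n
    ... | yes K≤n rewrite ℕ.m≤n⇒m⊓n≡m K≤n | ℕ.m≤n⇒m⊓n≡m (ℕ.m≤n⇒m≤1+n K≤n) = ℚ.≤-reflexive
      (solve 3 (λ p x n → p :* x :+ (n :* (p :* x) :+ (con 1ℚ :- x)) := (con 1ℚ :+ n) :* (p :* x) :+ (con 1ℚ :- x)) refl p (q ^ℚ K) (ι n))
    -- Near the end the new term `p * q ^ n` is `q ^ n − q ^ (n + 1)` and is absorbed by the
    -- correction; the whole `y` is slack.
    ... | no K≰n rewrite ℕ.m≥n⇒m⊓n≡n (ℕ.≰⇒≥ K≰n) | ℕ.m≥n⇒m⊓n≡n (ℕ.≰⇒> K≰n) = begin
      p * q ^ℚ n + (ι n * y + (1ℚ - q ^ℚ n))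
        ≤⟨ ≤-step (*-nonNeg 0≤p (^-nonNeg 0≤q K)) ⟩
      p * q ^ℚ n + (ι n * y + (1ℚ - q ^ℚ n)) + y
        ≡⟨ solve 4 (λ p x y n → p :* x :+ (n :* y :+ (con 1ℚ :- x)) :+ y := (con 1ℚ :+ n) :* y :+ (con 1ℚ :- (con 1ℚ :- p) :* x)) refl p (q ^ℚ n) y (ι n) ⟩
      (1ℚ + ι n) * y + (1ℚ - q * q ^ℚ n)                  ∎

  E-clusters≤ : ∀ n K → E n (ι ∘ clusters K) ≤ ι n * (p * q ^ℚ K) + 1ℚ
  E-clusters≤ n K = ℚ.≤-trans (E-clusters n K) (ℚ.+-monoʳ-≤ (ι n * (p * q ^ℚ K)) (begin
    1ℚ - q ^ℚ (K ℕ.⊓ n)                         ≤⟨ ≤-step (^-nonNeg 0≤q (K ℕ.⊓ n)) ⟩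
    1ℚ - q ^ℚ (K ℕ.⊓ n) + q ^ℚ (K ℕ.⊓ n)
      ≡⟨ solve 1 (λ x → con 1ℚ :- x :+ x := con 1ℚ) refl (q ^ℚ (K ℕ.⊓ n)) ⟩
    1ℚ                                          ∎))
    where open ℚ.≤-Reasoning

  -- The probability that a vertex closes an odd cluster

  module OddClusters (κ : ℕ) where

    K : ℕ
    K = suc κ

    x : ℚ
    x = q ^ℚ K

    -- The probability that a scan in the given state has even parity after `N` further entries.
    value : ℕ → ℕ × Bool → ℚ
    value zero    (g , b) = 𝟙 (not b)
    value (suc N) st      = p * value N (step K half st) + q * value N (step K full st)

    -- `E` splits off the first entry, which the scan reads last. Averaging over it turns `value k`
    -- into `value (suc k)`, so `k` has to be general in the induction.
    E-scan : ∀ k N → E N (λ D → value k (scan K D)) ≡ value (N ℕ.+ k) (K , false)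
    E-scan k zero    = refl
    E-scan k (suc N) = begin
      p * E N (λ D → value k (step K half (scan K D))) + q * E N (λ D → value k (step K full (scan K D)))
        ≡⟨ cong₂ _+_ (E-* N p _) (E-* N q _) ⟨
      E N (λ D → p * value k (step K half (scan K D))) + E N (λ D → q * value k (step K full (scan K D)))
        ≡⟨ E-+ N _ _ ⟨
      E N (λ D → value (suc k) (scan K D))
        ≡⟨ E-scan (suc k) N ⟩
      value (N ℕ.+ suc k) (K , false)
        ≡⟨ cong (λ i → value i (K , false)) (ℕ.+-suc N k) ⟩
      value (suc N ℕ.+ k) (K , false) ∎
      where open ≡-Reasoning

    E-evenAfterGap : ∀ r N → E (r ℕ.+ N) (𝟙 ∘ evenAfterGap K r) ≡ q ^ℚ r * value N (K , false)
    E-evenAfterGap zero    N = begin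
      E N (λ D → value 0 (scan K D))     ≡⟨ E-scan 0 N ⟩
      value (N ℕ.+ 0) (K , false)        ≡⟨ cong (λ i → value i (K , false)) (ℕ.+-identityʳ N) ⟩
      value N (K , false)                ≡⟨ ℚ.*-identityˡ _ ⟨
      1ℚ * value N (K , false)           ∎
      where open ≡-Reasoning
    E-evenAfterGap (suc r) N rewrite E-const (r ℕ.+ N) 0ℚ | E-evenAfterGap r N =
      solve 4 (λ p q y v → p :* con 0ℚ :+ q :* (y :* v) := (q :* y) :* v) refl p q (q ^ℚ r) (value N (K , false))

    E-oddEnd : ∀ N → E (suc (K ℕ.+ N)) (𝟙 ∘ oddEnd K) ≡ p * (x * value N (K , false))
    E-oddEnd N = trans (cong₂ (λ a b → p * a + q * b) (E-evenAfterGap K N) (E-const (K ℕ.+ N) 0ℚ))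
      (solve 3 (λ p q a → p :* a :+ q :* con 0ℚ := p :* a) refl p q (x * value N (K , false)))

    E-oddEnds : ∀ N → E (suc (K ℕ.+ N)) (λ D → ι (oddEnds D κ)) ≡ ι (suc (K ℕ.+ N)) * (p * (x * value N (K , false)))
    E-oddEnds N = E-sumFrom n (λ D j → if oddEnd K (window (cyclic D) j n) then 1 else 0) _
      (λ j → trans (E-window (K ℕ.+ N) (𝟙 ∘ oddEnd K) j) (E-oddEnd N)) 0 n
      where n = suc (K ℕ.+ N)

    -- The probability that a scan with budget g does not reach the end of its
    -- cluster within N entries.
    survival : ℕ → ℕ → ℚ
    survival N       zero    = 0ℚ
    survival zero    (suc g) = 1ℚ
    survival (suc N) (suc g) = p * survival N K + q * survival N g

    convex-≤ : ∀ {a b c d} → a ≤ c → b ≤ d → p * a + q * b ≤ p * c + q * d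
    convex-≤ a≤c b≤d = ℚ.+-mono-≤ (ℚ.*-monoˡ-≤-nonNeg p {{nonNegative 0≤p}} a≤c) (ℚ.*-monoˡ-≤-nonNeg q {{nonNegative 0≤q}} b≤d)

    survival≤1 : ∀ N g → survival N g ≤ 1ℚ
    survival≤1 N       zero    = 0≤1
    survival≤1 zero    (suc g) = ℚ.≤-refl
    survival≤1 (suc N) (suc g) = ℚ.≤-trans (convex-≤ (survival≤1 N K) (survival≤1 N g)) (ℚ.≤-reflexive (convex 1ℚ))

    survival-suc : ∀ N g → survival (suc N) g ≤ survival N g
    survival-suc N       zero    = ℚ.≤-refl
    survival-suc zero    (suc g) = survival≤1 1 (suc g)
    survival-suc (suc N) (suc g) = convex-≤ (survival-suc N K) (survival-suc N g)

    survival-anti : ∀ d N g → survival (d ℕ.+ N) g ≤ survival N g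
    survival-anti zero    N g = ℚ.≤-refl
    survival-anti (suc d) N g = ℚ.≤-trans (survival-suc (d ℕ.+ N) g) (survival-anti d N g)

    -- A half among the first `g` entries resets both budgets to `K`. If these entries are all full,
    -- budget `g` is spent, and budget `g + 1` survives only through a half at the next entry, with
    -- `j` entries left to read.
    survival-budget : ∀ g j → survival (suc g ℕ.+ j) (suc g) ≡ survival (suc g ℕ.+ j) g + p * (q ^ℚ g * survival j K)
    survival-budget zero    j = solve 3 (λ p q a → p :* a :+ q :* con 0ℚ := con 0ℚ :+ p :* (con 1ℚ :* a)) refl p q (survival j K)
    survival-budget (suc g) j rewrite survival-budget g j =
      solve 6 (λ p q a b y s → p :* a :+ q :* (b :+ p :* (y :* s)) := (p :* a :+ q :* b) :+ p :* ((q :* y) :* s)) refl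
        p q (survival (suc g ℕ.+ j) K) (survival (suc g ℕ.+ j) g) (q ^ℚ g) (survival j K)

    -- The cluster ends exactly at step `K + j + 1` when it is alive after `j` steps and a half and
    -- `K` fulls follow. The derivation works from the other end, replacing the budget `κ` left by
    -- an initial full by means of `survival-budget`.
    survival-rec : ∀ j → survival (suc (K ℕ.+ j)) K ≡ survival (K ℕ.+ j) K - (p * x) * survival j K
    survival-rec j = begin
      p * survival (K ℕ.+ j) K + q * survival (K ℕ.+ j) κ
        ≡⟨ solve 5 (λ p a b y s → p :* a :+ (con 1ℚ :- p) :* b
             := p :* a :+ (con 1ℚ :- p) :* (b :+ p :* (y :* s)) :- (p :* ((con 1ℚ :- p) :* y)) :* s) refl
             p (survival (K ℕ.+ j) K) (survival (K ℕ.+ j) κ) (q ^ℚ κ) (survival j K) ⟩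
      p * survival (K ℕ.+ j) K + q * (survival (K ℕ.+ j) κ + p * (q ^ℚ κ * survival j K)) - (p * x) * survival j K
        ≡⟨ cong (λ z → p * survival (K ℕ.+ j) K + q * z - (p * x) * survival j K) (survival-budget κ j) ⟨
      p * survival (K ℕ.+ j) K + q * survival (K ℕ.+ j) K - (p * x) * survival j K
        ≡⟨ cong (_- (p * x) * survival j K) (convex _) ⟩
      survival (K ℕ.+ j) K - (p * x) * survival j K ∎
      where open ≡-Reasoning

    0≤x : 0ℚ ≤ x
    0≤x = ^-nonNeg 0≤q K

    x≤1 : x ≤ 1ℚ
    x≤1 = ^-≤1 0≤q q≤1 K

    0≤1-px : 0ℚ ≤ 1ℚ - p * x
    0≤1-px = ≤⇒0≤- (*-mono 0≤1 0≤x p≤1 x≤1)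

    -- Survival decreases with time, so `survival j K` in `survival-rec` may be lowered to
    -- `survival (K + j) K`, which makes the recursion geometric.
    survival≤ : ∀ j → survival (K ℕ.+ j) K ≤ (1ℚ - p * x) ^ℚ j
    survival≤ zero    = survival≤1 (K ℕ.+ 0) K
    survival≤ (suc j) = begin
      survival (K ℕ.+ suc j) K
        ≡⟨ cong (λ N → survival N K) (ℕ.+-suc K j) ⟩
      survival (suc (K ℕ.+ j)) K                          ≡⟨ survival-rec j ⟩
      survival (K ℕ.+ j) K - (p * x) * survival j K
        ≤⟨ ℚ.+-monoʳ-≤ (survival (K ℕ.+ j) K) (ℚ.neg-antimono-≤ (ℚ.*-monoˡ-≤-nonNeg (p * x) {{nonNegative (*-nonNeg 0≤p 0≤x)}} (survival-anti K j K))) ⟩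
      survival (K ℕ.+ j) K - (p * x) * survival (K ℕ.+ j) K
        ≡⟨ solve 2 (λ s y → s :- y :* s := (con 1ℚ :- y) :* s) refl (survival (K ℕ.+ j) K) (p * x) ⟩
      (1ℚ - p * x) * survival (K ℕ.+ j) K
        ≤⟨ ℚ.*-monoˡ-≤-nonNeg (1ℚ - p * x) {{nonNegative 0≤1-px}} (survival≤ j) ⟩
      (1ℚ - p * x) * (1ℚ - p * x) ^ℚ j                    ∎
      where open ℚ.≤-Reasoning

    module _ (o : ℚ) (o-inv : (1ℚ + 1ℚ - x) * o ≡ 1ℚ) (0≤o : 0ℚ ≤ o) (o≤1 : o ≤ 1ℚ) where

      -- The limit of value as N → ∞; o is its value at (K , false).
      limit : ℕ → Bool → ℚ
      limit g true  = (1ℚ - q ^ℚ g) * o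
      limit g false = 1ℚ - (1ℚ - q ^ℚ g) * o

      -- The equation that determines `o`. From budget `K`, either `K` fulls come first and the
      -- cluster ends with even parity, or a half comes first, flips the parity and restores the
      -- budget: `o = x + (1 − x)(1 − o)`.
      1-[1-x]o : 1ℚ - (1ℚ - x) * o ≡ o
      1-[1-x]o = begin
        1ℚ - (1ℚ - x) * o                        ≡⟨ cong (_- (1ℚ - x) * o) o-inv ⟨
        (1ℚ + 1ℚ - x) * o - (1ℚ - x) * o
          ≡⟨ solve 2 (λ x o → (con 1ℚ :+ con 1ℚ :- x) :* o :- (con 1ℚ :- x) :* o := o) refl x o ⟩
        o                                        ∎
        where open ≡-Reasoning

      -- The limits obey the same one-step recursion as `value`. In an even state with budget `g`
      -- the scan ends before the next half with probability `q ^ g` and otherwise restarts as odd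
      -- with budget `K`, whence `q ^ g + (1 − q ^ g)(1 − o)`; in an odd state only the restart can
      -- succeed.
      limit-harmonic : ∀ g b → limit (suc g) b ≡ p * limit K (not b) + q * limit g b
      limit-harmonic g true = begin
        (1ℚ - q * y) * o
          ≡⟨ solve 3 (λ p y o → (con 1ℚ :- (con 1ℚ :- p) :* y) :* o
                                                              := p :* o :+ (con 1ℚ :- p) :* ((con 1ℚ :- y) :* o)) refl p y o ⟩
        p * o + q * ((1ℚ - y) * o)
          ≡⟨ cong (λ z → p * z + q * ((1ℚ - y) * o)) 1-[1-x]o ⟨
        p * limit K false + q * ((1ℚ - y) * o)           ∎
        where
        open ≡-Reasoning
        y = q ^ℚ g
      limit-harmonic g false = begin
        1ℚ - (1ℚ - q * y) * o
          ≡⟨ solve 3 (λ p y o → con 1ℚ :- (con 1ℚ :- (con 1ℚ :- p) :* y) :* o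
                                                              := p :* (con 1ℚ :- o) :+ (con 1ℚ :- p) :* (con 1ℚ :- (con 1ℚ :- y) :* o)) refl p y o ⟩
        p * (1ℚ - o) + q * (1ℚ - (1ℚ - y) * o)
          ≡⟨ cong (λ z → p * (1ℚ - z) + q * (1ℚ - (1ℚ - y) * o)) 1-[1-x]o ⟨
        p * (1ℚ - limit K false) + q * (1ℚ - (1ℚ - y) * o)
          ≡⟨ cong (λ z → p * z + q * (1ℚ - (1ℚ - y) * o)) (solve 1 (λ z → con 1ℚ :- (con 1ℚ :- z) := z) refl ((1ℚ - x) * o)) ⟩
        p * limit K true + q * (1ℚ - (1ℚ - y) * o)       ∎
        where
        open ≡-Reasoning
        y = q ^ℚ g

      0≤limit-true : ∀ g → 0ℚ ≤ limit g true
      0≤limit-true g = *-nonNeg {1ℚ - q ^ℚ g} (≤⇒0≤- (^-≤1 0≤q q≤1 g)) 0≤o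

      limit≤1 : ∀ g b → limit g b ≤ 1ℚ
      limit≤1 g true = *-mono {1ℚ - q ^ℚ g} 0≤1 0≤o (0≤-⇒≤ (subst (0ℚ ≤_) (solve 1 (λ y → y := con 1ℚ :- (con 1ℚ :- y)) refl (q ^ℚ g)) (^-nonNeg 0≤q g))) o≤1
      limit≤1 g false = 0≤-⇒≤ (subst (0ℚ ≤_) (solve 1 (λ z → z := con 1ℚ :- (con 1ℚ :- z)) refl (limit g true)) (0≤limit-true g))

      limit-0 : ∀ b → limit 0 b ≡ 𝟙 (not b)
      limit-0 true  = solve 1 (λ o → (con 1ℚ :- con 1ℚ) :* o := con 0ℚ) refl o
      limit-0 false = solve 1 (λ o → con 1ℚ :- (con 1ℚ :- con 1ℚ) :* o := con 1ℚ) refl o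

      -- All three functions follow the same recursion, so only the scans still alive after `N`
      -- entries matter. On those, `limit` is at most 1 and `value` at least 0.
      limit-survival≤value : ∀ N g b → limit g b - survival N g ≤ value N (g , b)
      limit-survival≤value zero    zero    b rewrite limit-0 b = ℚ.≤-reflexive (ℚ.+-identityʳ (𝟙 (not b)))
      limit-survival≤value (suc N) zero    b = ℚ.≤-trans (limit-survival≤value N zero b) (ℚ.≤-reflexive (sym (convex (value N (zero , b)))))
      limit-survival≤value zero    (suc g) b = ℚ.≤-trans
        (ℚ.+-monoˡ-≤ (- 1ℚ) (limit≤1 (suc g) b)) (0≤ι (if not b then 1 else 0))
      limit-survival≤value (suc N) (suc g) b = begin
        limit (suc g) b - (p * survival N K + q * survival N g)
          ≡⟨ cong (_- (p * survival N K + q * survival N g)) (limit-harmonic g b) ⟩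
        p * limit K (not b) + q * limit g b - (p * survival N K + q * survival N g)
          ≡⟨ solve 6 (λ p q a b c d → p :* a :+ q :* b :- (p :* c :+ q :* d) := p :* (a :- c) :+ q :* (b :- d)) refl
               p q (limit K (not b)) (limit g b) (survival N K) (survival N g) ⟩
        p * (limit K (not b) - survival N K) + q * (limit g b - survival N g)
          ≤⟨ convex-≤ (limit-survival≤value N K (not b)) (limit-survival≤value N g b) ⟩
        p * value N (K , not b) + q * value N (g , b) ∎
        where open ℚ.≤-Reasoning

      -- The `n` vertices are the half itself, the `K` fulls of its gap, the `K` scanned vertices
      -- before the decay of `survival≤` sets in, and `j` more.
      E-oddEnds≥ : ∀ j → let n = suc (K ℕ.+ (K ℕ.+ j)) in
        ι n * (p * (x * (o - (1ℚ - p * x) ^ℚ j))) ≤ E n (λ D → ι (oddEnds D κ))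
      E-oddEnds≥ j = ℚ.≤-trans
        (ℚ.*-monoˡ-≤-nonNeg (ι n) {{nonNegative (0≤ι n)}} (ℚ.*-monoˡ-≤-nonNeg p {{nonNegative 0≤p}}
          (ℚ.*-monoˡ-≤-nonNeg x {{nonNegative 0≤x}} (begin
            o - (1ℚ - p * x) ^ℚ j
              ≤⟨ ℚ.+-monoʳ-≤ o (ℚ.neg-antimono-≤ (survival≤ j)) ⟩
            o - survival (K ℕ.+ j) K              ≡⟨ cong (_- survival (K ℕ.+ j) K) 1-[1-x]o ⟨
            limit K false - survival (K ℕ.+ j) K  ≤⟨ limit-survival≤value (K ℕ.+ j) K false ⟩
            value (K ℕ.+ j) (K , false)           ∎))))
        (ℚ.≤-reflexive (sym (E-oddEnds (K ℕ.+ j))))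
        where
        open ℚ.≤-Reasoning
        n = suc (K ℕ.+ (K ℕ.+ j))

-- The matching loss, for fixed demands and in expectation

2μ-loss≤ : ∀ {n} K (D : Vec Demand n) →
  2 ℕ.* μ (complete n [ supp D ]) ℕ.≤ 2 ℕ.* μ (chain n K [ supp D ]) ℕ.+ clusters K D
2μ-loss≤ {n} K D = ℕ.≤-trans (2μ≤halves (complete n) D) (halves≤2μ-chain+clusters K D)

2μ-loss≥ : ∀ {m} (D : Vec Demand (suc m)) κ →
  oddEnds D κ ℕ.+ 2 ℕ.* μ (chain (suc m) (suc κ) [ supp D ]) ℕ.≤ 2 ℕ.* μ (complete (suc m) [ supp D ]) ℕ.+ 1
2μ-loss≥ D κ = ℕ.≤-trans (oddEnds+2μ≤halves D κ) (halves≤2μ-complete+1 D)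

module Loss (p : ℝ) (k : ℕ) (0≤p : 0ℚ ℚ.≤ seq p k) (p≤1 : seq p k ℚ.≤ 1ℚ) where

  open Data.Rational.Base hiding (truncate)
  open Expectation (seq p k) 0≤p p≤1

  expectationOver : ∀ {n} → List (Vec Demand n) → (Vec Demand n → ℝ) → ℚ
  expectationOver Ds f = seq (List.foldr (λ D s → Pr p D Defs.* f D Defs.+ s) 0ℝ Ds) k

  over-++ : ∀ {n} (Ds Es : List (Vec Demand n)) f → expectationOver (Ds ++ Es) f ≡ expectationOver Ds f + expectationOver Es f
  over-++ []       Es f = sym (ℚ.+-identityˡ _)
  over-++ (D ∷ Ds) Es f = trans (cong (seq (Pr p D) k * seq (f D) k +_) (over-++ Ds Es f))
    (sym (ℚ.+-assoc (seq (Pr p D) k * seq (f D) k) (expectationOver Ds f) (expectationOver Es f)))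

  over-map : ∀ {n} d (Ds : List (Vec Demand n)) f →
             expectationOver (List.map (d ∷_) Ds) f ≡ seq (weight p d) k * expectationOver Ds (f ∘ (d ∷_))
  over-map d []       f = sym (ℚ.*-zeroʳ (seq (weight p d) k))
  over-map d (D ∷ Ds) f rewrite over-map d Ds f =
    solve 4 (λ w P x s → (w :* P) :* x :+ w :* s := w :* (P :* x :+ s)) refl
      (seq (weight p d) k) (seq (Pr p D) k) (seq (f (d ∷ D)) k) (expectationOver Ds (f ∘ (d ∷_)))

  seq-𝔼 : ∀ n (f : Vec Demand n → ℝ) → seq (𝔼 p f) k ≡ E n (λ D → seq (f D) k)
  seq-𝔼 zero    f = solve 1 (λ x → con 1ℚ :* x :+ con 0ℚ := x) refl (seq (f []) k)
  seq-𝔼 (suc n) f = begin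
    expectationOver (List.map (half ∷_) (demands n) ++ List.map (full ∷_) (demands n) ++ []) f
      ≡⟨ over-++ (List.map (half ∷_) (demands n)) _ f ⟩
    expectationOver (List.map (half ∷_) (demands n)) f + expectationOver (List.map (full ∷_) (demands n) ++ []) f
      ≡⟨ cong (λ Ds → expectationOver (List.map (half ∷_) (demands n)) f + expectationOver Ds f) (++-identityʳ (List.map (full ∷_) (demands n))) ⟩
    expectationOver (List.map (half ∷_) (demands n)) f + expectationOver (List.map (full ∷_) (demands n)) f
      ≡⟨ cong₂ _+_ (over-map half (demands n) f) (over-map full (demands n) f) ⟩
    seq p k * seq (𝔼 p (f ∘ (half ∷_))) k + q * seq (𝔼 p (f ∘ (full ∷_))) k
      ≡⟨ cong₂ (λ a b → seq p k * a + q * b) (seq-𝔼 n (f ∘ (half ∷_))) (seq-𝔼 n (f ∘ (full ∷_))) ⟩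
    E (suc n) (λ D → seq (f D) k) ∎
    where open ≡-Reasoning

  -- No approximation is involved: the operations that build `L` all act termwise. The factor 2 is
  -- moved inside to meet the doubled matching numbers of the counting bounds.
  seq-L : ∀ {n} (G : Graph n) → seq (L p G) k ≡ E n (λ D → ι (2 ℕ.* μ (complete n [ supp D ])) - ι (2 ℕ.* μ (G [ supp D ])))
  seq-L {n} G = begin
    ι 2 * seq (𝔼 p loss) k        ≡⟨ cong (ι 2 *_) (seq-𝔼 n loss) ⟩
    ι 2 * E n (λ D → seq (loss D) k)            ≡⟨ E-* n (ι 2) _ ⟨
    E n (λ D → ι 2 * seq (loss D) k)
      ≡⟨ E-cong n (λ D → double (μ (complete n [ supp D ])) (μ (G [ supp D ]))) ⟩
    E n (λ D → ι (2 ℕ.* μ (complete n [ supp D ])) - ι (2 ℕ.* μ (G [ supp D ]))) ∎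
    where
    open ≡-Reasoning
    loss : Vec Demand n → ℝ
    loss D = fromℕ (μ (complete n [ supp D ])) Defs.- fromℕ (μ (G [ supp D ]))
    double : ∀ a b → ι 2 * (ι a - ι b) ≡ ι (2 ℕ.* a) - ι (2 ℕ.* b)
    double a b rewrite ι-* 2 a | ι-* 2 b =
      solve 3 (λ t x y → t :* (x :- y) := t :* x :- t :* y) refl (ι 2) (ι a) (ι b)

  L-chain≤ : ∀ n K → seq (L p (chain n K)) k ≤ ι n * (seq p k * q ^ℚ K) + 1ℚ
  L-chain≤ n K = begin
    seq (L p (chain n K)) k
      ≡⟨ seq-L (chain n K) ⟩
    E n (λ D → ι (2 ℕ.* μ (complete n [ supp D ])) - ι (2 ℕ.* μ (chain n K [ supp D ])))
      ≤⟨ E-mono n (λ D → bound D) ⟩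
    E n (ι ∘ clusters K)
      ≤⟨ E-clusters≤ n K ⟩
    ι n * (seq p k * q ^ℚ K) + 1ℚ ∎
    where
    open ℚ.≤-Reasoning
    bound : ∀ D → ι (2 ℕ.* μ (complete n [ supp D ])) - ι (2 ℕ.* μ (chain n K [ supp D ])) ≤ ι (clusters K D)
    bound D = begin
      ι a - ι b                     ≤⟨ ℚ.+-monoˡ-≤ (- ι b) (ι-mono (2μ-loss≤ K D)) ⟩
      ι (b ℕ.+ clusters K D) - ι b  ≡⟨ cong (_- ι b) (ι-+ b (clusters K D)) ⟩
      ι b + ι (clusters K D) - ι b
        ≡⟨ solve 2 (λ b c → b :+ c :- b := c) refl (ι b) (ι (clusters K D)) ⟩
      ι (clusters K D)              ∎
      where
      a = 2 ℕ.* μ (complete n [ supp D ])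
      b = 2 ℕ.* μ (chain n K [ supp D ])

  L-chain≥ : ∀ m κ → E (suc m) (λ D → ι (oddEnds D κ)) - 1ℚ ≤ seq (L p (chain (suc m) (suc κ))) k
  L-chain≥ m κ = begin
    E n (λ D → ι (oddEnds D κ)) - 1ℚ
      ≡⟨ cong (λ c → E n (λ D → ι (oddEnds D κ)) + c) (E-const n (- 1ℚ)) ⟨
    E n (λ D → ι (oddEnds D κ)) + E n (λ D → - 1ℚ)
      ≡⟨ E-+ n (λ D → ι (oddEnds D κ)) (λ _ → - 1ℚ) ⟨
    E n (λ D → ι (oddEnds D κ) - 1ℚ)                  ≤⟨ E-mono n bound ⟩
    E n (λ D → ι (2 ℕ.* μ (complete n [ supp D ])) - ι (2 ℕ.* μ (chain n K [ supp D ])))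
      ≡⟨ seq-L (chain n K) ⟨
    seq (L p (chain n K)) k ∎
    where
    open ℚ.≤-Reasoning
    n = suc m
    K = suc κ
    bound : ∀ D → ι (oddEnds D κ) - 1ℚ ≤ ι (2 ℕ.* μ (complete n [ supp D ])) - ι (2 ℕ.* μ (chain n K [ supp D ]))
    bound D = begin
      ι o - 1ℚ
        ≡⟨ solve 2 (λ o b → o :- con 1ℚ := o :+ b :- (b :+ con 1ℚ)) refl (ι o) (ι b) ⟩
      ι o + ι b - (ι b + 1ℚ)    ≡⟨ cong (_- (ι b + 1ℚ)) (ι-+ o b) ⟨
      ι (o ℕ.+ b) - (ι b + 1ℚ)  ≤⟨ ℚ.+-monoˡ-≤ (- (ι b + 1ℚ)) (ι-mono (2μ-loss≥ D κ)) ⟩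
      ι (a ℕ.+ 1) - (ι b + 1ℚ)  ≡⟨ cong (_- (ι b + 1ℚ)) (ι-+ a 1) ⟩
      ι a + 1ℚ - (ι b + 1ℚ)
        ≡⟨ solve 2 (λ a b → a :+ con 1ℚ :- (b :+ con 1ℚ) := a :- b) refl (ι a) (ι b) ⟩
      ι a - ι b                 ∎
      where
      o = oddEnds D κ
      a = 2 ℕ.* μ (complete n [ supp D ])
      b = 2 ℕ.* μ (chain n K [ supp D ])

-- Partial sums of the exponential series

module Exponential where

  open Sequences
  open Data.Rational.Base hiding (truncate)

  -- Partial sums of Cauchy products

  module Series where

    partialSum : (ℕ → ℚ) → ℕ → ℚ
    partialSum a zero    = 0ℚ
    partialSum a (suc N) = a 0 + partialSum (a ∘ suc) N

    convolution : (ℕ → ℚ) → (ℕ → ℚ) → ℕ → ℚ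
    convolution a b zero    = a 0 * b 0
    convolution a b (suc k) = a 0 * b (suc k) + convolution (a ∘ suc) b k

    cauchySum : (ℕ → ℚ) → (ℕ → ℚ) → ℕ → ℚ
    cauchySum a b = partialSum (convolution a b)

    partialSum-snoc : ∀ a N → partialSum a (suc N) ≡ partialSum a N + a N
    partialSum-snoc a zero    = ℚ.+-comm (a 0) 0ℚ
    partialSum-snoc a (suc N) = trans (cong (a 0 +_) (partialSum-snoc (a ∘ suc) N)) (sym (ℚ.+-assoc (a 0) _ _))

    partialSum-cong : ∀ {a b} → (∀ i → a i ≡ b i) → ∀ N → partialSum a N ≡ partialSum b N
    partialSum-cong a≡b zero    = refl
    partialSum-cong a≡b (suc N) = cong₂ _+_ (a≡b 0) (partialSum-cong (a≡b ∘ suc) N)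

    -- The triangle of index pairs is cut along its row `i = 0`; what remains is a smaller triangle
    -- for the shifted sequence.
    cauchySum-suc : ∀ a b N → cauchySum a b (suc N) ≡ a 0 * partialSum b (suc N) + cauchySum (a ∘ suc) b N
    cauchySum-suc a b zero    = solve 2 (λ a b → a :* b :+ con 0ℚ := a :* (b :+ con 0ℚ) :+ con 0ℚ) refl (a 0) (b 0)
    cauchySum-suc a b (suc N) = begin
      cauchySum a b (suc (suc N))
        ≡⟨ partialSum-snoc (convolution a b) (suc N) ⟩
      cauchySum a b (suc N) + (a 0 * b (suc N) + convolution (a ∘ suc) b N)
        ≡⟨ cong (_+ (a 0 * b (suc N) + convolution (a ∘ suc) b N)) (cauchySum-suc a b N) ⟩
      a 0 * partialSum b (suc N) + cauchySum (a ∘ suc) b N + (a 0 * b (suc N) + convolution (a ∘ suc) b N)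
        ≡⟨ solve 5 (λ a s c b d → a :* s :+ c :+ (a :* b :+ d) := a :* (s :+ b) :+ (c :+ d)) refl
             (a 0) (partialSum b (suc N)) (cauchySum (a ∘ suc) b N) (b (suc N)) (convolution (a ∘ suc) b N) ⟩
      a 0 * (partialSum b (suc N) + b (suc N)) + (cauchySum (a ∘ suc) b N + convolution (a ∘ suc) b N)
        ≡⟨ cong₂ (λ s c → a 0 * s + c) (partialSum-snoc b (suc N)) (partialSum-snoc (convolution (a ∘ suc) b) N) ⟨
      a 0 * partialSum b (suc (suc N)) + cauchySum (a ∘ suc) b (suc N) ∎
      where open ≡-Reasoning

    partialSum-tail : ∀ {b B} → (∀ i → ∣ b i ∣ ≤ B i) → ∀ j N →
      ∣ partialSum b (j ℕ.+ N) - partialSum b N ∣ ≤ partialSum B (j ℕ.+ N) - partialSum B N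
    partialSum-tail {b} {B} b≤B zero N rewrite ℚ.+-inverseʳ (partialSum b N) | ℚ.+-inverseʳ (partialSum B N) = ℚ.≤-refl
    partialSum-tail {b} {B} b≤B (suc j) N = begin
      ∣ partialSum b (suc j ℕ.+ N) - partialSum b N ∣
        ≡⟨ cong ∣_∣ (trans (cong (_- partialSum b N) (partialSum-snoc b (j ℕ.+ N))) (rearrange (partialSum b (j ℕ.+ N)) (b (j ℕ.+ N)) (partialSum b N))) ⟩
      ∣ (partialSum b (j ℕ.+ N) - partialSum b N) + b (j ℕ.+ N) ∣
        ≤⟨ ℚ.∣p+q∣≤∣p∣+∣q∣ (partialSum b (j ℕ.+ N) - partialSum b N) (b (j ℕ.+ N)) ⟩
      ∣ partialSum b (j ℕ.+ N) - partialSum b N ∣ + ∣ b (j ℕ.+ N) ∣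
        ≤⟨ ℚ.+-mono-≤ (partialSum-tail b≤B j N) (b≤B (j ℕ.+ N)) ⟩
      (partialSum B (j ℕ.+ N) - partialSum B N) + B (j ℕ.+ N)
        ≡⟨ trans (cong (_- partialSum B N) (partialSum-snoc B (j ℕ.+ N))) (rearrange (partialSum B (j ℕ.+ N)) (B (j ℕ.+ N)) (partialSum B N)) ⟨
      partialSum B (suc j ℕ.+ N) - partialSum B N ∎
      where
      open ℚ.≤-Reasoning
      rearrange : ∀ s x t → (s + x) - t ≡ (s - t) + x
      rearrange = solve 3 (λ s x t → (s :+ x) :- t := (s :- t) :+ x) refl

    partialSum-mono : ∀ {B} → (∀ i → 0ℚ ≤ B i) → ∀ j N → partialSum B N ≤ partialSum B (j ℕ.+ N)
    partialSum-mono {B} 0≤B zero    N = ℚ.≤-refl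
    partialSum-mono {B} 0≤B (suc j) N = ℚ.≤-trans (partialSum-mono 0≤B j N)
      (subst (partialSum B (j ℕ.+ N) ≤_) (sym (partialSum-snoc B (j ℕ.+ N))) (≤-step (0≤B (j ℕ.+ N))))

    -- The difference is the sum of `a i * b k` over `i < N` and `k < j + N` with `i + k ≥ N`, so it
    -- is dominated term by term. The offset `j` grows in the induction because removing `a 0`
    -- shortens the first sum and leaves the second one as it is.
    product-cauchySum : ∀ {b B} → (∀ i → ∣ b i ∣ ≤ B i) → ∀ {a A} → (∀ i → ∣ a i ∣ ≤ A i) → ∀ N j →
      ∣ partialSum a N * partialSum b (j ℕ.+ N) - cauchySum a b N ∣ ≤ partialSum A N * partialSum B (j ℕ.+ N) - cauchySum A B N
    product-cauchySum {b} {B} b≤B {a} {A} a≤A zero j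
      rewrite ℚ.*-zeroˡ (partialSum b (j ℕ.+ 0)) | ℚ.*-zeroˡ (partialSum B (j ℕ.+ 0)) = ℚ.≤-refl
    product-cauchySum {b} {B} b≤B {a} {A} a≤A (suc N) j = begin
      ∣ (a 0 + sa) * sb - cauchySum a b (suc N) ∣
        ≡⟨ cong ∣_∣ (trans (cong (λ z → (a 0 + sa) * sb - z) (cauchySum-suc a b N)) (rearrange (a 0) sa sb (partialSum b (suc N)) (cauchySum (a ∘ suc) b N))) ⟩
      ∣ a 0 * (sb - partialSum b (suc N)) + (sa * sb - cauchySum (a ∘ suc) b N) ∣
        ≤⟨ ℚ.∣p+q∣≤∣p∣+∣q∣ (a 0 * (sb - partialSum b (suc N))) (sa * sb - cauchySum (a ∘ suc) b N) ⟩
      ∣ a 0 * (sb - partialSum b (suc N)) ∣ + ∣ sa * sb - cauchySum (a ∘ suc) b N ∣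
        ≤⟨ ℚ.+-mono-≤ head≤ (subst (λ i → ∣ sa * partialSum b i - cauchySum (a ∘ suc) b N ∣ ≤ sA * partialSum B i - cauchySum (A ∘ suc) B N)
             (sym (ℕ.+-suc j N)) (product-cauchySum b≤B (a≤A ∘ suc) N (suc j))) ⟩
      A 0 * (sB - partialSum B (suc N)) + (sA * sB - cauchySum (A ∘ suc) B N)
        ≡⟨ trans (cong (λ z → (A 0 + sA) * sB - z) (cauchySum-suc A B N)) (rearrange (A 0) sA sB (partialSum B (suc N)) (cauchySum (A ∘ suc) B N)) ⟨
      (A 0 + sA) * sB - cauchySum A B (suc N) ∎
      where
      open ℚ.≤-Reasoning
      sa = partialSum (a ∘ suc) N
      sA = partialSum (A ∘ suc) N
      sb = partialSum b (j ℕ.+ suc N)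
      sB = partialSum B (j ℕ.+ suc N)
      rearrange : ∀ a sa sb sb′ c → (a + sa) * sb - (a * sb′ + c) ≡ a * (sb - sb′) + (sa * sb - c)
      rearrange = solve 5 (λ a sa sb sb′ c → (a :+ sa) :* sb :- (a :* sb′ :+ c) := a :* (sb :- sb′) :+ (sa :* sb :- c)) refl
      head≤ : ∣ a 0 * (sb - partialSum b (suc N)) ∣ ≤ A 0 * (sB - partialSum B (suc N))
      head≤ = subst (_≤ A 0 * (sB - partialSum B (suc N))) (sym (ℚ.∣p*q∣≡∣p∣*∣q∣ (a 0) (sb - partialSum b (suc N))))
        (*-mono (ℚ.≤-trans (ℚ.0≤∣p∣ (a 0)) (a≤A 0)) (ℚ.0≤∣p∣ (sb - partialSum b (suc N))) (a≤A 0) (partialSum-tail b≤B j (suc N)))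

    0≤partialSum : ∀ {B} → (∀ i → 0ℚ ≤ B i) → ∀ N → 0ℚ ≤ partialSum B N
    0≤partialSum 0≤B zero    = ℚ.≤-refl
    0≤partialSum 0≤B (suc N) = +-nonNeg (0≤B 0) (0≤partialSum (0≤B ∘ suc) N)

    0≤convolution : ∀ {A B} → (∀ i → 0ℚ ≤ A i) → (∀ i → 0ℚ ≤ B i) → ∀ k → 0ℚ ≤ convolution A B k
    0≤convolution 0≤A 0≤B zero    = *-nonNeg (0≤A 0) (0≤B 0)
    0≤convolution 0≤A 0≤B (suc k) = +-nonNeg (*-nonNeg (0≤A 0) (0≤B (suc k))) (0≤convolution (0≤A ∘ suc) 0≤B k)

    -- The rectangle `i < N`, `k < M` lies inside the triangle `i + k < N + M`.
    product≤cauchySum : ∀ {A B} → (∀ i → 0ℚ ≤ A i) → (∀ i → 0ℚ ≤ B i) → ∀ N M →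
      partialSum A N * partialSum B M ≤ cauchySum A B (N ℕ.+ M)
    product≤cauchySum {A} {B} 0≤A 0≤B zero    M = subst (_≤ cauchySum A B M) (sym (ℚ.*-zeroˡ (partialSum B M)))
      (0≤partialSum (0≤convolution 0≤A 0≤B) M)
    product≤cauchySum {A} {B} 0≤A 0≤B (suc N) M = begin
      (A 0 + sA) * partialSum B M                 ≡⟨ ℚ.*-distribʳ-+ (partialSum B M) (A 0) sA ⟩
      A 0 * partialSum B M + sA * partialSum B M
        ≤⟨ ℚ.+-mono-≤ (ℚ.*-monoˡ-≤-nonNeg (A 0) {{nonNegative (0≤A 0)}} (partialSum-mono 0≤B (suc N) M))
                                                       (product≤cauchySum (0≤A ∘ suc) 0≤B N M) ⟩
      A 0 * partialSum B (suc N ℕ.+ M) + cauchySum (A ∘ suc) B (N ℕ.+ M)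
        ≡⟨ cauchySum-suc A B (N ℕ.+ M) ⟨
      cauchySum A B (suc N ℕ.+ M)                 ∎
      where
      open ℚ.≤-Reasoning
      sA = partialSum (A ∘ suc) N

    -- Coefficients of the formal derivative of the power series with coefficients `a`.
    derivative : (ℕ → ℚ) → ℕ → ℚ
    derivative a k = ι (suc k) * a (suc k)

    convolution-cong : ∀ {a a′ b b′} → (∀ i → a i ≡ a′ i) → (∀ i → b i ≡ b′ i) → ∀ k → convolution a b k ≡ convolution a′ b′ k
    convolution-cong a≡ b≡ zero    = cong₂ _*_ (a≡ 0) (b≡ 0)
    convolution-cong a≡ b≡ (suc k) = cong₂ _+_ (cong₂ _*_ (a≡ 0) (b≡ (suc k))) (convolution-cong (a≡ ∘ suc) b≡ k)

    convolution-+ˡ : ∀ a a′ b k → convolution (λ i → a i + a′ i) b k ≡ convolution a b k + convolution a′ b k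
    convolution-+ˡ a a′ b zero    = ℚ.*-distribʳ-+ (b 0) (a 0) (a′ 0)
    convolution-+ˡ a a′ b (suc k) rewrite convolution-+ˡ (a ∘ suc) (a′ ∘ suc) b k =
      solve 5 (λ a a′ b c c′ → (a :+ a′) :* b :+ (c :+ c′) := (a :* b :+ c) :+ (a′ :* b :+ c′)) refl
        (a 0) (a′ 0) (b (suc k)) (convolution (a ∘ suc) b k) (convolution (a′ ∘ suc) b k)

    convolution-*ˡ : ∀ x a b k → convolution (λ i → x * a i) b k ≡ x * convolution a b k
    convolution-*ˡ x a b zero    = ℚ.*-assoc x (a 0) (b 0)
    convolution-*ˡ x a b (suc k) rewrite convolution-*ˡ x (a ∘ suc) b k =
      solve 4 (λ x a b c → (x :* a) :* b :+ x :* c := x :* (a :* b :+ c)) refl x (a 0) (b (suc k)) (convolution (a ∘ suc) b k)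

    convolution-*ʳ : ∀ x a b k → convolution a (λ i → x * b i) k ≡ x * convolution a b k
    convolution-*ʳ x a b zero    = solve 3 (λ x a b → a :* (x :* b) := x :* (a :* b)) refl x (a 0) (b 0)
    convolution-*ʳ x a b (suc k) rewrite convolution-*ʳ x (a ∘ suc) b k =
      solve 4 (λ x a b c → a :* (x :* b) :+ x :* c := x :* (a :* b :+ c)) refl x (a 0) (b (suc k)) (convolution (a ∘ suc) b k)

    leibniz : ∀ a b k → derivative (convolution a b) k ≡ convolution (derivative a) b k + convolution a (derivative b) k
    leibniz a b zero = solve 4 (λ a₀ a₁ b₀ b₁ → con 1ℚ :* (a₀ :* b₁ :+ a₁ :* b₀) := (con 1ℚ :* a₁) :* b₀ :+ a₀ :* (con 1ℚ :* b₁)) refl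
      (a 0) (a 1) (b 0) (b 1)
    leibniz a b (suc k) = begin
      ι (2 ℕ.+ k) * (a 0 * b (2 ℕ.+ k) + c)
        ≡⟨ ℚ.*-distribˡ-+ (ι (2 ℕ.+ k)) _ c ⟩
      ι (2 ℕ.+ k) * (a 0 * b (2 ℕ.+ k)) + ι (2 ℕ.+ k) * c
        ≡⟨ cong (λ z → ι (2 ℕ.+ k) * (a 0 * b (2 ℕ.+ k)) + z * c) (ι-+ 1 (suc k)) ⟩
      ι (2 ℕ.+ k) * (a 0 * b (2 ℕ.+ k)) + (1ℚ + ι (suc k)) * c
        ≡⟨ solve 5 (λ i j a b c → i :* (a :* b) :+ (con 1ℚ :+ j) :* c := a :* (i :* b) :+ c :+ j :* c) refl
             (ι (2 ℕ.+ k)) (ι (suc k)) (a 0) (b (2 ℕ.+ k)) c ⟩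
      a 0 * derivative b (suc k) + c + derivative (convolution (a ∘ suc) b) k
        ≡⟨ cong (a 0 * derivative b (suc k) + c +_) (leibniz (a ∘ suc) b k) ⟩
      a 0 * derivative b (suc k) + (a 1 * b (suc k) + c₂) + (c₁ + c₃)
        ≡⟨ solve 5 (λ u v c₁ c₂ c₃ → u :+ (v :+ c₂) :+ (c₁ :+ c₃) := con 1ℚ :* v :+ (c₁ :+ c₂) :+ (u :+ c₃)) refl
             (a 0 * derivative b (suc k)) (a 1 * b (suc k)) c₁ c₂ c₃ ⟩
      1ℚ * (a 1 * b (suc k)) + (c₁ + c₂) + (a 0 * derivative b (suc k) + c₃)
        ≡⟨ cong₂ (λ z w → z + w + (a 0 * derivative b (suc k) + c₃)) (sym (ℚ.*-assoc 1ℚ (a 1) (b (suc k)))) shifted ⟩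
      convolution (derivative a) b (suc k) + convolution a (derivative b) (suc k) ∎
      where
      open ≡-Reasoning
      c = convolution (a ∘ suc) b (suc k)
      c₁ = convolution (derivative (a ∘ suc)) b k
      c₂ = convolution (a ∘ suc ∘ suc) b k
      c₃ = convolution (a ∘ suc) (derivative b) k
      shifted : c₁ + c₂ ≡ convolution (derivative a ∘ suc) b k
      shifted = trans (sym (convolution-+ˡ (derivative (a ∘ suc)) (a ∘ suc ∘ suc) b k))
        (convolution-cong {b = b} (λ i → trans
          (solve 2 (λ j z → j :* z :+ z := (con 1ℚ :+ j) :* z) refl (ι (suc i)) (a (2 ℕ.+ i)))
          (cong (_* a (2 ℕ.+ i)) (sym (ι-+ 1 (suc i))))) (λ _ → refl) k)

  open Series

  -- Truncated exponentials and their errors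

  term : ℚ → ℕ → ℚ
  term x k = x ^ k * 1/! k

  expSum≡partialSum : ∀ x N → expSum N x ≡ partialSum (term x) N
  expSum≡partialSum x zero    = refl
  expSum≡partialSum x (suc N) = trans (cong (_+ term x N) (expSum≡partialSum x N)) (sym (partialSum-snoc (term x) N))

  derivative-term : ∀ x k → derivative (term x) k ≡ x * term x k
  derivative-term x k = begin
    ι (suc k) * ((x * x ^ k) * 1/! (suc k))
      ≡⟨ solve 4 (λ i x y r → i :* ((x :* y) :* r) := x :* (y :* (r :* i))) refl (ι (suc k)) x (x ^ k) (1/! (suc k)) ⟩
    x * (x ^ k * (1/! (suc k) * ι (suc k)))  ≡⟨ cong (λ z → x * (x ^ k * z)) (1/!-suc k) ⟩
    x * term x k                             ∎
    where open ≡-Reasoning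

  ι-cancel : ∀ k {a b} → ι (suc k) * a ≡ ι (suc k) * b → a ≡ b
  ι-cancel k eq = ℚ.≤-antisym
    (ℚ.*-cancelˡ-≤-pos (ι (suc k)) {{positive (0<ι k)}} (ℚ.≤-reflexive eq))
    (ℚ.*-cancelˡ-≤-pos (ι (suc k)) {{positive (0<ι k)}} (ℚ.≤-reflexive (sym eq)))

  -- Binomial coefficients are avoided: as formal power series both sides solve `f′ = (x + y) f`
  -- with constant term 1, and the factor `ι (suc k)` of the derivative can be cancelled.
  convolution-term : ∀ x y k → convolution (term x) (term y) k ≡ term (x + y) k
  convolution-term x y zero    = refl
  convolution-term x y (suc k) = ι-cancel k (begin
    derivative (convolution (term x) (term y)) k
      ≡⟨ leibniz (term x) (term y) k ⟩
    convolution (derivative (term x)) (term y) k + convolution (term x) (derivative (term y)) k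
      ≡⟨ cong₂ _+_ (trans (convolution-cong {b = term y} (derivative-term x) (λ _ → refl) k) (convolution-*ˡ x (term x) (term y) k))
                   (trans (convolution-cong {a = term x} (λ _ → refl) (derivative-term y) k) (convolution-*ʳ y (term x) (term y) k)) ⟩
    x * convolution (term x) (term y) k + y * convolution (term x) (term y) k
      ≡⟨ ℚ.*-distribʳ-+ (convolution (term x) (term y) k) x y ⟨
    (x + y) * convolution (term x) (term y) k
      ≡⟨ cong ((x + y) *_) (convolution-term x y k) ⟩
    (x + y) * term (x + y) k
      ≡⟨ derivative-term (x + y) k ⟨
    derivative (term (x + y)) k ∎)
    where open ≡-Reasoning

  cauchySum-term : ∀ x y N → cauchySum (term x) (term y) N ≡ expSum N (x + y)
  cauchySum-term x y N = trans (partialSum-cong (convolution-term x y) N) (sym (expSum≡partialSum (x + y) N))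

  ∣term∣≤ : ∀ {x b} → ∣ x ∣ ≤ b → ∀ k → ∣ term x k ∣ ≤ term b k
  ∣term∣≤ {x} {b} x≤b k = subst (_≤ term b k) (sym (∣*∣ (x ^ k) (0≤1/! k)))
    (ℚ.*-monoʳ-≤-nonNeg (1/! k) {{nonNegative (0≤1/! k)}} (∣^∣≤ x≤b k))

  expSum-product : ∀ {x y a b} → ∣ x ∣ ≤ a → ∣ y ∣ ≤ b → ∀ N →
    ∣ expSum N x * expSum N y - expSum N (x + y) ∣ ≤ expSum N a * expSum N b - expSum N (a + b)
  expSum-product {x} {y} {a} {b} x≤a y≤b N = subst₂ (λ u v → ∣ u ∣ ≤ v) (rephrase x y) (rephrase a b)
    (product-cauchySum (∣term∣≤ y≤b) (∣term∣≤ x≤a) N 0)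
    where
    rephrase : ∀ x y → partialSum (term x) N * partialSum (term y) N - cauchySum (term x) (term y) N
                     ≡ expSum N x * expSum N y - expSum N (x + y)
    rephrase x y = cong₂ _-_ (sym (cong₂ _*_ (expSum≡partialSum x N) (expSum≡partialSum y N))) (cauchySum-term x y N)

  expSum-product≤ : ∀ {a b} → 0ℚ ≤ a → 0ℚ ≤ b → ∀ N → expSum N a * expSum N b ≤ expSum (N ℕ.+ N) (a + b)
  expSum-product≤ {a} {b} 0≤a 0≤b N = subst₂ _≤_
    (sym (cong₂ _*_ (expSum≡partialSum a N) (expSum≡partialSum b N))) (cauchySum-term a b (N ℕ.+ N))
    (product≤cauchySum (term-nonNeg 0≤a) (term-nonNeg 0≤b) N N)

  -- Taken at `x = a` and `y = b`, the error bound of `expSum-product` dominates an absolute value,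
  -- so it is nonnegative.
  expSum-+≤ : ∀ {a b} → 0ℚ ≤ a → 0ℚ ≤ b → ∀ N → expSum N (a + b) ≤ expSum N a * expSum N b
  expSum-+≤ {a} {b} 0≤a 0≤b N = 0≤-⇒≤ (ℚ.≤-trans (ℚ.0≤∣p∣ _)
    (expSum-product {a} {b} (ℚ.≤-reflexive (ℚ.0≤p⇒∣p∣≡p 0≤a)) (ℚ.≤-reflexive (ℚ.0≤p⇒∣p∣≡p 0≤b)) N))

  expSum-monoˡ : ∀ {a b} → 0ℚ ≤ a → a ≤ b → ∀ N → expSum N a ≤ expSum N b
  expSum-monoˡ 0≤a a≤b zero    = ℚ.≤-refl
  expSum-monoˡ {a} {b} 0≤a a≤b (suc N) = ℚ.+-mono-≤ (expSum-monoˡ 0≤a a≤b N)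
    (ℚ.≤-trans (p≤∣p∣ (term a N)) (∣term∣≤ (subst (_≤ b) (sym (ℚ.0≤p⇒∣p∣≡p 0≤a)) a≤b) N))

  1≤expSum : ∀ {t} → 0ℚ ≤ t → ∀ N → 1ℚ ≤ expSum (suc N) t
  1≤expSum {t} 0≤t N = subst (λ k → 1ℚ ≤ expSum k t) (ℕ.+-comm N 1) (expSum-mono 0≤t N 1)

  expSum-0 : ∀ N → expSum (suc N) 0ℚ ≡ 1ℚ
  expSum-0 zero    = refl
  expSum-0 (suc N) = trans (cong₂ _+_ (expSum-0 N) (trans (cong (_* 1/! (suc N)) (ℚ.*-zeroˡ (0ℚ ^ N))) (ℚ.*-zeroˡ (1/! (suc N))))) (ℚ.+-identityʳ 1ℚ)

  1/!≤1 : ∀ k → 1/! k ≤ 1ℚ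
  1/!≤1 zero    = ℚ.≤-refl
  1/!≤1 (suc k) = begin
    1/! (suc k)                ≡⟨ ℚ.*-identityʳ (1/! (suc k)) ⟨
    1/! (suc k) * 1ℚ
      ≤⟨ ℚ.*-monoˡ-≤-nonNeg (1/! (suc k)) {{nonNegative (0≤1/! (suc k))}} (ι-mono (s≤s (z≤n {k}))) ⟩
    1/! (suc k) * ι (suc k)    ≡⟨ 1/!-suc k ⟩
    1/! k                      ≤⟨ 1/!≤1 k ⟩
    1ℚ                         ∎
    where open ℚ.≤-Reasoning

  -- The exponential series is dominated by the geometric one.
  [1-y]expSum≤ : ∀ {y} → 0ℚ ≤ y → y ≤ 1ℚ → ∀ N → (1ℚ - y) * expSum N y ≤ 1ℚ - y ^ N
  [1-y]expSum≤ {y} 0≤y y≤1 zero    = ℚ.≤-reflexive (ℚ.*-zeroʳ (1ℚ - y))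
  [1-y]expSum≤ {y} 0≤y y≤1 (suc N) = begin
    (1ℚ - y) * (expSum N y + y ^ N * 1/! N)
      ≡⟨ solve 4 (λ w e z r → w :* (e :+ z :* r) := w :* e :+ (w :* z) :* r) refl (1ℚ - y) (expSum N y) (y ^ N) (1/! N) ⟩
    (1ℚ - y) * expSum N y + ((1ℚ - y) * y ^ N) * 1/! N
      ≤⟨ ℚ.+-mono-≤ ([1-y]expSum≤ 0≤y y≤1 N)
           (ℚ.*-monoˡ-≤-nonNeg ((1ℚ - y) * y ^ N) {{nonNegative (*-nonNeg (≤⇒0≤- y≤1) (^-nonNeg 0≤y N))}} (1/!≤1 N)) ⟩
    (1ℚ - y ^ N) + ((1ℚ - y) * y ^ N) * 1ℚ
      ≡⟨ solve 2 (λ y z → (con 1ℚ :- z) :+ ((con 1ℚ :- y) :* z) :* con 1ℚ := con 1ℚ :- y :* z) refl y (y ^ N) ⟩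
    1ℚ - y ^ suc N                                ∎
    where open ℚ.≤-Reasoning

  -- A truncated form of `(1 − y)ᵐ ≤ exp(−m y)`. Stated as a product, it has only nonnegative
  -- arguments, for which partial sums are submultiplicative and each factor `(1 − y) * expSum N y`
  -- is at most 1.
  [1-y]^expSum≤1 : ∀ {y} → 0ℚ ≤ y → y ≤ 1ℚ → ∀ m N → (1ℚ - y) ^ m * expSum (suc N) (ι m * y) ≤ 1ℚ
  [1-y]^expSum≤1 {y} 0≤y y≤1 zero    N rewrite ℚ.*-zeroˡ y | expSum-0 N = ℚ.≤-refl
  [1-y]^expSum≤1 {y} 0≤y y≤1 (suc m) N = begin
    (w * w ^ m) * expSum (suc N) (ι (suc m) * y)
      ≡⟨ cong (λ t → (w * w ^ m) * expSum (suc N) t) split ⟩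
    (w * w ^ m) * expSum (suc N) (y + ι m * y)
      ≤⟨ ℚ.*-monoˡ-≤-nonNeg (w * w ^ m) {{nonNegative (*-nonNeg 0≤w (^-nonNeg 0≤w m))}}
                                                                       (expSum-+≤ 0≤y (*-nonNeg (0≤ι m) 0≤y) (suc N)) ⟩
    (w * w ^ m) * (expSum (suc N) y * expSum (suc N) (ι m * y))
      ≡⟨ solve 4 (λ w v e f → (w :* v) :* (e :* f) := (w :* e) :* (v :* f)) refl
                                                                       w (w ^ m) (expSum (suc N) y) (expSum (suc N) (ι m * y)) ⟩
    (w * expSum (suc N) y) * (w ^ m * expSum (suc N) (ι m * y))
      ≤⟨ *-mono 0≤1 0≤tail (ℚ.≤-trans ([1-y]expSum≤ 0≤y y≤1 (suc N)) 1-≤1) ([1-y]^expSum≤1 0≤y y≤1 m N) ⟩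
    1ℚ                                                            ∎
    where
    open ℚ.≤-Reasoning
    w = 1ℚ - y
    0≤w : 0ℚ ≤ w
    0≤w = ≤⇒0≤- y≤1
    0≤tail : 0ℚ ≤ w ^ m * expSum (suc N) (ι m * y)
    0≤tail = *-nonNeg (^-nonNeg 0≤w m) (ℚ.≤-trans 0≤1 (1≤expSum (*-nonNeg (0≤ι m) 0≤y) N))
    split : ι (suc m) * y ≡ y + ι m * y
    split = trans (cong (_* y) (ι-+ 1 m)) (solve 2 (λ i y → (con 1ℚ :+ i) :* y := y :+ i :* y) refl (ι m) y)
    1-≤1 : 1ℚ - y ^ suc N ≤ 1ℚ
    1-≤1 = 0≤-⇒≤ (subst (0ℚ ≤_) (solve 1 (λ z → z := con 1ℚ :- (con 1ℚ :- z)) refl (y ^ suc N)) (^-nonNeg 0≤y (suc N)))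

  -- Partial sums at `t` and `−t` are inverse only up to the pairs of terms missing from the Cauchy
  -- product. Their total is bounded through `b` instead of `t`, because `t` will vary with the
  -- approximation of `p`.
  expSum-neg : ∀ {t b} → 0ℚ ≤ t → t ≤ b → ∀ N →
    1ℚ - (expSum (suc N ℕ.+ suc N) (b + b) - expSum (suc N) (b + b)) ≤ expSum (suc N) t * expSum (suc N) (- t)
  expSum-neg {t} {b} 0≤t t≤b N = begin
    1ℚ - (expSum (M ℕ.+ M) (b + b) - expSum M (b + b))
      ≤⟨ ℚ.+-monoʳ-≤ 1ℚ (ℚ.neg-antimono-≤ error≤) ⟩
    1ℚ - ∣ u * v - 1ℚ ∣
      ≤⟨ ℚ.+-monoʳ-≤ 1ℚ (ℚ.neg-antimono-≤ (subst (_≤ ∣ u * v - 1ℚ ∣) (solve 1 (λ z → :- (z :- con 1ℚ) := con 1ℚ :- z) refl (u * v))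
           (subst (- (u * v - 1ℚ) ≤_) (ℚ.∣-p∣≡∣p∣ (u * v - 1ℚ)) (p≤∣p∣ (- (u * v - 1ℚ)))))) ⟩
    1ℚ - (1ℚ - u * v)
      ≡⟨ solve 1 (λ z → con 1ℚ :- (con 1ℚ :- z) := z) refl (u * v) ⟩
    u * v ∎
    where
    open ℚ.≤-Reasoning
    M = suc N
    u = expSum M t
    v = expSum M (- t)
    ∣t∣≤t : ∣ t ∣ ≤ t
    ∣t∣≤t = ℚ.≤-reflexive (ℚ.0≤p⇒∣p∣≡p 0≤t)
    error≤ : ∣ u * v - 1ℚ ∣ ≤ expSum (M ℕ.+ M) (b + b) - expSum M (b + b)
    error≤ = begin
      ∣ u * v - 1ℚ ∣
        ≡⟨ cong (λ z → ∣ u * v - z ∣) (trans (cong (expSum M) (ℚ.+-inverseʳ t)) (expSum-0 N)) ⟨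
      ∣ u * v - expSum M (t + - t) ∣
        ≤⟨ expSum-product ∣t∣≤t (subst (_≤ t) (sym (ℚ.∣-p∣≡∣p∣ t)) ∣t∣≤t) M ⟩
      expSum M t * expSum M t - expSum M (t + t)
        ≤⟨ ℚ.+-monoˡ-≤ (- expSum M (t + t)) (expSum-product≤ 0≤t 0≤t M) ⟩
      expSum (M ℕ.+ M) (t + t) - expSum M (t + t)
        ≤⟨ ℚ.≤-trans (p≤∣p∣ _) (expSum-tail (subst (_≤ b + b) (sym (ℚ.0≤p⇒∣p∣≡p (+-nonNeg 0≤t 0≤t))) (ℚ.+-mono-≤ t≤b t≤b)) M M) ⟩
      expSum (M ℕ.+ M) (b + b) - expSum M (b + b)  ∎

  -- With `W` the power, `W u ≤ 1 ≤ u v + ε ≤ u (v + ε)`, and `u ≥ 1` cancels.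
  power≤expSum-neg : ∀ {y t b} m → 0ℚ ≤ y → y ≤ 1ℚ → 0ℚ ≤ t → t ≤ ι m * y → t ≤ b → ∀ N →
    (1ℚ - y) ^ m ≤ expSum (suc N) (- t) + (expSum (suc N ℕ.+ suc N) (b + b) - expSum (suc N) (b + b))
  power≤expSum-neg {y} {t} {b} m 0≤y y≤1 0≤t t≤my t≤b N =
    ℚ.*-cancelˡ-≤-pos u {{positive (ℚ.<-≤-trans 0<1 1≤u)}} (begin
      u * W                       ≡⟨ ℚ.*-comm u W ⟩
      W * u
        ≤⟨ ℚ.*-monoˡ-≤-nonNeg W {{nonNegative (^-nonNeg (≤⇒0≤- y≤1) m)}} (expSum-monoˡ 0≤t t≤my M) ⟩
      W * expSum M (ι m * y)      ≤⟨ [1-y]^expSum≤1 0≤y y≤1 m N ⟩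
      1ℚ                          ≡⟨ solve 1 (λ e → con 1ℚ := (con 1ℚ :- e) :+ e) refl ε ⟩
      (1ℚ - ε) + ε                ≤⟨ ℚ.+-mono-≤ (expSum-neg 0≤t t≤b N) ε≤uε ⟩
      u * v + u * ε               ≡⟨ ℚ.*-distribˡ-+ u v ε ⟨
      u * (v + ε)                 ∎)
    where
    open ℚ.≤-Reasoning
    M = suc N
    W = (1ℚ - y) ^ m
    u = expSum M t
    v = expSum M (- t)
    ε = expSum (M ℕ.+ M) (b + b) - expSum M (b + b)
    1≤u = 1≤expSum 0≤t N
    0≤b = ℚ.≤-trans 0≤t t≤b
    ε≤uε : ε ≤ u * ε
    ε≤uε = subst (_≤ u * ε) (ℚ.*-identityˡ ε)
      (ℚ.*-monoʳ-≤-nonNeg ε {{nonNegative (≤⇒0≤- (expSum-mono (+-nonNeg 0≤b 0≤b) M M))}} 1≤u)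

  expSum-tail-vanishes : ∀ {b C} → 0ℚ ≤ b → 0ℚ < C → ∀ ε → 0ℚ < ε →
    ∃ λ N₀ → ∀ N → N₀ ℕ.≤ N → C * (expSum (N ℕ.+ N) b - expSum N b) ≤ ε
  expSum-tail-vanishes {b} {C} 0≤b 0<C ε 0<ε =
    proj₁ close , λ N N₀≤N → begin
      C * (expSum (N ℕ.+ N) b - expSum N b)
        ≤⟨ ℚ.*-monoˡ-≤-nonNeg C {{nonNegative (ℚ.<⇒≤ 0<C)}} (p≤∣p∣ (expSum (N ℕ.+ N) b - expSum N b)) ⟩
      C * ∣ expSum (N ℕ.+ N) b - expSum N b ∣
        ≤⟨ ℚ.*-monoˡ-≤-nonNeg C {{nonNegative (ℚ.<⇒≤ 0<C)}} (ℚ.<⇒≤ (proj₂ close (N ℕ.+ N) N (ℕ.≤-trans N₀≤N (ℕ.m≤m+n N N)) N₀≤N)) ⟩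
      C * (ε * (1/ C) {{>-nonZero 0<C}})
        ≡⟨ *-1/ 0<C ε ⟩
      ε ∎
    where
    open ℚ.≤-Reasoning
    close = expSum-cauchy-const b 0≤b (ε * (1/ C) {{>-nonZero 0<C}}) (*-pos 0<ε (1/-pos 0<C))

open Exponential

-- Both bounds at a rational parameter

module Reciprocal where

  open Data.Rational.Base hiding (truncate)

  inv-bounds : ∀ {w} → 1ℚ ≤ w → w * inv w ≡ 1ℚ × 0ℚ ≤ inv w × inv w ≤ 1ℚ
  inv-bounds {w} 1≤w with w ℚ.≟ 0ℚ
  ... | yes refl = contradiction (ℚ.<-≤-trans 0<1 1≤w) (ℚ.<-irrefl refl)
  ... | no w≢0 = ℚ.*-inverseʳ w {{≢-nonZero w≢0}} , 0≤i , (begin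
      i        ≡⟨ ℚ.*-identityʳ i ⟨
      i * 1ℚ   ≤⟨ ℚ.*-monoˡ-≤-nonNeg i {{nonNegative 0≤i}} 1≤w ⟩
      i * w    ≡⟨ ℚ.*-inverseˡ w {{≢-nonZero w≢0}} ⟩
      1ℚ       ∎)
    where
    open ℚ.≤-Reasoning
    i = (1/ w) {{≢-nonZero w≢0}}
    0≤i : 0ℚ ≤ i
    0≤i = ℚ.<⇒≤ (ℚ.positive⁻¹ i {{ℚ.1/pos⇒pos w {{positive (ℚ.<-≤-trans 0<1 1≤w)}}}})


open Reciprocal

module Approximation (p : ℝ) (κ k : ℕ) (0≤P : 0ℚ ℚ.≤ seq p k) (P≤1 : seq p k ℚ.≤ 1ℚ) where

  open Data.Rational.Base hiding (truncate)
  open Expectation (seq p k) 0≤P P≤1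
  open OddClusters κ
  open Loss p k 0≤P P≤1

  P : ℚ
  P = seq p k

  o : ℚ
  o = inv (ι 2 - x)

  z : ℚ
  z = 1ℚ - x

  c : ℚ
  c = (z * (z * 1ℚ)) * o

  o-bounds : (ι 2 - x) * o ≡ 1ℚ × 0ℚ ≤ o × o ≤ 1ℚ
  o-bounds = inv-bounds {ι 2 - x} (0≤-⇒≤ (subst (0ℚ ≤_) (solve 1 (λ x → con 1ℚ :- x := (con 1ℚ :+ con 1ℚ :- x) :- con 1ℚ) refl x) (≤⇒0≤- x≤1)))

  0≤o = proj₁ (proj₂ o-bounds)
  o≤1 = proj₂ (proj₂ o-bounds)

  0≤z : 0ℚ ≤ z
  0≤z = ≤⇒0≤- x≤1

  0≤c : 0ℚ ≤ c
  0≤c = *-nonNeg (*-nonNeg 0≤z (*-nonNeg 0≤z 0≤1)) 0≤o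

  -- The lower bound is obtained with `o` in place of `c`; the square is given away here.
  c≤o : c ≤ o
  c≤o = begin
    (z * (z * 1ℚ)) * o
      ≤⟨ ℚ.*-monoʳ-≤-nonNeg o {{nonNegative 0≤o}} (*-mono 0≤1 (*-nonNeg 0≤z 0≤1) z≤1 (*-mono 0≤1 0≤1 z≤1 ℚ.≤-refl)) ⟩
    1ℚ * o               ≡⟨ ℚ.*-identityˡ o ⟩
    o                    ∎
    where
    open ℚ.≤-Reasoning
    z≤1 : z ≤ 1ℚ
    z≤1 = 0≤-⇒≤ (subst (0ℚ ≤_) (solve 1 (λ x → x := con 1ℚ :- (con 1ℚ :- x)) refl x) 0≤x)

  0≤nPx : ∀ n → 0ℚ ≤ ι n * P * x
  0≤nPx n = *-nonNeg (*-nonNeg (0≤ι n) 0≤P) 0≤x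

  upper : ∀ n → seq (L p (chain n K)) k ≤ (ι n * P * x) * (c + x + 1ℚ) + 1ℚ
  upper n = begin
    seq (L p (chain n K)) k                 ≤⟨ L-chain≤ n K ⟩
    ι n * (P * x) + 1ℚ                      ≤⟨ ≤-step (*-nonNeg (0≤nPx n) (+-nonNeg 0≤c 0≤x)) ⟩
    ι n * (P * x) + 1ℚ + (ι n * P * x) * (c + x)
      ≡⟨ solve 5 (λ n P x c d → n :* (P :* x) :+ con 1ℚ :+ (n :* P :* x) :* (c :+ d) := (n :* P :* x) :* (c :+ d :+ con 1ℚ) :+ con 1ℚ) refl (ι n) P x c x ⟩
    (ι n * P * x) * (c + x + 1ℚ) + 1ℚ       ∎
    where open ℚ.≤-Reasoning

  exponent : ℕ → ℚ
  exponent n = (ι n - ι 3 * ι K - ι 2) * P * x * inv (ι 2)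

  i≥0 : 0ℚ ≤ inv (ι 2)
  i≥0 = proj₁ (proj₂ (inv-bounds {ι 2} (ι-mono {1} {2} (s≤s z≤n))))

  i≤1 : inv (ι 2) ≤ 1ℚ
  i≤1 = proj₂ (proj₂ (inv-bounds {ι 2} (ι-mono {1} {2} (s≤s z≤n))))

  -1≤L : ∀ m → - 1ℚ ≤ seq (L p (chain (suc m) K)) k
  -1≤L m = begin
    - 1ℚ                                              ≡⟨ ℚ.+-identityˡ (- 1ℚ) ⟨
    0ℚ - 1ℚ                                           ≡⟨ cong (_- 1ℚ) (E-const (suc m) 0ℚ) ⟨
    E (suc m) (λ _ → 0ℚ) - 1ℚ
      ≤⟨ ℚ.+-monoˡ-≤ (- 1ℚ) (E-mono (suc m) (λ D → 0≤ι (oddEnds D κ))) ⟩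
    E (suc m) (λ D → ι (oddEnds D κ)) - 1ℚ            ≤⟨ L-chain≥ m κ ⟩
    seq (L p (chain (suc m) K)) k                     ∎
    where open ℚ.≤-Reasoning

  -- The argument of the exponential is nonnegative here, so its partial sum is at least `1 ≥ c`.
  -- The bracket is then at most 0, and the left side at most -1.
  lower-small : ∀ m N → suc m ℕ.≤ 3 ℕ.* K ℕ.+ 2 →
    (ι (suc m) * P * x) * (c - expSum (suc N) (- exponent (suc m))) - 1ℚ ≤ seq (L p (chain (suc m) K)) k
  lower-small m N n≤ = ℚ.≤-trans (begin
    (ι n * P * x) * (c - e) - 1ℚ
      ≤⟨ ℚ.+-monoˡ-≤ (- 1ℚ) (ℚ.*-monoˡ-≤-nonNeg (ι n * P * x) {{nonNegative (0≤nPx n)}} c-e≤0) ⟩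
    (ι n * P * x) * 0ℚ - 1ℚ        ≡⟨ cong (_- 1ℚ) (ℚ.*-zeroʳ (ι n * P * x)) ⟩
    0ℚ - 1ℚ                        ≡⟨ ℚ.+-identityˡ (- 1ℚ) ⟩
    - 1ℚ                           ∎) (-1≤L m)
    where
    open ℚ.≤-Reasoning
    n = suc m
    e = expSum (suc N) (- exponent n)
    s = ι 3 * ι K + ι 2 - ι n
    0≤s : 0ℚ ≤ s
    0≤s = ≤⇒0≤- (subst (ι n ≤_) (trans (ι-+ (3 ℕ.* K) 2) (cong (_+ ι 2) (ι-* 3 K))) (ι-mono n≤))
    0≤-exponent : 0ℚ ≤ - exponent n
    0≤-exponent = subst (0ℚ ≤_)
      (solve 7 (λ n t K u P x i → ((t :* K :+ u :- n) :* P :* x) :* i := :- ((n :- t :* K :- u) :* P :* x :* i)) refl (ι n) (ι 3) (ι K) (ι 2) P x (inv (ι 2)))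
      (*-nonNeg (*-nonNeg (*-nonNeg 0≤s 0≤P) 0≤x) i≥0)
    c-e≤0 : c - e ≤ 0ℚ
    c-e≤0 = begin
      c - e    ≤⟨ ℚ.+-mono-≤ (ℚ.≤-trans c≤o o≤1) (ℚ.neg-antimono-≤ (1≤expSum 0≤-exponent N)) ⟩
      1ℚ - 1ℚ  ≡⟨ ℚ.+-inverseʳ 1ℚ ⟩
      0ℚ       ∎

  module _ (r : ℕ) where

    private
      -- `r` is `n − 3K − 2`, and `n = 1 + K + (K + j)` has the form that `E-oddEnds≥` requires.
      j = suc K ℕ.+ r
      m = K ℕ.+ (K ℕ.+ j)
      n = suc m
      t = exponent n
      W = (1ℚ - P * x) ^ℚ j

    -- The error of `power≤expSum-neg` for the bound `b = n`, independent of `p`.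
    tail : ℕ → ℚ
    tail N = expSum (suc N ℕ.+ suc N) (ι n + ι n) - expSum (suc N) (ι n + ι n)

    ι-n : ι n - ι 3 * ι K - ι 2 ≡ ι r
    ι-n = begin
      ι n - ι 3 * ι K - ι 2
        ≡⟨ cong (λ y → y - ι 3 * ι K - ι 2) (trans (ι-+ 1 m) (cong (1ℚ +_) (trans (ι-+ K (K ℕ.+ j)) (cong (ι K +_)
             (trans (ι-+ K j) (cong (ι K +_) (trans (ι-+ 1 (K ℕ.+ r)) (cong (1ℚ +_) (ι-+ K r))))))))) ⟩
      1ℚ + (ι K + (ι K + (1ℚ + (ι K + ι r)))) - ι 3 * ι K - ι 2
        ≡⟨ solve 2 (λ K r → con 1ℚ :+ (K :+ (K :+ (con 1ℚ :+ (K :+ r)))) :- (con 1ℚ :+ con 1ℚ :+ con 1ℚ) :* K :- (con 1ℚ :+ con 1ℚ) := r) refl (ι K) (ι r) ⟩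
      ι r ∎
      where open ≡-Reasoning

    t≡ : t ≡ ι r * P * x * inv (ι 2)
    t≡ = cong (λ y → y * P * x * inv (ι 2)) ι-n

    0≤t : 0ℚ ≤ t
    0≤t = subst (0ℚ ≤_) (sym t≡) (*-nonNeg (0≤nPx r) i≥0)

    t≤rPx : t ≤ ι r * (P * x)
    t≤rPx = begin
      t                           ≡⟨ t≡ ⟩
      ι r * P * x * inv (ι 2)
        ≤⟨ ℚ.*-monoˡ-≤-nonNeg (ι r * P * x) {{nonNegative (0≤nPx r)}} i≤1 ⟩
      ι r * P * x * 1ℚ
        ≡⟨ solve 3 (λ r P x → r :* P :* x :* con 1ℚ := r :* (P :* x)) refl (ι r) P x ⟩
      ι r * (P * x)               ∎
      where open ℚ.≤-Reasoning

    Px≤1 : P * x ≤ 1ℚ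
    Px≤1 = *-mono 0≤1 0≤x P≤1 x≤1

    -- Two losses are accepted here: the factor 1/2 in the exponent, and `K + 1` of the `j` steps.
    t≤jPx : t ≤ ι j * (P * x)
    t≤jPx = ℚ.≤-trans t≤rPx (ℚ.*-monoʳ-≤-nonNeg (P * x) {{nonNegative (*-nonNeg 0≤P 0≤x)}} (ι-mono (ℕ.m≤n+m r (suc K))))

    r≤n : r ℕ.≤ n
    r≤n = ℕ.≤-trans (ℕ.m≤n+m r (suc K)) (ℕ.≤-trans (ℕ.m≤n+m j K) (ℕ.≤-trans (ℕ.m≤n+m (K ℕ.+ j) K) (ℕ.n≤1+n m)))

    t≤n : t ≤ ι n
    t≤n = begin
      t              ≤⟨ t≤rPx ⟩
      ι r * (P * x)  ≤⟨ *-mono (0≤ι n) (*-nonNeg 0≤P 0≤x) (ι-mono r≤n) Px≤1 ⟩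
      ι n * 1ℚ       ≡⟨ ℚ.*-identityʳ (ι n) ⟩
      ι n            ∎
      where open ℚ.≤-Reasoning

    0≤tail : ∀ N → 0ℚ ≤ tail N
    0≤tail N = ≤⇒0≤- (expSum-mono (+-nonNeg (0≤ι n) (0≤ι n)) (suc N) (suc N))

    lower-large : ∀ N → (ι n * P * x) * (c - expSum (suc N) (- t)) - 1ℚ ≤ seq (L p (chain n K)) k + ι n * tail N
    lower-large N = begin
      (ι n * P * x) * (c - e) - 1ℚ
        ≤⟨ ℚ.+-monoˡ-≤ (- 1ℚ) (ℚ.*-monoˡ-≤-nonNeg (ι n * P * x) {{nonNegative (0≤nPx n)}} (ℚ.+-mono-≤ c≤o (ℚ.neg-antimono-≤ W-tail≤e))) ⟩
      (ι n * P * x) * (o - (W - tail N)) - 1ℚ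
        ≡⟨ solve 6 (λ n P x o W s → (n :* P :* x) :* (o :- (W :- s)) :- con 1ℚ := n :* (P :* (x :* (o :- W))) :- con 1ℚ :+ n :* (P :* x :* s)) refl (ι n) P x o W (tail N) ⟩
      ι n * (P * (x * (o - W))) - 1ℚ + ι n * (P * x * tail N)
        ≤⟨ ℚ.+-mono-≤ (ℚ.≤-trans (ℚ.+-monoˡ-≤ (- 1ℚ) (E-oddEnds≥ o (proj₁ o-bounds) 0≤o o≤1 j)) (L-chain≥ m κ))
                      (ℚ.*-monoˡ-≤-nonNeg (ι n) {{nonNegative (0≤ι n)}} (ℚ.*-monoʳ-≤-nonNeg (tail N) {{nonNegative (0≤tail N)}} Px≤1)) ⟩
      seq (L p (chain n K)) k + ι n * (1ℚ * tail N)
        ≡⟨ cong (λ y → seq (L p (chain n K)) k + ι n * y) (ℚ.*-identityˡ (tail N)) ⟩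
      seq (L p (chain n K)) k + ι n * tail N ∎
      where
      open ℚ.≤-Reasoning
      e = expSum (suc N) (- t)
      W-tail≤e : W - tail N ≤ e
      W-tail≤e = begin
        W - tail N
          ≤⟨ ℚ.+-monoˡ-≤ (- tail N) (power≤expSum-neg j (*-nonNeg 0≤P 0≤x) Px≤1 0≤t t≤jPx t≤n N) ⟩
        e + tail N - tail N   ≡⟨ solve 2 (λ e s → e :+ s :- s := e) refl e (tail N) ⟩
        e                     ∎

large : ∀ K n → 3 ℕ.* K ℕ.+ 2 ℕ.≤ n → ∃ λ r → n ≡ suc (K ℕ.+ (K ℕ.+ (suc K ℕ.+ r)))
large K n 3K+2≤n = n ℕ.∸ (3 ℕ.* K ℕ.+ 2) , trans (sym (ℕ.m+[n∸m]≡n 3K+2≤n)) (rearrange K _)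
  where
  rearrange : ∀ K r → 3 ℕ.* K ℕ.+ 2 ℕ.+ r ≡ suc (K ℕ.+ (K ℕ.+ (suc K ℕ.+ r)))
  rearrange = solve-∀

-- Passage to real parameters

open Defs using (_+_; _*_; _-_; -_; _≤_; _<_; _^_)

-- Spelled as the `k`-th term of the stated bound unfolds, including the factor `1ℚ` from the
-- square, so that the final proof needs no conversion. `X` is kept apart because `seq-^` is needed
-- to turn the `k`-th term of the real power into a rational power.
lowerValue : (n K : ℕ) (P X : ℚ) (k : ℕ) → ℚ
lowerValue n K P X k = (ι n ℚ.* P ℚ.* X) ℚ.* ((1ℚ ℚ.- X) ℚ.* ((1ℚ ℚ.- X) ℚ.* 1ℚ) ℚ.* inv (ι 2 ℚ.- X)
  ℚ.- expSum k (ℚ.- ((ι n ℚ.- ι 3 ℚ.* ι K ℚ.- ι 2) ℚ.* P ℚ.* X ℚ.* inv (ι 2)))) ℚ.- 1ℚ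

upperValue : (n : ℕ) (P X : ℚ) → ℚ
upperValue n P X = (ι n ℚ.* P ℚ.* X) ℚ.* ((1ℚ ℚ.- X) ℚ.* ((1ℚ ℚ.- X) ℚ.* 1ℚ) ℚ.* inv (ι 2 ℚ.- X) ℚ.+ X ℚ.+ 1ℚ) ℚ.+ 1ℚ

eventually-01 : ∀ p → 0ℝ < p → p < 1ℝ → ∃ λ N → ∀ k → N ℕ.≤ k → 0ℚ ℚ.≤ seq p k × seq p k ℚ.≤ 1ℚ
eventually-01 p (ε , 0<ε , N , lo) (ε′ , 0<ε′ , N′ , hi) = N ℕ.⊔ N′ , λ k ≤k →
  ℚ.≤-trans (≤-step {0ℚ} (ℚ.<⇒≤ 0<ε)) (lo k (ℕ.m⊔n≤o⇒m≤o N N′ ≤k)) ,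
  ℚ.≤-trans (≤-step {seq p k} (ℚ.<⇒≤ 0<ε′)) (hi k (ℕ.m⊔n≤o⇒n≤o N N′ ≤k))

Lower : ℝ → ℕ → ℕ → ℕ → ℚ → Set
Lower p κ m k ε = lowerValue (suc m) (suc κ) (seq p k) ((1ℚ ℚ.- seq p k) Sequences.^ suc κ) k
                  ℚ.≤ seq (L p (chain (suc m) (suc κ))) k ℚ.+ ε

-- The equation for `n` is an argument so that it can be matched with `refl`; `lower-large` speaks
-- only of `n` in this form.
lower-large-at : ∀ p κ k ε → 0ℚ ℚ.≤ seq p (suc k) → seq p (suc k) ℚ.≤ 1ℚ → ∀ m r →
  suc m ≡ suc (suc κ ℕ.+ (suc κ ℕ.+ (suc (suc κ) ℕ.+ r))) →
  ι (suc m) ℚ.* (expSum (suc k ℕ.+ suc k) (ι (suc m) ℚ.+ ι (suc m)) ℚ.- expSum (suc k) (ι (suc m) ℚ.+ ι (suc m))) ℚ.≤ ε →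
  Lower p κ m (suc k) ε
lower-large-at p κ k ε 0≤P P≤1 m r refl tail≤ε =
  ℚ.≤-trans (Approximation.lower-large p κ (suc k) 0≤P P≤1 r k)
    (ℚ.+-monoʳ-≤ (seq (L p (chain (suc m) (suc κ))) (suc k)) tail≤ε)

lower-eventually : ∀ p → 0ℝ < p → p < 1ℝ → ∀ κ m ε → 0ℚ ℚ.< ε → ∃ λ N → ∀ k → N ℕ.≤ k →
  lowerValue (suc m) (suc κ) (seq p k) (seq ((1ℝ - p) ^ suc κ) k) k ℚ.≤ seq (L p (chain (suc m) (suc κ))) k ℚ.+ ε
lower-eventually p 0<p p<1 κ m ε 0<ε = N ℕ.⊔ suc N₀ , λ k ≤k →
  subst (λ X → lowerValue (suc m) (suc κ) (seq p k) X k ℚ.≤ seq (L p (chain (suc m) (suc κ))) k ℚ.+ ε) (sym (seq-^ (1ℝ - p) (suc κ) k))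
    (at k (proj₂ (eventually-01 p 0<p p<1) k (ℕ.m⊔n≤o⇒m≤o N _ ≤k)) (ℕ.m⊔n≤o⇒n≤o N _ ≤k) (3 ℕ.* suc κ ℕ.+ 2 ℕ.≤? suc m))
  where
  N = proj₁ (eventually-01 p 0<p p<1)
  tail = expSum-tail-vanishes {ι (suc m) ℚ.+ ι (suc m)} (+-nonNeg (0≤ι (suc m)) (0≤ι (suc m))) (0<ι m) ε 0<ε
  N₀ = proj₁ tail
  at : ∀ k → 0ℚ ℚ.≤ seq p k × seq p k ℚ.≤ 1ℚ → suc N₀ ℕ.≤ k → Dec (3 ℕ.* suc κ ℕ.+ 2 ℕ.≤ suc m) → Lower p κ m k ε
  -- The index 0 is excluded by `suc N₀ ≤ k`: there the partial sum is empty and lacks the leading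
  -- term 1 on which both cases rely.
  at (suc k) (0≤P , P≤1) N₀≤k (no small) =
    ℚ.≤-trans (Approximation.lower-small p κ (suc k) 0≤P P≤1 m k (ℕ.<⇒≤ (ℕ.≰⇒> small))) (≤-step (ℚ.<⇒≤ 0<ε))
  at (suc k) (0≤P , P≤1) N₀≤k (yes big) = lower-large-at p κ k ε 0≤P P≤1 m
    (proj₁ (large (suc κ) (suc m) big)) (proj₂ (large (suc κ) (suc m) big)) (proj₂ tail (suc k) (ℕ.<⇒≤ N₀≤k))

upper-eventually : ∀ p → 0ℝ < p → p < 1ℝ → ∀ κ m ε → 0ℚ ℚ.< ε → ∃ λ N → ∀ k → N ℕ.≤ k →
  seq (L p (chain (suc m) (suc κ))) k ℚ.≤ upperValue (suc m) (seq p k) (seq ((1ℝ - p) ^ suc κ) k) ℚ.+ ε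
upper-eventually p 0<p p<1 κ m ε 0<ε = proj₁ bounds , λ k N≤k →
  subst (λ X → seq (L p (chain (suc m) (suc κ))) k ℚ.≤ upperValue (suc m) (seq p k) X ℚ.+ ε) (sym (seq-^ (1ℝ - p) (suc κ) k))
    (let 0≤P , P≤1 = proj₂ bounds k N≤k
     in ℚ.≤-trans (Approximation.upper p κ k 0≤P P≤1 (suc m)) (≤-step (ℚ.<⇒≤ 0<ε)))
  where bounds = eventually-01 p 0<p p<1

theoremC1 :
    ∀ (p : ℝ) (0<p : 0ℝ < p) (p<1 : p < 1ℝ) (K n : ℕ) → 0 ℕ.< K → 0 ℕ.< n →
    let q = 1ℝ - p
        npqᴷ = fromℕ n * p * q ^ K
        c = (1ℝ - q ^ K) ^ 2 ÷ (2ℝ - q ^ K) [ 0<2-q^ p 0<p p<1 K ]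
        x = (fromℕ n - 3ℝ * fromℕ K - 2ℝ) * p * q ^ K ÷ 2ℝ [ 0<2 ]
    in (npqᴷ * (c - exp (- x)) - 1ℝ ≤ L p (chain n K))
       × (L p (chain n K) ≤ npqᴷ * (c + q ^ K + 1ℝ) + 1ℝ)
theoremC1 p 0<p p<1 (suc κ) (suc m) _ _ =
  lower-eventually p 0<p p<1 κ m , upper-eventually p 0<p p<1 κ m
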